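{- There exists an absolute constant $c>0$ such that for all integers $n,t\geq 2$, $$\log_2 A(t,n)\leq \left(1+c\cdot \frac{(\log n)^3}{n}\right)\cdot \alpha(t,n).$$
   Context: For an integer $t\geq 2$ write $[t]=\{0,1,\dots,t-1\}$. The hypergrid $[t]^n$ is the poset on $[t]^n$ with the coordinate-wise order: $x\preceq y$ iff $x(i)\leq y(i)$ for all $i=1,\dots,n$. An antichain is a set of pairwise incomparable elements. $\alpha(t,n)$ denotes the width of $[t]^n$ (the maximum size of an antichain), and $A(t,n)$ denotes the total number of antichains of $[t]^n$ (including the empty set). -}

module Defs where

open import Data.Nat using (ℕ; zero; suc; _⊔_)
open import Data.Fin using (Fin)
import Data.Fin as F
open import Data.Fin.Properties using () renaming (_≤?_ to _≤F?_)
open import Data.Vec using (Vec; []; _∷_)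
open import Data.Vec.Relation.Binary.Pointwise.Inductive using (Pointwise; decidable)
open import Data.List using (List; []; _∷_; [_]; _++_; map; concatMap; filter; length; foldr; allFin)
open import Data.List.Relation.Unary.AllPairs using (AllPairs; allPairs?)
open import Data.Product using (_×_)
open import Relation.Nullary using (¬_; Dec; _×-dec_; ¬?)

Point : ℕ → ℕ → Set
Point t n = Vec (Fin t) n

_≼_ : ∀ {t n} → Point t n → Point t n → Set
_≼_ = Pointwise F._≤_

_≼?_ : ∀ {t n} (x y : Point t n) → Dec (x ≼ y)
_≼?_ = decidable _≤F?_

Incomparable : ∀ {t n} → Point t n → Point t n → Set
Incomparable x y = ¬ (x ≼ y) × ¬ (y ≼ x)

incomparable? : ∀ {t n} (x y : Point t n) → Dec (Incomparable x y)
incomparable? x y = ¬? (x ≼? y) ×-dec ¬? (y ≼? x)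

points : (t n : ℕ) → List (Point t n)
points t zero = [ [] ]
points t (suc n) = concatMap (λ i → map (i ∷_) (points t n)) (allFin t)

-- all sublists (= all subsets, since the input list has no repetitions)
subsets : ∀ {a} {A : Set a} → List A → List (List A)
subsets [] = [ [] ]
subsets (x ∷ xs) = subsets xs ++ map (x ∷_) (subsets xs)

IsAntichain : ∀ {t n} → List (Point t n) → Set
IsAntichain = AllPairs Incomparable

antichains : (t n : ℕ) → List (List (Point t n))
antichains t n = filter (allPairs? incomparable?) (subsets (points t n))

A : ℕ → ℕ → ℕ
A t n = length (antichains t n)

α : ℕ → ℕ → ℕ
α t n = foldr _⊔_ 0 (map length (antichains t n))

{-# OPTIONS --safe #-}
module Submission where

-- A Markov chain climbing [t]^n one step at a time, uniformly distributed on each layer, meets a set F of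
-- (1 + ε) α points in at least 1 + ε points on average.  If every step has probability at most K / n, then F
-- contains a point comparable to at least about ε n / K others.  Branching on such points bounds the number of
-- antichains of a set of size poly(n) α by 2 ^ ((1 + O(K (log n)² / n)) α), since halving the excess ε always
-- costs O(K α log n / n) bits.
--
-- The chain with K = O(log n) treats the coordinates in a cyclic order starting at a random place: given that
-- the remaining m coordinates have to gain one, the first of them gains it with the unique probability that
-- respects uniformity, and otherwise the question is passed on.  Layer sizes are log-concave and nearly constant
-- on windows of length t, so this probability is O(1 / m) unless the remaining coordinates are atypical, and
-- the average over the rotations is (1 / n) Σ O(1 / m).
--
-- Planes spanned by two coordinates serve twice.  An antichain of [t]² has at most 16 ^ t possible values, which
-- makes the traces of an antichain on the few planes with atypical remaining coordinates negligible; and coarsening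
-- each plane into blocks of side n² confines the antichain to poly(n) α points at negligible cost, so that
-- no power of log t appears.

open import Defs
open import Data.Bool using (Bool; true; false; not; _∧_)
open import Data.Empty using (⊥; ⊥-elim)
open import Data.Fin using (Fin; toℕ)
import Data.Fin as Fin
import Data.Fin.Properties as Fin
open import Data.List using (List; []; _∷_; [_]; _++_; map; concatMap; filter; length; foldr; take; drop; downFrom; allFin; tabulate)
open import Data.List.Membership.Propositional using (_∈_)
open import Data.List.Membership.Propositional.Properties using (∈-downFrom⁺; ∈-downFrom⁻; ∈-map⁺; ∈-map⁻; ∈-++⁺ˡ; ∈-++⁺ʳ; ∈-++⁻; ∈-filter⁺)
open import Data.List.Properties using (length-map; length-++; ++-assoc; ++-identityʳ; length-take; length-drop; take++drop≡id; ≡-dec; ∷ʳ-injective)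
open import Data.List.Relation.Unary.All using (All; []; _∷_)
import Data.List.Relation.Unary.All as All
import Data.List.Relation.Unary.All.Properties as All
open import Data.List.Relation.Unary.AllPairs using (AllPairs; []; _∷_; allPairs?)
open import Data.List.Relation.Unary.Any using (here; there)
open import Data.List.Relation.Binary.Pointwise using (Pointwise; []; _∷_)
import Data.List.Relation.Binary.Pointwise as Pointwise
open import Data.List.Relation.Unary.Unique.Propositional using (Unique)
import Data.List.Relation.Unary.Unique.Propositional.Properties as Unique
open import Data.Nat using (ℕ; zero; suc; pred; _+_; _*_; _∸_; _^_; _≤_; _<_; _≡ᵇ_; z≤n; s≤s; _⊔_; _!; NonZero; >-nonZero; ≢-nonZero; _≟_; _≤?_; _<?_; ⌊_/2⌋; ⌈_/2⌉)
open import Data.Nat.Divisibility using (divides; m≤n⇒m!∣n!; m∣m*n; ∣-trans)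
open import Data.Nat.DivMod using (_/_; _%_; m/n*n≤m; /-monoˡ-≤; m≡m%n+[m/n]*n; m%n<n; m*n/n≡m)
open import Data.Nat.Induction using (<-rec)
open import Data.Nat.ListAction using (sum)
open import Data.Nat.ListAction.Properties using (sum-++)
open import Data.Nat.Logarithm using (⌈log₂_⌉; ⌈log₂⌉-mono-≤; ⌈log₂2^n⌉≡n; ⌈log₂⌈n/2⌉⌉≡⌈log₂n⌉∸1)
open import Data.Nat.Properties hiding (_≟_; _≤?_; _<?_)
open import Data.Nat.Tactic.RingSolver using (solve-∀)
open import Data.Product using (Σ; ∃; _×_; _,_; proj₁; proj₂)
open import Data.Sum using (_⊎_; inj₁; inj₂)
open import Data.Unit using (tt)
open import Data.Vec using ([]; _∷_)
import Data.Vec.Relation.Binary.Pointwise.Inductive as VecPointwise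
open import Function using (_∘_; id)
open import Relation.Binary.PropositionalEquality using (_≡_; _≢_; refl; sym; trans; cong; cong₂; subst; subst₂; module ≡-Reasoning)
open import Relation.Nullary using (¬_; Dec; yes; no; does)
open import Relation.Nullary.Decidable using (dec-true; dec-false)

-- Finite sums

-- Probabilities are kept integral: a step is scaled by a common denominator, `r` steps by its
-- `r`-th power, and the final inequality is raised to the power `n`. Convexity enters through a
-- line instead of a square: if a chain meets c points of F, its number of pairs c (c - 1) / 2 lies
-- above the line through two neighbouring integer points, so the averages of c and of the number of
-- pairs suffice. The estimate O(1 / m) may depend only on the endpoint of a step that lies in F,
-- because F can be restricted to well-behaved points while the chain cannot. The three logarithms
-- have separate origins: the harmonic sum over the rotations, the number of halvings of the excess,
-- and the degree d of order p log n needed for branching with growth rate 1 + 1 / p, as (1 + 1 / p)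
-- ^ d has to reach p.

∑ : {V : Set} → List V → (V → ℕ) → ℕ
∑ [] f = 0
∑ (x ∷ xs) f = f x + ∑ xs f

⟦_⟧ : Bool → ℕ
⟦ true ⟧ = 1
⟦ false ⟧ = 0

⟦⟧≤1 : ∀ b → ⟦ b ⟧ ≤ 1
⟦⟧≤1 true = ≤-refl
⟦⟧≤1 false = z≤n

∑-mono-∈ : {V : Set} (xs : List V) {f g : V → ℕ} → (∀ x → x ∈ xs → f x ≤ g x) → ∑ xs f ≤ ∑ xs g
∑-mono-∈ [] h = z≤n
∑-mono-∈ (x ∷ xs) h = +-mono-≤ (h x (here refl)) (∑-mono-∈ xs (λ y y∈ → h y (there y∈)))

∑-mono : {V : Set} (xs : List V) {f g : V → ℕ} → (∀ x → f x ≤ g x) → ∑ xs f ≤ ∑ xs g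
∑-mono xs h = ∑-mono-∈ xs (λ x _ → h x)

∑-cong-∈ : {V : Set} (xs : List V) {f g : V → ℕ} → (∀ x → x ∈ xs → f x ≡ g x) → ∑ xs f ≡ ∑ xs g
∑-cong-∈ [] h = refl
∑-cong-∈ (x ∷ xs) h = cong₂ _+_ (h x (here refl)) (∑-cong-∈ xs (λ y y∈ → h y (there y∈)))

∑-cong : {V : Set} (xs : List V) {f g : V → ℕ} → (∀ x → f x ≡ g x) → ∑ xs f ≡ ∑ xs g
∑-cong xs h = ∑-cong-∈ xs (λ x _ → h x)

private
  interchange : ∀ a b c d → a + b + (c + d) ≡ (a + c) + (b + d)
  interchange = solve-∀

∑-+ : {V : Set} (xs : List V) (f g : V → ℕ) → ∑ xs (λ x → f x + g x) ≡ ∑ xs f + ∑ xs g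
∑-+ [] f g = refl
∑-+ (x ∷ xs) f g = trans (cong (f x + g x +_) (∑-+ xs f g)) (interchange (f x) (g x) (∑ xs f) (∑ xs g))

∑-*ˡ : {V : Set} (xs : List V) (c : ℕ) (f : V → ℕ) → ∑ xs (λ x → c * f x) ≡ c * ∑ xs f
∑-*ˡ [] c f = sym (*-zeroʳ c)
∑-*ˡ (x ∷ xs) c f = trans (cong (c * f x +_) (∑-*ˡ xs c f)) (sym (*-distribˡ-+ c (f x) (∑ xs f)))

∑-*ʳ : {V : Set} (xs : List V) (c : ℕ) (f : V → ℕ) → ∑ xs (λ x → f x * c) ≡ ∑ xs f * c
∑-*ʳ xs c f = trans (∑-cong xs (λ x → *-comm (f x) c)) (trans (∑-*ˡ xs c f) (*-comm c (∑ xs f)))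

∑-const : {V : Set} (xs : List V) (c : ℕ) → ∑ xs (λ _ → c) ≡ length xs * c
∑-const [] c = refl
∑-const (x ∷ xs) c = cong (c +_) (∑-const xs c)

∑-zero : {V : Set} (xs : List V) → ∑ xs (λ _ → 0) ≡ 0
∑-zero xs = trans (∑-const xs 0) (*-zeroʳ (length xs))

∑-zero-∈ : {V : Set} (xs : List V) {f : V → ℕ} → (∀ x → x ∈ xs → f x ≡ 0) → ∑ xs f ≡ 0
∑-zero-∈ xs h = trans (∑-cong-∈ xs h) (∑-zero xs)

∑-swap : {V W : Set} (xs : List V) (ys : List W) (f : V → W → ℕ) →
         ∑ xs (λ x → ∑ ys (f x)) ≡ ∑ ys (λ y → ∑ xs (λ x → f x y))
∑-swap [] ys f = sym (∑-zero ys)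
∑-swap (x ∷ xs) ys f = trans (cong (∑ ys (f x) +_) (∑-swap xs ys f)) (sym (∑-+ ys (f x) _))

∑-++ : {V : Set} (xs ys : List V) (f : V → ℕ) → ∑ (xs ++ ys) f ≡ ∑ xs f + ∑ ys f
∑-++ [] ys f = refl
∑-++ (x ∷ xs) ys f = trans (cong (f x +_) (∑-++ xs ys f)) (sym (+-assoc (f x) _ _))

∑-map : {V W : Set} (g : V → W) (xs : List V) (f : W → ℕ) → ∑ (map g xs) f ≡ ∑ xs (f ∘ g)
∑-map g [] f = refl
∑-map g (x ∷ xs) f = cong (f (g x) +_) (∑-map g xs f)

∑-concatMap : {V W : Set} (g : V → List W) (xs : List V) (f : W → ℕ) →
              ∑ (concatMap g xs) f ≡ ∑ xs (λ x → ∑ (g x) f)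
∑-concatMap g [] f = refl
∑-concatMap g (x ∷ xs) f = trans (∑-++ (g x) _ f) (cong (∑ (g x) f +_) (∑-concatMap g xs f))

term≤∑ : {V : Set} {xs : List V} {x : V} (f : V → ℕ) → x ∈ xs → f x ≤ ∑ xs f
term≤∑ f (here refl) = m≤m+n _ _
term≤∑ {xs = y ∷ xs} f (there x∈) = ≤-trans (term≤∑ f x∈) (m≤n+m _ (f y))

∑-nonzero : {V : Set} (xs : List V) (f : V → ℕ) → ∑ xs f ≢ 0 → Σ V (λ x → x ∈ xs × f x ≢ 0)
∑-nonzero [] f ne = ⊥-elim (ne refl)
∑-nonzero (x ∷ xs) f ne with f x ≟ 0
... | no fx≢0 = x , here refl , fx≢0
... | yes fx≡0 with ∑-nonzero xs f (λ e → ne (cong₂ _+_ fx≡0 e))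
... | y , y∈ , fy≢0 = y , there y∈ , fy≢0

∑< : ℕ → (ℕ → ℕ) → ℕ
∑< n = ∑ (downFrom n)

∑<-mono : ∀ n {f g : ℕ → ℕ} → (∀ i → i < n → f i ≤ g i) → ∑< n f ≤ ∑< n g
∑<-mono n h = ∑-mono-∈ (downFrom n) (λ i i∈ → h i (∈-downFrom⁻ i∈))

∑<-cong : ∀ n {f g : ℕ → ℕ} → (∀ i → i < n → f i ≡ g i) → ∑< n f ≡ ∑< n g
∑<-cong n h = ∑-cong-∈ (downFrom n) (λ i i∈ → h i (∈-downFrom⁻ i∈))

length-downFrom : ∀ n → length (downFrom n) ≡ n
length-downFrom zero = refl
length-downFrom (suc n) = cong suc (length-downFrom n)

∑<-const : ∀ n c → ∑< n (λ _ → c) ≡ n * c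
∑<-const n c = trans (∑-const (downFrom n) c) (cong (_* c) (length-downFrom n))

∑<-suc : ∀ n (f : ℕ → ℕ) → ∑< (suc n) f ≡ f 0 + ∑< n (f ∘ suc)
∑<-suc zero f = refl
∑<-suc (suc n) f = begin
  f (suc n) + (f n + ∑< n f)          ≡⟨ cong (f (suc n) +_) (∑<-suc n f) ⟩
  f (suc n) + (f 0 + ∑< n (f ∘ suc))  ≡⟨ swap₃ (f (suc n)) (f 0) _ ⟩
  f 0 + (f (suc n) + ∑< n (f ∘ suc))  ∎
  where
  open ≡-Reasoning
  swap₃ : ∀ a b c → a + (b + c) ≡ b + (a + c)
  swap₃ = solve-∀

∑<-+ : ∀ m n (f : ℕ → ℕ) → ∑< (m + n) f ≡ ∑< m f + ∑< n (λ i → f (m + i))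
∑<-+ zero n f = refl
∑<-+ (suc m) n f = begin
  ∑< (suc (m + n)) f                                   ≡⟨ ∑<-suc (m + n) f ⟩
  f 0 + ∑< (m + n) (f ∘ suc)                           ≡⟨ cong (f 0 +_) (∑<-+ m n (f ∘ suc)) ⟩
  f 0 + (∑< m (f ∘ suc) + ∑< n (λ i → f (suc m + i)))  ≡⟨ sym (+-assoc (f 0) _ _) ⟩
  f 0 + ∑< m (f ∘ suc) + ∑< n (λ i → f (suc m + i))    ≡⟨ cong (_+ ∑< n (λ i → f (suc m + i))) (sym (∑<-suc m f)) ⟩
  ∑< (suc m) f + ∑< n (λ i → f (suc m + i))            ∎
  where open ≡-Reasoning

∑<-≤ : ∀ {m n} (f : ℕ → ℕ) → m ≤ n → ∑< m f ≤ ∑< n f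
∑<-≤ {m} f m≤n with m≤n⇒∃[o]m+o≡n m≤n
... | o , refl = ≤-trans (m≤m+n _ _) (≤-reflexive (sym (∑<-+ m o f)))

∑<-reverse : ∀ n (f : ℕ → ℕ) → ∑< n (λ i → f (n ∸ suc i)) ≡ ∑< n f
∑<-reverse zero f = refl
∑<-reverse (suc n) f = trans (∑<-suc n (λ i → f (n ∸ i))) (cong (f n +_) (∑<-reverse n f))

∑-allFin : ∀ t (f : ℕ → ℕ) → ∑ (allFin t) (f ∘ toℕ) ≡ ∑< t f
∑-allFin t f = trans (shifted t id) (ranged t id)
  where
  shifted : ∀ n (g : Fin n → Fin t) → ∑ (tabulate g) (f ∘ toℕ) ≡ ∑ (tabulate (toℕ ∘ g)) f
  shifted zero g = refl
  shifted (suc n) g = cong (f (toℕ (g Fin.zero)) +_) (shifted n (g ∘ Fin.suc))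
  ranged : ∀ n (h : ℕ → ℕ) → ∑ (tabulate {n = n} (h ∘ toℕ)) f ≡ ∑< n (f ∘ h)
  ranged zero h = refl
  ranged (suc n) h = trans (cong (f (h 0) +_) (ranged n (h ∘ suc))) (sym (∑<-suc n (f ∘ h)))

-- Counting antichains inside a list

private variable
  𝓐 𝓑 : Set

-- The test enters as a value, so that abstracting `p x` alone makes `fil` compute.
keep : Bool → 𝓐 → List 𝓐 → List 𝓐
keep true x xs = x ∷ xs
keep false x xs = xs

fil : (𝓐 → Bool) → List 𝓐 → List 𝓐
fil p [] = []
fil p (x ∷ xs) = keep (p x) x (fil p xs)

fil-comm : (p q : 𝓐 → Bool) (xs : List 𝓐) → fil p (fil q xs) ≡ fil q (fil p xs)
fil-comm p q [] = refl
fil-comm p q (x ∷ xs) with p x in px | q x in qx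
... | true  | true  rewrite px | qx = cong (x ∷_) (fil-comm p q xs)
... | true  | false rewrite qx = fil-comm p q xs
... | false | true  rewrite px = fil-comm p q xs
... | false | false = fil-comm p q xs

fil-id : (p : 𝓐 → Bool) (xs : List 𝓐) → (∀ x → x ∈ xs → p x ≡ true) → fil p xs ≡ xs
fil-id p [] h = refl
fil-id p (x ∷ xs) h rewrite h x (here refl) = cong (x ∷_) (fil-id p xs (λ y y∈ → h y (there y∈)))

∑-fil : (p : 𝓐 → Bool) (xs : List 𝓐) (f : 𝓐 → ℕ) → ∑ (fil p xs) f ≡ ∑ xs (λ x → ⟦ p x ⟧ * f x)
∑-fil p [] f = refl
∑-fil p (x ∷ xs) f with p x
... | true  = cong₂ _+_ (sym (+-identityʳ (f x))) (∑-fil p xs f)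
... | false = ∑-fil p xs f

∑-fil-≤ : (p : 𝓐 → Bool) (xs : List 𝓐) (f : 𝓐 → ℕ) → ∑ (fil p xs) f ≤ ∑ xs f
∑-fil-≤ p xs f = ≤-trans (≤-reflexive (∑-fil p xs f))
  (∑-mono xs (λ x → ≤-trans (*-monoˡ-≤ (f x) (⟦⟧≤1 (p x))) (≤-reflexive (+-identityʳ (f x)))))

length-∑ : (xs : List 𝓐) → length xs ≡ ∑ xs (λ _ → 1)
length-∑ xs = trans (sym (*-identityʳ (length xs))) (sym (∑-const xs 1))

length-fil : (p : 𝓐 → Bool) (xs : List 𝓐) → length (fil p xs) ≡ ∑ xs (⟦_⟧ ∘ p)
length-fil p xs = trans (length-∑ (fil p xs))
  (trans (∑-fil p xs (λ _ → 1)) (∑-cong xs (λ x → *-identityʳ ⟦ p x ⟧)))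

length-fil-≤ : (p : 𝓐 → Bool) (xs : List 𝓐) → length (fil p xs) ≤ length xs
length-fil-≤ p xs = subst₂ _≤_ (sym (length-∑ (fil p xs))) (sym (length-∑ xs)) (∑-fil-≤ p xs (λ _ → 1))

∈-fil⁻ : (p : 𝓐 → Bool) (xs : List 𝓐) {x : 𝓐} → x ∈ fil p xs → x ∈ xs × p x ≡ true
∈-fil⁻ p (y ∷ xs) x∈ with p y in py
∈-fil⁻ p (y ∷ xs) (here refl) | true = here refl , py
∈-fil⁻ p (y ∷ xs) (there x∈)  | true = there (proj₁ (∈-fil⁻ p xs x∈)) , proj₂ (∈-fil⁻ p xs x∈)
... | false = there (proj₁ (∈-fil⁻ p xs x∈)) , proj₂ (∈-fil⁻ p xs x∈)

∈-fil⁺ : (p : 𝓐 → Bool) {xs : List 𝓐} {x : 𝓐} → x ∈ xs → p x ≡ true → x ∈ fil p xs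
∈-fil⁺ p {y ∷ xs} (here refl) px rewrite px = here refl
∈-fil⁺ p {y ∷ xs} (there x∈) px with p y
... | true  = there (∈-fil⁺ p x∈ px)
... | false = ∈-fil⁺ p x∈ px

length-fil-∨ : (p q r : 𝓐 → Bool) (xs : List 𝓐) →
  (∀ x → x ∈ xs → p x ≡ true → q x ≡ true ⊎ r x ≡ true) →
  length (fil p xs) ≤ length (fil q xs) + length (fil r xs)
length-fil-∨ p q r xs h = begin
  length (fil p xs)                     ≡⟨ length-fil p xs ⟩
  ∑ xs (⟦_⟧ ∘ p)                        ≤⟨ ∑-mono-∈ xs termwise ⟩
  ∑ xs (λ x → ⟦ q x ⟧ + ⟦ r x ⟧)        ≡⟨ ∑-+ xs _ _ ⟩
  ∑ xs (⟦_⟧ ∘ q) + ∑ xs (⟦_⟧ ∘ r)       ≡⟨ sym (cong₂ _+_ (length-fil q xs) (length-fil r xs)) ⟩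
  length (fil q xs) + length (fil r xs) ∎
  where
  open ≤-Reasoning
  termwise : ∀ x → x ∈ xs → ⟦ p x ⟧ ≤ ⟦ q x ⟧ + ⟦ r x ⟧
  termwise x x∈ with p x in px
  ... | false = z≤n
  ... | true with h x x∈ px
  ... | inj₁ qx rewrite qx = s≤s z≤n
  ... | inj₂ rx rewrite rx = m≤n+m 1 ⟦ q x ⟧

allᵇ : (𝓐 → Bool) → List 𝓐 → Bool
allᵇ p [] = true
allᵇ p (x ∷ xs) = p x ∧ allᵇ p xs

-- A chosen element is absorbed into the predicate, so sublists are counted without being listed;
-- `length-filter-subsets` is the link to the enumeration `subsets`.
countSublists : (List 𝓐 → Bool) → List 𝓐 → ℕ
countSublists P [] = ⟦ P [] ⟧
countSublists P (x ∷ xs) = countSublists P xs + countSublists (P ∘ (x ∷_)) xs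

countSublists-cong : {P Q : List 𝓐 → Bool} (xs : List 𝓐) → (∀ S → P S ≡ Q S) →
                     countSublists P xs ≡ countSublists Q xs
countSublists-cong [] h = cong ⟦_⟧ (h [])
countSublists-cong (x ∷ xs) h =
  cong₂ _+_ (countSublists-cong xs h) (countSublists-cong xs (λ S → h (x ∷ S)))

countSublists-false : (xs : List 𝓐) → countSublists (λ _ → false) xs ≡ 0
countSublists-false [] = refl
countSublists-false (x ∷ xs) = cong₂ _+_ (countSublists-false xs) (countSublists-false xs)

-- Once `x` has been chosen, requiring the later elements to be incomparable to `x` merely deletes
-- points from the list. This is the source of the recursion `cnt-∷`.
countSublists-all : (p : 𝓐 → Bool) (P : List 𝓐 → Bool) (xs : List 𝓐) →
  countSublists (λ S → allᵇ p S ∧ P S) xs ≡ countSublists P (fil p xs)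
countSublists-all p P [] = refl
countSublists-all p P (y ∷ ys) with p y
... | true  = cong₂ _+_ (countSublists-all p P ys) (countSublists-all p (P ∘ (y ∷_)) ys)
... | false = trans (cong₂ _+_ (countSublists-all p P ys) (countSublists-false ys)) (+-identityʳ _)

countSublists-map : (f : 𝓐 → 𝓑) (P : List 𝓑 → Bool) (xs : List 𝓐) →
  countSublists P (map f xs) ≡ countSublists (P ∘ map f) xs
countSublists-map f P [] = refl
countSublists-map f P (x ∷ xs) =
  cong₂ _+_ (countSublists-map f P xs) (countSublists-map f (P ∘ (f x ∷_)) xs)

length-filter-++ : {P : 𝓐 → Set} (P? : ∀ x → Dec (P x)) (xs ys : List 𝓐) →
  length (filter P? (xs ++ ys)) ≡ length (filter P? xs) + length (filter P? ys)
length-filter-++ P? [] ys = refl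
length-filter-++ P? (x ∷ xs) ys with does (P? x)
... | true  = cong suc (length-filter-++ P? xs ys)
... | false = length-filter-++ P? xs ys

length-filter-map : (f : 𝓐 → 𝓑) {P : 𝓑 → Set} (P? : ∀ x → Dec (P x)) (xs : List 𝓐) →
  length (filter P? (map f xs)) ≡ length (filter (P? ∘ f) xs)
length-filter-map f P? [] = refl
length-filter-map f P? (x ∷ xs) with does (P? (f x))
... | true  = cong suc (length-filter-map f P? xs)
... | false = length-filter-map f P? xs

length-filter-subsets : {P : List 𝓐 → Set} (P? : ∀ S → Dec (P S)) (xs : List 𝓐) →
  length (filter P? (subsets xs)) ≡ countSublists (does ∘ P?) xs
length-filter-subsets P? [] with does (P? [])
... | true  = refl
... | false = refl
length-filter-subsets P? (x ∷ xs) = begin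
  length (filter P? (subsets xs ++ map (x ∷_) (subsets xs)))
    ≡⟨ length-filter-++ P? (subsets xs) _ ⟩
  length (filter P? (subsets xs)) + length (filter P? (map (x ∷_) (subsets xs)))
    ≡⟨ cong₂ _+_ (length-filter-subsets P? xs) (length-filter-map (x ∷_) P? (subsets xs)) ⟩
  countSublists (does ∘ P?) xs + length (filter (P? ∘ (x ∷_)) (subsets xs))
    ≡⟨ cong (countSublists (does ∘ P?) xs +_) (length-filter-subsets (P? ∘ (x ∷_)) xs) ⟩
  countSublists (does ∘ P?) (x ∷ xs) ∎
  where open ≡-Reasoning

pairwiseᵇ : (𝓐 → 𝓐 → Bool) → List 𝓐 → Bool
pairwiseᵇ inc [] = true
pairwiseᵇ inc (x ∷ S) = allᵇ (inc x) S ∧ pairwiseᵇ inc S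

count : (𝓐 → 𝓐 → Bool) → List 𝓐 → ℕ
count inc = countSublists (pairwiseᵇ inc)

allᵇ-map : (f : 𝓐 → 𝓑) (p : 𝓑 → Bool) (S : List 𝓐) → allᵇ p (map f S) ≡ allᵇ (p ∘ f) S
allᵇ-map f p [] = refl
allᵇ-map f p (x ∷ S) = cong (p (f x) ∧_) (allᵇ-map f p S)

allᵇ-cong : {p q : 𝓐 → Bool} → (∀ x → p x ≡ q x) → ∀ S → allᵇ p S ≡ allᵇ q S
allᵇ-cong h [] = refl
allᵇ-cong h (x ∷ S) = cong₂ _∧_ (h x) (allᵇ-cong h S)

count-map : (f : 𝓐 → 𝓑) (inc : 𝓑 → 𝓑 → Bool) (inc′ : 𝓐 → 𝓐 → Bool) →
  (∀ x y → inc (f x) (f y) ≡ inc′ x y) → ∀ xs → count inc (map f xs) ≡ count inc′ xs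
count-map {𝓐} f inc inc′ h xs = trans (countSublists-map f _ xs) (countSublists-cong xs same)
  where
  same : ∀ S → pairwiseᵇ inc (map f S) ≡ pairwiseᵇ inc′ S
  same [] = refl
  same (x ∷ S) = cong₂ _∧_ (trans (allᵇ-map f (inc (f x)) S) (allᵇ-cong (h x) S)) (same S)

-- Recursions and decompositions for the number of antichains

module Antichains {V : Set} (inc : V → V → Bool) where

  cnt : List V → ℕ
  cnt = count inc

  cnt-∷ : ∀ x xs → cnt (x ∷ xs) ≡ cnt xs + cnt (fil (inc x) xs)
  cnt-∷ x xs = cong (cnt xs +_) (countSublists-all (inc x) (pairwiseᵇ inc) xs)

  -- The recursion `cnt-∷` leads to `fil (inc x) xs`, which is no subterm of the list, so the
  -- induction runs on a bound for the length; the lemmas below do the same.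
  cnt-fil-≤ : ∀ p xs → cnt (fil p xs) ≤ cnt xs
  cnt-fil-≤ p xs = go (length xs) xs ≤-refl
    where
    go : ∀ n xs → length xs ≤ n → cnt (fil p xs) ≤ cnt xs
    go n [] _ = ≤-refl
    go (suc n) (x ∷ xs) (s≤s l) rewrite cnt-∷ x xs with p x
    ... | true rewrite cnt-∷ x (fil p xs) | fil-comm (inc x) p xs =
      +-mono-≤ (go n xs l) (go n (fil (inc x) xs) (≤-trans (length-fil-≤ (inc x) xs) l))
    ... | false = ≤-trans (go n xs l) (m≤m+n _ _)

  cnt≤2^length : ∀ xs → cnt xs ≤ 2 ^ length xs
  cnt≤2^length [] = ≤-refl
  cnt≤2^length (x ∷ xs) rewrite cnt-∷ x xs =
    +-mono-≤ (cnt≤2^length xs)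
             (≤-trans (cnt-fil-≤ (inc x) xs) (≤-trans (cnt≤2^length xs) (≤-reflexive (sym (+-identityʳ _)))))

  -- An antichain is determined by its traces on the two parts, and each trace is an antichain.
  cnt-product : ∀ p xs → cnt xs ≤ cnt (fil p xs) * cnt (fil (not ∘ p) xs)
  cnt-product p xs = go (length xs) xs ≤-refl
    where
    open ≤-Reasoning
    go : ∀ n xs → length xs ≤ n → cnt xs ≤ cnt (fil p xs) * cnt (fil (not ∘ p) xs)
    go n [] _ = ≤-refl
    go (suc n) (x ∷ xs) (s≤s l) rewrite cnt-∷ x xs with p x
    ... | true = begin
      cnt xs + cnt (fil (inc x) xs)
        ≤⟨ +-mono-≤ (go n xs l) (go n (fil (inc x) xs) (≤-trans (length-fil-≤ (inc x) xs) l)) ⟩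
      cnt (fil p xs) * c + cnt (fil p (fil (inc x) xs)) * cnt (fil (not ∘ p) (fil (inc x) xs))
        ≤⟨ +-monoʳ-≤ (cnt (fil p xs) * c) (*-mono-≤ (≤-reflexive (cong cnt (fil-comm p (inc x) xs)))
             (≤-trans (≤-reflexive (cong cnt (fil-comm (not ∘ p) (inc x) xs))) (cnt-fil-≤ (inc x) (fil (not ∘ p) xs)))) ⟩
      cnt (fil p xs) * c + cnt (fil (inc x) (fil p xs)) * c
        ≡⟨ sym (*-distribʳ-+ c (cnt (fil p xs)) _) ⟩
      (cnt (fil p xs) + cnt (fil (inc x) (fil p xs))) * c
        ≡⟨ cong (_* c) (sym (cnt-∷ x (fil p xs))) ⟩
      cnt (x ∷ fil p xs) * c ∎
      where
      c : ℕ
      c = cnt (fil (not ∘ p) xs)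
    ... | false = begin
      cnt xs + cnt (fil (inc x) xs)
        ≤⟨ +-mono-≤ (go n xs l) (go n (fil (inc x) xs) (≤-trans (length-fil-≤ (inc x) xs) l)) ⟩
      c * cnt (fil (not ∘ p) xs) + cnt (fil p (fil (inc x) xs)) * cnt (fil (not ∘ p) (fil (inc x) xs))
        ≤⟨ +-monoʳ-≤ (c * cnt (fil (not ∘ p) xs)) (*-mono-≤
             (≤-trans (≤-reflexive (cong cnt (fil-comm p (inc x) xs))) (cnt-fil-≤ (inc x) (fil p xs)))
             (≤-reflexive (cong cnt (fil-comm (not ∘ p) (inc x) xs)))) ⟩
      c * cnt (fil (not ∘ p) xs) + c * cnt (fil (inc x) (fil (not ∘ p) xs))
        ≡⟨ sym (*-distribˡ-+ c (cnt (fil (not ∘ p) xs)) _) ⟩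
      c * (cnt (fil (not ∘ p) xs) + cnt (fil (inc x) (fil (not ∘ p) xs)))
        ≡⟨ cong (c *_) (sym (cnt-∷ x (fil (not ∘ p) xs))) ⟩
      c * cnt (x ∷ fil (not ∘ p) xs) ∎
      where
      c : ℕ
      c = cnt (fil p xs)

  -- All points of `s₁` are comparable to all points of `s₂`, so an antichain misses one of the two
  -- sets.
  cnt-split : ∀ s₁ s₂ xs → (∀ x → s₁ x ≡ true → s₂ x ≡ false) →
    (∀ x y → x ∈ xs → y ∈ xs → s₁ x ≡ true → s₂ y ≡ true → inc x y ≡ false × inc y x ≡ false) →
    cnt xs ≤ cnt (fil (not ∘ s₁) xs) + cnt (fil (not ∘ s₂) xs)
  cnt-split s₁ s₂ xs disjoint = go (length xs) xs ≤-refl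
    where
    open ≤-Reasoning
    Cross : List V → Set
    Cross xs = ∀ x y → x ∈ xs → y ∈ xs → s₁ x ≡ true → s₂ y ≡ true → inc x y ≡ false × inc y x ≡ false
    four : ∀ a b c d → a + b + (c + d) ≡ (a + c) + (b + d)
    four = solve-∀
    shuffle : ∀ a b c → (a + b) + c ≡ a + (b + c)
    shuffle = solve-∀
    shuffle′ : ∀ a b c → (a + b) + c ≡ (a + c) + b
    shuffle′ = solve-∀
    go : ∀ n xs → length xs ≤ n → Cross xs → cnt xs ≤ cnt (fil (not ∘ s₁) xs) + cnt (fil (not ∘ s₂) xs)
    go n [] _ _ = s≤s z≤n
    go (suc n) (x ∷ xs) (s≤s l) cross rewrite cnt-∷ x xs with s₁ x in e₁ | s₂ x in e₂
    ... | true | true with () ← trans (sym (disjoint x e₁)) e₂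
    ... | false | false = begin
      cnt xs + cnt (fil (inc x) xs)
        ≤⟨ +-mono-≤ IH (go n (fil (inc x) xs) (≤-trans (length-fil-≤ (inc x) xs) l)
             (λ y z y∈ z∈ → cross y z (there (proj₁ (∈-fil⁻ (inc x) xs y∈))) (there (proj₁ (∈-fil⁻ (inc x) xs z∈))))) ⟩
      (cnt X₁ + cnt X₂) + (cnt (fil (not ∘ s₁) (fil (inc x) xs)) + cnt (fil (not ∘ s₂) (fil (inc x) xs)))
        ≡⟨ cong ((cnt X₁ + cnt X₂) +_) (cong₂ (λ u v → cnt u + cnt v)
             (fil-comm (not ∘ s₁) (inc x) xs) (fil-comm (not ∘ s₂) (inc x) xs)) ⟩
      (cnt X₁ + cnt X₂) + (cnt (fil (inc x) X₁) + cnt (fil (inc x) X₂))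
        ≡⟨ four (cnt X₁) (cnt X₂) _ _ ⟩
      (cnt X₁ + cnt (fil (inc x) X₁)) + (cnt X₂ + cnt (fil (inc x) X₂))
        ≡⟨ sym (cong₂ _+_ (cnt-∷ x X₁) (cnt-∷ x X₂)) ⟩
      cnt (x ∷ X₁) + cnt (x ∷ X₂) ∎
      where
      X₁ X₂ : List V
      X₁ = fil (not ∘ s₁) xs
      X₂ = fil (not ∘ s₂) xs
      IH : cnt xs ≤ cnt X₁ + cnt X₂
      IH = go n xs l (λ y z y∈ z∈ → cross y z (there y∈) (there z∈))
    ... | true | false = begin
      cnt xs + cnt (fil (inc x) xs)
        ≤⟨ +-monoˡ-≤ _ (go n xs l (λ y z y∈ z∈ → cross y z (there y∈) (there z∈))) ⟩
      (cnt X₁ + cnt X₂) + cnt (fil (inc x) xs)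
        ≡⟨ cong (λ u → (cnt X₁ + cnt X₂) + cnt u) (sym (fil-id (not ∘ s₂) (fil (inc x) xs) avoid)) ⟩
      (cnt X₁ + cnt X₂) + cnt (fil (not ∘ s₂) (fil (inc x) xs))
        ≡⟨ cong (λ u → (cnt X₁ + cnt X₂) + cnt u) (fil-comm (not ∘ s₂) (inc x) xs) ⟩
      (cnt X₁ + cnt X₂) + cnt (fil (inc x) X₂)
        ≡⟨ shuffle (cnt X₁) _ _ ⟩
      cnt X₁ + (cnt X₂ + cnt (fil (inc x) X₂))
        ≡⟨ cong (cnt X₁ +_) (sym (cnt-∷ x X₂)) ⟩
      cnt X₁ + cnt (x ∷ X₂) ∎
      where
      X₁ X₂ : List V
      X₁ = fil (not ∘ s₁) xs
      X₂ = fil (not ∘ s₂) xs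
      -- With `x` from `s₁` chosen, its incomparable points contain none of `s₂`.
      avoid : ∀ y → y ∈ fil (inc x) xs → not (s₂ y) ≡ true
      avoid y y∈ with s₂ y in e
      ... | false = refl
      ... | true with () ← trans (sym (proj₂ (∈-fil⁻ (inc x) xs y∈)))
                            (proj₁ (cross x y (here refl) (there (proj₁ (∈-fil⁻ (inc x) xs y∈))) e₁ e))
    ... | false | true = begin
      cnt xs + cnt (fil (inc x) xs)
        ≤⟨ +-monoˡ-≤ _ (go n xs l (λ y z y∈ z∈ → cross y z (there y∈) (there z∈))) ⟩
      (cnt X₁ + cnt X₂) + cnt (fil (inc x) xs)
        ≡⟨ cong (λ u → (cnt X₁ + cnt X₂) + cnt u) (sym (fil-id (not ∘ s₁) (fil (inc x) xs) avoid)) ⟩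
      (cnt X₁ + cnt X₂) + cnt (fil (not ∘ s₁) (fil (inc x) xs))
        ≡⟨ cong (λ u → (cnt X₁ + cnt X₂) + cnt u) (fil-comm (not ∘ s₁) (inc x) xs) ⟩
      (cnt X₁ + cnt X₂) + cnt (fil (inc x) X₁)
        ≡⟨ shuffle′ (cnt X₁) _ _ ⟩
      (cnt X₁ + cnt (fil (inc x) X₁)) + cnt X₂
        ≡⟨ cong (_+ cnt X₂) (sym (cnt-∷ x X₁)) ⟩
      cnt (x ∷ X₁) + cnt X₂ ∎
      where
      X₁ X₂ : List V
      X₁ = fil (not ∘ s₁) xs
      X₂ = fil (not ∘ s₂) xs
      avoid : ∀ y → y ∈ fil (inc x) xs → not (s₁ y) ≡ true
      avoid y y∈ with s₁ y in e
      ... | false = refl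
      ... | true with () ← trans (sym (proj₂ (∈-fil⁻ (inc x) xs y∈)))
                            (proj₂ (cross y x (there (proj₁ (∈-fil⁻ (inc x) xs y∈))) (here refl) e e₂))

  module Branching (_≟′_ : (x y : V) → Dec (x ≡ y))
    (inc-sym : ∀ x y → inc x y ≡ inc y x) (inc-irrefl : ∀ x → inc x x ≡ false) where

    δ : V → V → ℕ
    δ x y = ⟦ does (x ≟′ y) ⟧

    -- Absence of repetitions as an inequality between sums, which passes to filtered lists by
    -- monotonicity and can itself be summed.
    Distinct : List V → Set
    Distinct xs = ∀ x → ∑ xs (δ x) ≤ 1

    Distinct-fil : ∀ p xs → Distinct xs → Distinct (fil p xs)
    Distinct-fil p xs d x = ≤-trans (∑-fil-≤ p xs (δ x)) (d x)

    _∖_ : List V → V → List V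
    xs ∖ x = fil (λ y → not (does (x ≟′ y))) xs

    δ-refl : ∀ x → δ x x ≡ 1
    δ-refl x with x ≟′ x
    ... | yes _ = refl
    ... | no x≢x = ⊥-elim (x≢x refl)

    ∑δ≡0⇒≢ : ∀ {x xs} → ∑ xs (δ x) ≡ 0 → ∀ y → y ∈ xs → not (does (x ≟′ y)) ≡ true
    ∑δ≡0⇒≢ {x} {xs} e y y∈ with x ≟′ y
    ... | no _ = refl
    ... | yes refl with () ← subst (1 ≤_) e (subst (_≤ ∑ xs (δ x)) (δ-refl x) (term≤∑ (δ x) y∈))

    -- Unlike in `cnt-∷`, the branching point may stand anywhere. An earlier point `y` that is
    -- chosen either leaves `x` available or, by `inc-sym`, rules it out; in the latter case the
    -- antichains counted avoid `x` anyway.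
    cnt-branch : ∀ x xs → Distinct xs → cnt xs ≤ cnt (xs ∖ x) + cnt (fil (inc x) xs)
    cnt-branch x xs = go (length xs) xs ≤-refl
      where
      open ≤-Reasoning
      four : ∀ a b c d → a + b + (c + d) ≡ (a + c) + (b + d)
      four = solve-∀
      shuffle : ∀ a b c → (a + b) + c ≡ (a + c) + b
      shuffle = solve-∀
      tail-distinct : ∀ y ys → Distinct (y ∷ ys) → Distinct ys
      tail-distinct y ys d z = ≤-trans (m≤n+m _ (δ z y)) (d z)
      ne : V → V → Bool
      ne x y = not (does (x ≟′ y))
      go : ∀ n xs → length xs ≤ n → Distinct xs → cnt xs ≤ cnt (xs ∖ x) + cnt (fil (inc x) xs)
      go n [] _ _ = s≤s z≤n
      go (suc n) (y ∷ ys) (s≤s l) d rewrite cnt-∷ y ys with x ≟′ y in e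
      ... | yes refl rewrite inc-irrefl x | fil-id (ne x) ys
              (∑δ≡0⇒≢ (n≤0⇒n≡0 (≤-pred (subst (λ z → z + ∑ ys (δ x) ≤ 1) (δ-refl x) (d x))))) = ≤-refl
      ... | no x≢y with inc x y in i
      ... | true = begin
        cnt ys + cnt (fil (inc y) ys)
          ≤⟨ +-mono-≤ (go n ys l (tail-distinct y ys d))
              (go n (fil (inc y) ys) (≤-trans (length-fil-≤ (inc y) ys) l) (Distinct-fil (inc y) ys (tail-distinct y ys d))) ⟩
        (cnt (ys ∖ x) + cnt (fil (inc x) ys)) + (cnt (fil (inc y) ys ∖ x) + cnt (fil (inc x) (fil (inc y) ys)))
          ≡⟨ cong (cnt (ys ∖ x) + cnt (fil (inc x) ys) +_) (cong₂ (λ u v → cnt u + cnt v)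
               (fil-comm (ne x) (inc y) ys) (fil-comm (inc x) (inc y) ys)) ⟩
        (cnt (ys ∖ x) + cnt (fil (inc x) ys)) + (cnt (fil (inc y) (ys ∖ x)) + cnt (fil (inc y) (fil (inc x) ys)))
          ≡⟨ four (cnt (ys ∖ x)) _ _ _ ⟩
        (cnt (ys ∖ x) + cnt (fil (inc y) (ys ∖ x))) + (cnt (fil (inc x) ys) + cnt (fil (inc y) (fil (inc x) ys)))
          ≡⟨ sym (cong₂ _+_ (cnt-∷ y (ys ∖ x)) (cnt-∷ y (fil (inc x) ys))) ⟩
        cnt (y ∷ (ys ∖ x)) + cnt (y ∷ fil (inc x) ys) ∎
      ... | false = begin
        cnt ys + cnt (fil (inc y) ys)
          ≤⟨ +-monoˡ-≤ _ (go n ys l (tail-distinct y ys d)) ⟩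
        (cnt (ys ∖ x) + cnt (fil (inc x) ys)) + cnt (fil (inc y) ys)
          ≡⟨ cong (λ u → (cnt (ys ∖ x) + cnt (fil (inc x) ys)) + cnt u) (sym (fil-id (ne x) (fil (inc y) ys) avoid)) ⟩
        (cnt (ys ∖ x) + cnt (fil (inc x) ys)) + cnt (fil (inc y) ys ∖ x)
          ≡⟨ cong (λ u → (cnt (ys ∖ x) + cnt (fil (inc x) ys)) + cnt u) (fil-comm (ne x) (inc y) ys) ⟩
        (cnt (ys ∖ x) + cnt (fil (inc x) ys)) + cnt (fil (inc y) (ys ∖ x))
          ≡⟨ shuffle (cnt (ys ∖ x)) _ _ ⟩
        (cnt (ys ∖ x) + cnt (fil (inc y) (ys ∖ x))) + cnt (fil (inc x) ys)
          ≡⟨ cong (_+ cnt (fil (inc x) ys)) (sym (cnt-∷ y (ys ∖ x))) ⟩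
        cnt (y ∷ (ys ∖ x)) + cnt (fil (inc x) ys) ∎
        where
        avoid : ∀ z → z ∈ fil (inc y) ys → ne x z ≡ true
        avoid z z∈ with x ≟′ z
        ... | no _ = refl
        ... | yes refl with () ← trans (sym (proj₂ (∈-fil⁻ (inc y) ys z∈))) (trans (inc-sym y x) i)

-- Supersaturation from a random chain

-- The binomial coefficient `c` over 2: the number of pairs among `c` points.
tri : ℕ → ℕ
tri zero = 0
tri (suc c) = c + tri c

-- By convexity `tri` lies above the line that agrees with it at `s` and at `s + 1`.
*≤tri+tri : ∀ s c → s * c ≤ tri c + tri (suc s)
*≤tri+tri zero c = z≤n
*≤tri+tri (suc s) zero = ≤-trans (≤-reflexive (*-zeroʳ s)) z≤n
*≤tri+tri (suc s) (suc c) = begin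
  suc s * suc c                        ≡⟨ expand s c ⟩
  s * c + (suc s + c)                  ≤⟨ +-monoˡ-≤ (suc s + c) (*≤tri+tri s c) ⟩
  tri c + tri (suc s) + (suc s + c)    ≡⟨ regroup (tri c) (tri (suc s)) (suc s) c ⟩
  c + tri c + (suc s + tri (suc s))    ∎
  where
  open ≤-Reasoning
  expand : ∀ s c → suc s * suc c ≡ s * c + (suc s + c)
  expand = solve-∀
  regroup : ∀ a b s c → a + b + (s + c) ≡ c + a + (s + b)
  regroup = solve-∀

2*tri : ∀ s → 2 * tri (suc s) ≡ s * suc s
2*tri zero = refl
2*tri (suc s) = begin
  2 * (suc s + tri (suc s))        ≡⟨ *-distribˡ-+ 2 (suc s) (tri (suc s)) ⟩
  2 * suc s + 2 * tri (suc s)      ≡⟨ cong (2 * suc s +_) (2*tri s) ⟩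
  2 * suc s + s * suc s            ≡⟨ square s ⟩
  suc s * suc (suc s)              ∎
  where
  open ≡-Reasoning
  square : ∀ s → 2 * suc s + s * suc s ≡ suc s * suc (suc s)
  square = solve-∀

-- A chain climbs from x to z with probability Φ x z / E and stops with the remaining probability;
-- in each rank it is distributed proportionally to μ.  M₁ r x and M₂ r x are E ^ r times the expected
-- numbers of points and of pairs of points of F met within r steps from x.
module Flow {V : Set} (_≟′_ : (x y : V) → Dec (x ≡ y)) (all : List V) (rank : V → ℕ)
  (T E D K : ℕ) (Φ : V → V → ℕ) (μ : V → ℕ) (lt : V → V → Bool) (0<E : 0 < E)
  (∑δ : ∀ y → y ∈ all → ∀ (h : V → ℕ) → ∑ all (λ z → h z * ⟦ does (z ≟′ y) ⟧) ≡ h y)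
  (outflow : ∀ x → x ∈ all → ∑ all (Φ x) ≤ E)
  (inflow : ∀ y → y ∈ all → rank y ≢ 0 → ∑ all (λ x → μ x * Φ x y) ≡ E * μ y)
  (bottom : ∑ all (λ x → ⟦ rank x ≡ᵇ 0 ⟧ * μ x) ≤ D)
  (Φ-rank : ∀ x y → Φ x y ≢ 0 → rank y ≡ suc (rank x))
  (Φ-lt : ∀ x y → x ∈ all → Φ x y ≢ 0 → lt x y ≡ true)
  (lt-trans : ∀ x y z → lt x y ≡ true → lt y z ≡ true → lt x z ≡ true)
  (lt-rank : ∀ x y → lt x y ≡ true → rank x < rank y)
  (rank≤T : ∀ x → x ∈ all → rank x ≤ T)
  (F : List V) (F⊆all : ∀ x → x ∈ F → x ∈ all)
  (F-distinct : ∀ x → ∑ F (λ y → ⟦ does (x ≟′ y) ⟧) ≤ 1)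
  (Φ≤K : ∀ x y → x ∈ all → y ∈ F → Φ x y ≤ K)
  (d : ℕ) (degree : ∀ x → x ∈ F → ∑ F (λ y → ⟦ lt x y ⟧) ≤ d)
  where

  private
    δ : V → V → ℕ
    δ x y = ⟦ does (x ≟′ y) ⟧

    1F : V → ℕ
    1F x = ∑ F (δ x)

    δ≢ : ∀ {x y} → x ≢ y → δ x y ≡ 0
    δ≢ {x} {y} x≢y rewrite dec-false (x ≟′ y) x≢y = refl

    M₁ M₂ : ℕ → V → ℕ
    M₁ zero x = 1F x
    M₁ (suc r) x = 1F x * E ^ suc r + ∑ all (λ z → Φ x z * M₁ r z)
    M₂ zero x = 0
    M₂ (suc r) x = ∑ all (λ z → Φ x z * (M₂ r z + 1F x * M₁ r z))

    tri-step : ∀ c b → b ≤ 1 → tri (c + b) ≡ tri c + c * b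
    tri-step c zero _ = trans (cong tri (+-identityʳ c)) (sym (trans (cong (tri c +_) (*-zeroʳ c)) (+-identityʳ _)))
    tri-step c (suc zero) _ =
      trans (cong tri (+-comm c 1)) (trans (+-comm c (tri c)) (cong (tri c +_) (sym (*-identityʳ c))))
    tri-step c (suc (suc b)) (s≤s ())

    -- Here `c` counts the points of F met before `x`. A chain that meets j more has `tri c` + c j +
    -- `tri` j pairs in the end, so this is `*≤tri+tri` averaged over the chain. It is stated for
    -- all `c` because a passage through a point of F changes `c`.
    tangent : ∀ s r x → x ∈ all → ∀ c →
      s * (c * E ^ r + M₁ r x) ≤ M₂ r x + c * M₁ r x + (tri c + tri (suc s)) * E ^ r
    tangent s zero x x∈ c = begin
      s * (c * 1 + b)                         ≡⟨ cong (λ u → s * (u + b)) (*-identityʳ c) ⟩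
      s * (c + b)                             ≤⟨ *≤tri+tri s (c + b) ⟩
      tri (c + b) + tri (suc s)               ≡⟨ cong (_+ tri (suc s)) (tri-step c b (F-distinct x)) ⟩
      tri c + c * b + tri (suc s)             ≡⟨ regroup (tri c) (c * b) (tri (suc s)) ⟩
      c * b + (tri c + tri (suc s)) * 1       ∎
      where
      open ≤-Reasoning
      b : ℕ
      b = 1F x
      regroup : ∀ x y z → x + y + z ≡ y + (x + z) * 1
      regroup = solve-∀
    -- `slack` is the weight of stopping at `x`, where the numerical inequality is applied directly.
    tangent s (suc r) x x∈ c with m≤n⇒∃[o]m+o≡n (outflow x x∈)
    ... | slack , O+slack≡E = begin
      s * (c * (E * e) + (b * (E * e) + ΦA))
        ≡⟨ split s c b E e ΦA ⟩
      (s * c′) * (E * e) + s * ΦA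
        ≡⟨ cong (λ u → (s * c′) * (u * e) + s * ΦA) (sym O+slack≡E) ⟩
      (s * c′) * ((O + slack) * e) + s * ΦA
        ≡⟨ split₂ (s * c′) O slack e (s * ΦA) ⟩
      (s * c′) * e * O + s * ΦA + (s * c′) * (slack * e)
        ≤⟨ +-mono-≤ summed (*-monoˡ-≤ (slack * e) (*≤tri+tri s c′)) ⟩
      ΦB + c′ * ΦA + τ * e * O + τ * (slack * e)
        ≡⟨ split₃ ΦB (c′ * ΦA) τ e O slack ⟩
      ΦB + c′ * ΦA + τ * ((O + slack) * e)
        ≡⟨ cong (λ u → ΦB + c′ * ΦA + τ * (u * e)) O+slack≡E ⟩
      ΦB + c′ * ΦA + τ * (E * e)
        ≡⟨ cong (λ u → ΦB + c′ * ΦA + (u + tri (suc s)) * (E * e)) (tri-step c b (F-distinct x)) ⟩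
      ΦB + (c + b) * ΦA + (tri c + c * b + tri (suc s)) * (E * e)
        ≡⟨ split₄ ΦB c b ΦA (tri c) (tri (suc s)) (E * e) ⟩
      (ΦB + b * ΦA) + c * (b * (E * e) + ΦA) + (tri c + tri (suc s)) * (E * e)
        ≡⟨ cong (λ u → u + c * (b * (E * e) + ΦA) + (tri c + tri (suc s)) * (E * e)) (sym B-suc) ⟩
      M₂ (suc r) x + c * (b * (E * e) + ΦA) + (tri c + tri (suc s)) * (E * e) ∎
      where
      open ≤-Reasoning
      b c′ e O ΦA ΦB τ : ℕ
      b = 1F x
      c′ = c + b
      e = E ^ r
      O = ∑ all (Φ x)
      ΦA = ∑ all (λ z → Φ x z * M₁ r z)
      ΦB = ∑ all (λ z → Φ x z * M₂ r z)
      τ = tri c′ + tri (suc s)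
      split : ∀ s c b E e X → s * (c * (E * e) + (b * (E * e) + X)) ≡ (s * (c + b)) * (E * e) + s * X
      split = solve-∀
      split₂ : ∀ k O S e X → k * ((O + S) * e) + X ≡ k * e * O + X + k * (S * e)
      split₂ = solve-∀
      split₃ : ∀ X Y τ e O S → X + Y + τ * e * O + τ * (S * e) ≡ X + Y + τ * ((O + S) * e)
      split₃ = solve-∀
      split₄ : ∀ X c b Y t u k → X + (c + b) * Y + (t + c * b + u) * k ≡
                                 (X + b * Y) + c * (b * k + Y) + (t + u) * k
      split₄ = solve-∀
      B-suc : M₂ (suc r) x ≡ ΦB + b * ΦA
      B-suc = trans (∑-cong all (λ z → dist (Φ x z) (M₂ r z) b (M₁ r z)))
                    (trans (∑-+ all _ _) (cong (ΦB +_) (∑-*ˡ all b _)))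
        where
        dist : ∀ p q b a → p * (q + b * a) ≡ p * q + b * (p * a)
        dist = solve-∀
      summed : (s * c′) * e * O + s * ΦA ≤ ΦB + c′ * ΦA + τ * e * O
      summed = begin
        (s * c′) * e * O + s * ΦA
          ≡⟨ sym (cong₂ _+_ (∑-*ˡ all ((s * c′) * e) (Φ x)) (∑-*ˡ all s _)) ⟩
        ∑ all (λ z → (s * c′) * e * Φ x z) + ∑ all (λ z → s * (Φ x z * M₁ r z))
          ≡⟨ sym (∑-+ all _ _) ⟩
        ∑ all (λ z → (s * c′) * e * Φ x z + s * (Φ x z * M₁ r z))
          ≤⟨ ∑-mono-∈ all pointwise ⟩
        ∑ all (λ z → Φ x z * M₂ r z + c′ * (Φ x z * M₁ r z) + τ * e * Φ x z)
          ≡⟨ trans (∑-+ all _ _) (cong (_+ ∑ all (λ z → τ * e * Φ x z)) (∑-+ all _ _)) ⟩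
        ΦB + ∑ all (λ z → c′ * (Φ x z * M₁ r z)) + ∑ all (λ z → τ * e * Φ x z)
          ≡⟨ cong₂ (λ u v → ΦB + u + v) (∑-*ˡ all c′ _) (∑-*ˡ all (τ * e) (Φ x)) ⟩
        ΦB + c′ * ΦA + τ * e * O ∎
        where
        left : ∀ s c e p a → s * c * e * p + s * (p * a) ≡ p * (s * (c * e + a))
        left = solve-∀
        right : ∀ p q c a t e → p * (q + c * a + t * e) ≡ p * q + c * (p * a) + t * e * p
        right = solve-∀
        pointwise : ∀ z → z ∈ all → (s * c′) * e * Φ x z + s * (Φ x z * M₁ r z) ≤
                    Φ x z * M₂ r z + c′ * (Φ x z * M₁ r z) + τ * e * Φ x z
        pointwise z z∈ = begin
          (s * c′) * e * Φ x z + s * (Φ x z * M₁ r z)   ≡⟨ left s c′ e (Φ x z) (M₁ r z) ⟩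
          Φ x z * (s * (c′ * e + M₁ r z))               ≤⟨ *-monoʳ-≤ (Φ x z) (tangent s r z z∈ c′) ⟩
          Φ x z * (M₂ r z + c′ * M₁ r z + τ * e)         ≡⟨ right (Φ x z) (M₂ r z) c′ (M₁ r z) τ e ⟩
          Φ x z * M₂ r z + c′ * (Φ x z * M₁ r z) + τ * e * Φ x z ∎

    -- W r z y is the part of M₁ r z contributed by the point y of F.
    W U : ℕ → V → V → ℕ
    W zero x y = δ x y
    W (suc r) x y = δ x y * E ^ suc r + U r x y
    U r x y = ∑ all (λ z → Φ x z * W r z y)

    mutual
      A≡∑W : ∀ r x → M₁ r x ≡ ∑ F (W r x)
      A≡∑W zero x = refl
      A≡∑W (suc r) x = sym (trans (∑-+ F _ _) (cong₂ _+_ (∑-*ʳ F (E ^ suc r) (δ x)) (sym (ΦA≡∑U r x))))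

      ΦA≡∑U : ∀ r x → ∑ all (λ z → Φ x z * M₁ r z) ≡ ∑ F (U r x)
      ΦA≡∑U r x = trans (∑-cong all (λ z → trans (cong (Φ x z *_) (A≡∑W r z)) (sym (∑-*ˡ F (Φ x z) (W r z)))))
                        (∑-swap all F (λ z y → Φ x z * W r z y))

    zero-or : ∀ p q → (p ≢ 0 → q ≡ 0) → p * q ≡ 0
    zero-or zero q h = refl
    zero-or (suc p) q h rewrite h (λ ()) = *-zeroʳ p

    -- The chain only climbs, so from `x` it reaches nothing but points above `x`.
    U≡0 : ∀ r x y → x ∈ all → lt x y ≡ false → U r x y ≡ 0
    W≡0 : ∀ r x z y → x ∈ all → z ∈ all → lt x y ≡ false → Φ x z ≢ 0 → W r z y ≡ 0
    U≡0 r x y x∈ ¬xy = ∑-zero-∈ all (λ z z∈ → zero-or (Φ x z) (W r z y) (W≡0 r x z y x∈ z∈ ¬xy))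
    W≡0 r x z y x∈ z∈ ¬xy p≢0 with z ≟′ y
    ... | yes refl with () ← trans (sym ¬xy) (Φ-lt x y x∈ p≢0)
    W≡0 zero x z y x∈ z∈ ¬xy p≢0 | no z≢y = δ≢ z≢y
    W≡0 (suc r) x z y x∈ z∈ ¬xy p≢0 | no z≢y = cong₂ (λ u v → u * E ^ suc r + v) (δ≢ z≢y) (U≡0 r z y z∈ ¬zy)
      where
      ¬zy : lt z y ≡ false
      ¬zy with lt z y in e
      ... | false = refl
      ... | true with () ← trans (sym ¬xy) (lt-trans x z y (Φ-lt x z x∈ p≢0) e)

    -- If `y` is one rank above `x`, only the direct step leads there, since every other first step
    -- ends in the rank of `y`. Otherwise the first step averages bounds that hold for each of its
    -- endpoints, and the outflow of `x` is at most `E`.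
    U≤ : ∀ r x y → x ∈ all → y ∈ F → U r x y ≤ K * E ^ r
    U≤ zero x y x∈ y∈ = ≤-trans (≤-reflexive (∑δ y (F⊆all y y∈) (Φ x)))
                                (≤-trans (Φ≤K x y x∈ y∈) (≤-reflexive (sym (*-identityʳ K))))
    U≤ (suc r) x y x∈ y∈ with rank y ≟ suc (rank x)
    ... | yes next = begin
      ∑ all (λ z → Φ x z * (δ z y * E ^ suc r + U r z y))  ≡⟨ ∑-cong-∈ all direct ⟩
      ∑ all (λ z → Φ x z * δ z y * E ^ suc r)              ≡⟨ ∑-*ʳ all (E ^ suc r) _ ⟩
      ∑ all (λ z → Φ x z * δ z y) * E ^ suc r              ≡⟨ cong (_* E ^ suc r) (∑δ y (F⊆all y y∈) (Φ x)) ⟩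
      Φ x y * E ^ suc r                                    ≤⟨ *-monoˡ-≤ (E ^ suc r) (Φ≤K x y x∈ y∈) ⟩
      K * E ^ suc r                                        ∎
      where
      open ≤-Reasoning
      same-rank : ∀ z → Φ x z ≢ 0 → lt z y ≡ false
      same-rank z p≢0 with lt z y in e
      ... | false = refl
      ... | true = ⊥-elim (<-irrefl (trans (Φ-rank x z p≢0) (sym next)) (lt-rank z y e))
      direct : ∀ z → z ∈ all → Φ x z * (δ z y * E ^ suc r + U r z y) ≡ Φ x z * δ z y * E ^ suc r
      direct z z∈ = begin-equality
        Φ x z * (δ z y * E ^ suc r + U r z y)          ≡⟨ *-distribˡ-+ (Φ x z) _ _ ⟩
        Φ x z * (δ z y * E ^ suc r) + Φ x z * U r z y  ≡⟨ cong (Φ x z * (δ z y * E ^ suc r) +_)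
                                                            (zero-or (Φ x z) (U r z y) (λ p≢0 → U≡0 r z y z∈ (same-rank z p≢0))) ⟩
        Φ x z * (δ z y * E ^ suc r) + 0                ≡⟨ +-identityʳ _ ⟩
        Φ x z * (δ z y * E ^ suc r)                    ≡⟨ sym (*-assoc (Φ x z) _ _) ⟩
        Φ x z * δ z y * E ^ suc r                      ∎
    ... | no skip = begin
      ∑ all (λ z → Φ x z * (δ z y * E ^ suc r + U r z y))  ≤⟨ ∑-mono-∈ all indirect ⟩
      ∑ all (λ z → Φ x z * (K * E ^ r))                    ≡⟨ ∑-*ʳ all (K * E ^ r) (Φ x) ⟩
      ∑ all (Φ x) * (K * E ^ r)                            ≤⟨ *-monoˡ-≤ (K * E ^ r) (outflow x x∈) ⟩
      E * (K * E ^ r)                                      ≡⟨ exchange E K (E ^ r) ⟩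
      K * (E * E ^ r)                                      ∎
      where
      open ≤-Reasoning
      exchange : ∀ a b c → a * (b * c) ≡ b * (a * c)
      exchange = solve-∀
      indirect : ∀ z → z ∈ all → Φ x z * (δ z y * E ^ suc r + U r z y) ≤ Φ x z * (K * E ^ r)
      indirect z z∈ with Φ x z ≟ 0
      ... | yes p≡0 rewrite p≡0 = z≤n
      ... | no p≢0 rewrite δ≢ {z} {y} (λ z≡y → skip (trans (cong rank (sym z≡y)) (Φ-rank x z p≢0))) =
        *-monoʳ-≤ (Φ x z) (U≤ r z y z∈ y∈)

    -- After `x` only the at most `d` points of F above it can be met, each with weight at most `K`.
    ΦA≤ : ∀ r x → x ∈ F → ∑ all (λ z → Φ x z * M₁ r z) ≤ d * (K * E ^ r)
    ΦA≤ r x x∈ = begin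
      ∑ all (λ z → Φ x z * M₁ r z)             ≡⟨ ΦA≡∑U r x ⟩
      ∑ F (U r x)                             ≤⟨ ∑-mono-∈ F bounded ⟩
      ∑ F (λ y → ⟦ lt x y ⟧ * (K * E ^ r))    ≡⟨ ∑-*ʳ F (K * E ^ r) _ ⟩
      ∑ F (λ y → ⟦ lt x y ⟧) * (K * E ^ r)    ≤⟨ *-monoˡ-≤ (K * E ^ r) (degree x x∈) ⟩
      d * (K * E ^ r)                         ∎
      where
      open ≤-Reasoning
      bounded : ∀ y → y ∈ F → U r x y ≤ ⟦ lt x y ⟧ * (K * E ^ r)
      bounded y y∈ with lt x y in e
      ... | true = ≤-trans (U≤ r x y (F⊆all x x∈) y∈) (≤-reflexive (sym (+-identityʳ _)))
      ... | false = ≤-reflexive (U≡0 r x y (F⊆all x x∈) e)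

    -- Each step up uses one power of `E` and one of the remaining steps. Rescaled in this way, the
    -- moments carry the same power `E ^ T` in all ranks and satisfy equations that do not mention
    -- the number of steps.
    a b : V → ℕ
    a x = E ^ rank x * M₁ (T ∸ rank x) x
    b x = E ^ rank x * M₂ (T ∸ rank x) x

    top : ∀ x z → z ∈ all → T ∸ rank x ≡ 0 → ¬ (Φ x z ≢ 0)
    top x z z∈ e p≢0 = <-irrefl refl
      (≤-trans (≤-reflexive (sym (Φ-rank x z p≢0))) (≤-trans (rank≤T z z∈) (m∸n≡0⇒m≤n e)))

    climb : ∀ x z r → T ∸ rank x ≡ suc r → Φ x z ≢ 0 → T ∸ rank z ≡ r
    climb x z r e p≢0 rewrite Φ-rank x z p≢0 | sym (pred[m∸n]≡m∸[1+n] T (rank x)) | e = refl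

    rank+r : ∀ x r → x ∈ all → T ∸ rank x ≡ suc r → rank x + suc r ≡ T
    rank+r x r x∈ e = trans (cong (rank x +_) (sym e)) (m+[n∸m]≡n (rank≤T x x∈))

    a-fixed : ∀ x → x ∈ all → E * a x ≡ E ^ suc T * 1F x + ∑ all (λ z → Φ x z * a z)
    a-fixed x x∈ with T ∸ rank x in e
    ... | zero = begin
      E * (E ^ rank x * 1F x)                            ≡⟨ sym (*-assoc E _ _) ⟩
      E ^ suc (rank x) * 1F x                            ≡⟨ cong (λ u → E ^ suc u * 1F x) (≤-antisym (rank≤T x x∈) (m∸n≡0⇒m≤n e)) ⟩
      E ^ suc T * 1F x                                   ≡⟨ sym (+-identityʳ _) ⟩
      E ^ suc T * 1F x + 0                               ≡⟨ cong (E ^ suc T * 1F x +_) (sym (∑-zero-∈ all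
                                                              (λ z z∈ → zero-or (Φ x z) (a z) (λ p≢0 → ⊥-elim (top x z z∈ e p≢0))))) ⟩
      E ^ suc T * 1F x + ∑ all (λ z → Φ x z * a z)       ∎
      where open ≡-Reasoning
    ... | suc r = begin
      E * (E ^ rank x * (1F x * E ^ suc r + ∑ all (λ z → Φ x z * M₁ r z)))
        ≡⟨ spread E (E ^ rank x) (1F x) (E ^ suc r) _ ⟩
      E * (E ^ rank x * E ^ suc r) * 1F x + E ^ suc (rank x) * ∑ all (λ z → Φ x z * M₁ r z)
        ≡⟨ cong₂ (λ u v → E * u * 1F x + v)
             (trans (sym (^-distribˡ-+-* E (rank x) (suc r))) (cong (E ^_) (rank+r x r x∈ e)))
             (sym (∑-*ˡ all (E ^ suc (rank x)) _)) ⟩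
      E ^ suc T * 1F x + ∑ all (λ z → E ^ suc (rank x) * (Φ x z * M₁ r z))
        ≡⟨ cong (E ^ suc T * 1F x +_) (∑-cong all step) ⟩
      E ^ suc T * 1F x + ∑ all (λ z → Φ x z * a z) ∎
      where
      open ≡-Reasoning
      spread : ∀ e p q f X → e * (p * (q * f + X)) ≡ e * (p * f) * q + e * p * X
      spread = solve-∀
      exchange : ∀ x y z → x * (y * z) ≡ y * (x * z)
      exchange = solve-∀
      step : ∀ z → E ^ suc (rank x) * (Φ x z * M₁ r z) ≡ Φ x z * a z
      step z with Φ x z ≟ 0
      ... | yes p≡0 rewrite p≡0 = *-zeroʳ (E ^ suc (rank x))
      ... | no p≢0 rewrite climb x z r e p≢0 | Φ-rank x z p≢0 = exchange (E ^ suc (rank x)) (Φ x z) (M₁ r z)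

    b-fixed : ∀ x → x ∈ all → E * b x ≡ 1F x * ∑ all (λ z → Φ x z * a z) + ∑ all (λ z → Φ x z * b z)
    b-fixed x x∈ with T ∸ rank x in e
    ... | zero = begin
      E * (E ^ rank x * 0)   ≡⟨ cong (E *_) (*-zeroʳ (E ^ rank x)) ⟩
      E * 0                  ≡⟨ *-zeroʳ E ⟩
      0                      ≡⟨ sym (cong₂ _+_ (trans (cong (1F x *_) (none a)) (*-zeroʳ (1F x))) (none b)) ⟩
      1F x * ∑ all (λ z → Φ x z * a z) + ∑ all (λ z → Φ x z * b z) ∎
      where
      open ≡-Reasoning
      none : ∀ h → ∑ all (λ z → Φ x z * h z) ≡ 0
      none h = ∑-zero-∈ all (λ z z∈ → zero-or (Φ x z) (h z) (λ p≢0 → ⊥-elim (top x z z∈ e p≢0)))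
    ... | suc r = begin
      E * (E ^ rank x * ∑ all (λ z → Φ x z * (M₂ r z + 1F x * M₁ r z)))
        ≡⟨ sym (*-assoc E (E ^ rank x) _) ⟩
      E ^ suc (rank x) * ∑ all (λ z → Φ x z * (M₂ r z + 1F x * M₁ r z))
        ≡⟨ sym (∑-*ˡ all (E ^ suc (rank x)) _) ⟩
      ∑ all (λ z → E ^ suc (rank x) * (Φ x z * (M₂ r z + 1F x * M₁ r z)))
        ≡⟨ ∑-cong all step ⟩
      ∑ all (λ z → 1F x * (Φ x z * a z) + Φ x z * b z)
        ≡⟨ trans (∑-+ all _ _) (cong (_+ ∑ all (λ z → Φ x z * b z)) (∑-*ˡ all (1F x) _)) ⟩
      1F x * ∑ all (λ z → Φ x z * a z) + ∑ all (λ z → Φ x z * b z) ∎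
      where
      open ≡-Reasoning
      spread : ∀ e p u q v → e * (p * (u + q * v)) ≡ q * (p * (e * v)) + p * (e * u)
      spread = solve-∀
      step : ∀ z → E ^ suc (rank x) * (Φ x z * (M₂ r z + 1F x * M₁ r z)) ≡ 1F x * (Φ x z * a z) + Φ x z * b z
      step z with Φ x z ≟ 0
      ... | yes p≡0 rewrite p≡0 = trans (*-zeroʳ (E ^ suc (rank x)))
                                        (sym (trans (+-identityʳ _) (*-zeroʳ (1F x))))
      ... | no p≢0 rewrite climb x z r e p≢0 | Φ-rank x z p≢0 =
        spread (E ^ suc (rank x)) (Φ x z) (M₂ r z) (1F x) (M₁ r z)

    ∑⁰ : (V → ℕ) → ℕ
    ∑⁰ h = ∑ all (λ x → ⟦ rank x ≡ᵇ 0 ⟧ * (μ x * h x))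

    -- Both sides of the fixed point equation are averaged over μ; outside rank 0 the inflow condition cancels h.
    averaged : ∀ (g h : V → ℕ) → (∀ x → x ∈ all → E * h x ≡ g x + ∑ all (λ z → Φ x z * h z)) →
      E * ∑⁰ h ≡ ∑ all (λ x → μ x * g x)
    averaged g h fixed = +-cancelʳ-≡ upper (E * ∑⁰ h) _ (begin
      E * ∑⁰ h + upper
        ≡⟨ cong (_+ upper) (sym (∑-*ˡ all E _)) ⟩
      ∑ all (λ x → E * (⟦ rank x ≡ᵇ 0 ⟧ * (μ x * h x))) + upper
        ≡⟨ sym (∑-+ all _ _) ⟩
      ∑ all (λ x → E * (⟦ rank x ≡ᵇ 0 ⟧ * (μ x * h x)) + ⟦ not (rank x ≡ᵇ 0) ⟧ * (E * μ x * h x))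
        ≡⟨ ∑-cong-∈ all (λ x x∈ → trans (both (rank x ≡ᵇ 0) E (μ x) (h x)) (cong (μ x *_) (fixed x x∈))) ⟩
      ∑ all (λ x → μ x * (g x + ∑ all (λ z → Φ x z * h z)))
        ≡⟨ trans (∑-cong all (λ x → *-distribˡ-+ (μ x) (g x) _)) (∑-+ all _ _) ⟩
      ∑ all (λ x → μ x * g x) + ∑ all (λ x → μ x * ∑ all (λ z → Φ x z * h z))
        ≡⟨ cong (∑ all (λ x → μ x * g x) +_) incoming ⟩
      ∑ all (λ x → μ x * g x) + upper ∎)
      where
      open ≡-Reasoning
      upper : ℕ
      upper = ∑ all (λ x → ⟦ not (rank x ≡ᵇ 0) ⟧ * (E * μ x * h x))
      both : ∀ c e m k → e * (⟦ c ⟧ * (m * k)) + ⟦ not c ⟧ * (e * m * k) ≡ m * (e * k)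
      both true = poly₁
        where
        poly₁ : ∀ e m k → e * (1 * (m * k)) + 0 * (e * m * k) ≡ m * (e * k)
        poly₁ = solve-∀
      both false = poly₀
        where
        poly₀ : ∀ e m k → e * (0 * (m * k)) + 1 * (e * m * k) ≡ m * (e * k)
        poly₀ = solve-∀
      at : ∀ z → z ∈ all → ∑ all (λ x → μ x * Φ x z) ≡ ⟦ not (rank z ≡ᵇ 0) ⟧ * (E * μ z)
      at z z∈ with rank z in e
      ... | zero = ∑-zero-∈ all (λ x x∈ → trans (*-comm (μ x) (Φ x z)) (zero-or (Φ x z) (μ x) (λ p≢0 → ⊥-elim (absurd x p≢0))))
        where
        absurd : ∀ x → Φ x z ≢ 0 → ⊥
        absurd x p≢0 with () ← trans (sym e) (Φ-rank x z p≢0)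
      ... | suc k = trans (inflow z z∈ (λ z≡0 → absurd (trans (sym e) z≡0))) (sym (+-identityʳ _))
        where
        absurd : suc k ≢ 0
        absurd ()
      incoming : ∑ all (λ x → μ x * ∑ all (λ z → Φ x z * h z)) ≡ upper
      incoming = begin
        ∑ all (λ x → μ x * ∑ all (λ z → Φ x z * h z))   ≡⟨ ∑-cong all (λ x → sym (∑-*ˡ all (μ x) _)) ⟩
        ∑ all (λ x → ∑ all (λ z → μ x * (Φ x z * h z))) ≡⟨ ∑-swap all all _ ⟩
        ∑ all (λ z → ∑ all (λ x → μ x * (Φ x z * h z))) ≡⟨ ∑-cong-∈ all (λ z z∈ → trans (∑-cong all (λ x → sym (*-assoc (μ x) (Φ x z) (h z))))
                                                             (trans (∑-*ʳ all (h z) _) (trans (cong (_* h z) (at z z∈)) (*-assoc ⟦ not (rank z ≡ᵇ 0) ⟧ (E * μ z) (h z))))) ⟩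
        upper ∎

    μF : ℕ
    μF = ∑ all (λ x → μ x * 1F x)

    μF≡∑F : μF ≡ ∑ F μ
    μF≡∑F = trans (∑-cong all (λ x → sym (∑-*ˡ F (μ x) (δ x))))
      (trans (∑-swap all F _) (∑-cong-∈ F (λ y y∈ → ∑δ y (F⊆all y y∈) μ)))

    Φa≤ : ∀ x → x ∈ F → ∑ all (λ z → Φ x z * a z) ≤ d * (K * E ^ T)
    Φa≤ x x∈ with T ∸ rank x in e
    ... | zero = ≤-trans (≤-reflexive (∑-zero-∈ all (λ z z∈ → zero-or (Φ x z) (a z) (λ p≢0 → ⊥-elim (top x z z∈ e p≢0))))) z≤n
    ... | suc r = begin
      ∑ all (λ z → Φ x z * a z)                              ≡⟨ ∑-cong all step ⟩
      ∑ all (λ z → E ^ suc (rank x) * (Φ x z * M₁ r z))       ≡⟨ ∑-*ˡ all (E ^ suc (rank x)) _ ⟩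
      E ^ suc (rank x) * ∑ all (λ z → Φ x z * M₁ r z)         ≤⟨ *-monoʳ-≤ (E ^ suc (rank x)) (ΦA≤ r x x∈) ⟩
      E ^ suc (rank x) * (d * (K * E ^ r))                   ≡⟨ collect E (E ^ rank x) d K (E ^ r) ⟩
      d * (K * (E ^ rank x * E ^ suc r))                     ≡⟨ cong (λ u → d * (K * u)) (trans (sym (^-distribˡ-+-* E (rank x) (suc r)))
                                                                  (cong (E ^_) (rank+r x r (F⊆all x x∈) e))) ⟩
      d * (K * E ^ T)                                        ∎
      where
      open ≤-Reasoning
      collect : ∀ e p d k q → e * p * (d * (k * q)) ≡ d * (k * (p * (e * q)))
      collect = solve-∀
      exchange : ∀ x y z → y * (x * z) ≡ x * (y * z)
      exchange = solve-∀
      step : ∀ z → Φ x z * a z ≡ E ^ suc (rank x) * (Φ x z * M₁ r z)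
      step z with Φ x z ≟ 0
      ... | yes p≡0 rewrite p≡0 = sym (*-zeroʳ (E ^ suc (rank x)))
      ... | no p≢0 rewrite climb x z r e p≢0 | Φ-rank x z p≢0 = exchange (E ^ suc (rank x)) (Φ x z) (M₁ r z)

  -- Weighted by `μ`, the points of F that are met add up to `∑ F μ`, and the pairs to at most
  -- `d * K / E` times that. `tangent`, started in rank 0, compares the two; the total weight `D`
  -- there pays for its constant term.
  supersaturation : ∀ s → s * E * ∑ F μ ≤ tri (suc s) * E * D + d * K * ∑ F μ
  supersaturation s = subst (λ m → s * E * m ≤ tri (suc s) * E * D + d * K * m) μF≡∑F
    (*-cancelˡ-≤ (E ^ T) ⦃ m^n≢0 E T ⦃ >-nonZero 0<E ⦄ ⦄ (begin
      E ^ T * (s * E * μF)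
        ≡⟨ p₁ (E ^ T) s E μF ⟩
      s * (E ^ suc T * μF)
        ≡⟨ cong (s *_) (sym (trans (averaged (λ x → E ^ suc T * 1F x) a a-fixed)
             (trans (∑-cong all (λ x → p₂ (μ x) (E ^ suc T) (1F x))) (∑-*ˡ all (E ^ suc T) _)))) ⟩
      s * (E * ∑⁰ a)
        ≡⟨ p₃ s E (∑⁰ a) ⟩
      E * (s * ∑⁰ a)
        ≤⟨ *-monoʳ-≤ E bottom-tangent ⟩
      E * (∑⁰ b + tri (suc s) * E ^ T * D)
        ≡⟨ *-distribˡ-+ E _ _ ⟩
      E * ∑⁰ b + E * (tri (suc s) * E ^ T * D)
        ≡⟨ cong (_+ E * (tri (suc s) * E ^ T * D)) (averaged _ b b-fixed) ⟩
      ∑ all (λ x → μ x * (1F x * ∑ all (λ z → Φ x z * a z))) + E * (tri (suc s) * E ^ T * D)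
        ≤⟨ +-monoˡ-≤ _ (∑-mono all (λ x → *-monoʳ-≤ (μ x) (on-F x))) ⟩
      ∑ all (λ x → μ x * (1F x * (d * (K * E ^ T)))) + E * (tri (suc s) * E ^ T * D)
        ≡⟨ cong (_+ E * (tri (suc s) * E ^ T * D)) (trans (∑-cong all (λ x → sym (*-assoc (μ x) (1F x) _))) (∑-*ʳ all (d * (K * E ^ T)) _)) ⟩
      μF * (d * (K * E ^ T)) + E * (tri (suc s) * E ^ T * D)
        ≡⟨ p₄ μF d K (E ^ T) E (tri (suc s)) D ⟩
      E ^ T * (tri (suc s) * E * D + d * K * μF) ∎))
    where
    open ≤-Reasoning
    p₁ : ∀ e s E m → e * (s * E * m) ≡ s * (E * e * m)
    p₁ = solve-∀
    p₂ : ∀ m e f → m * (e * f) ≡ e * (m * f)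
    p₂ = solve-∀
    p₃ : ∀ s E m → s * (E * m) ≡ E * (s * m)
    p₃ = solve-∀
    p₄ : ∀ m d K e E t D → m * (d * (K * e)) + E * (t * e * D) ≡ e * (t * E * D + d * K * m)
    p₄ = solve-∀
    on-F : ∀ x → 1F x * ∑ all (λ z → Φ x z * a z) ≤ 1F x * (d * (K * E ^ T))
    on-F x with 1F x ≟ 0
    ... | yes e rewrite e = z≤n
    ... | no ne with ∑-nonzero F (δ x) ne
    ... | y , y∈ , δ≢0 with x ≟′ y
    ... | yes refl = *-monoʳ-≤ (1F x) (Φa≤ x y∈)
    ... | no _ = ⊥-elim (δ≢0 refl)
    bottom-tangent : s * ∑⁰ a ≤ ∑⁰ b + tri (suc s) * E ^ T * D
    bottom-tangent = begin
      s * ∑⁰ a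
        ≡⟨ sym (∑-*ˡ all s _) ⟩
      ∑ all (λ x → s * (⟦ rank x ≡ᵇ 0 ⟧ * (μ x * a x)))
        ≤⟨ ∑-mono-∈ all pointwise ⟩
      ∑ all (λ x → ⟦ rank x ≡ᵇ 0 ⟧ * (μ x * b x) + tri (suc s) * E ^ T * (⟦ rank x ≡ᵇ 0 ⟧ * μ x))
        ≡⟨ trans (∑-+ all _ _) (cong (∑⁰ b +_) (∑-*ˡ all (tri (suc s) * E ^ T) _)) ⟩
      ∑⁰ b + tri (suc s) * E ^ T * ∑ all (λ x → ⟦ rank x ≡ᵇ 0 ⟧ * μ x)
        ≤⟨ +-monoʳ-≤ (∑⁰ b) (*-monoʳ-≤ (tri (suc s) * E ^ T) bottom) ⟩
      ∑⁰ b + tri (suc s) * E ^ T * D ∎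
      where
      pointwise : ∀ x → x ∈ all → s * (⟦ rank x ≡ᵇ 0 ⟧ * (μ x * a x)) ≤
        ⟦ rank x ≡ᵇ 0 ⟧ * (μ x * b x) + tri (suc s) * E ^ T * (⟦ rank x ≡ᵇ 0 ⟧ * μ x)
      pointwise x x∈ with rank x
      ... | suc _ = ≤-trans (≤-reflexive (*-zeroʳ s)) z≤n
      ... | zero = begin
        s * (1 * (μ x * (1 * M₁ T x)))                     ≡⟨ q₁ s (μ x) (M₁ T x) ⟩
        μ x * (s * M₁ T x)                                 ≤⟨ *-monoʳ-≤ (μ x) (tangent s T x x∈ 0) ⟩
        μ x * (M₂ T x + 0 + tri (suc s) * E ^ T)           ≡⟨ q₂ (μ x) (M₂ T x) (tri (suc s)) (E ^ T) ⟩
        1 * (μ x * (1 * M₂ T x)) + tri (suc s) * E ^ T * (1 * μ x) ∎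
        where
        q₁ : ∀ s m a → s * (1 * (m * (1 * a))) ≡ m * (s * a)
        q₁ = solve-∀
        q₂ : ∀ m b t e → m * (b + 0 + t * e) ≡ 1 * (m * (1 * b)) + t * e * (1 * m)
        q₂ = solve-∀

-- Log-concave sequences and layer sizes

-- sh a h is h delayed by a, with value 0 before time a.
sh : ℕ → (ℕ → ℕ) → ℕ → ℕ
sh zero h k = h k
sh (suc a) h zero = 0
sh (suc a) h (suc k) = sh a h k

sh-+ : ∀ a h k → sh a h (a + k) ≡ h k
sh-+ zero h k = refl
sh-+ (suc a) h k = sh-+ a h k

sh-< : ∀ a h {k} → k < a → sh a h k ≡ 0
sh-< (suc a) h {zero} _ = refl
sh-< (suc a) h {suc k} (s≤s k<a) = sh-< a h k<a

sh-cong : ∀ a {h h′ : ℕ → ℕ} → (∀ k → h k ≡ h′ k) → ∀ k → sh a h k ≡ sh a h′ k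
sh-cong zero e k = e k
sh-cong (suc a) e zero = refl
sh-cong (suc a) e (suc k) = sh-cong a e k

sh-∑ : ∀ {V : Set} a (xs : List V) (h : V → ℕ → ℕ) k →
       sh a (λ j → ∑ xs (λ x → h x j)) k ≡ ∑ xs (λ x → sh a (h x) k)
sh-∑ zero xs h k = refl
sh-∑ (suc a) xs h zero = sym (∑-zero xs)
sh-∑ (suc a) xs h (suc k) = sh-∑ a xs h k

sh-* : ∀ a c h k → sh a (λ j → c * h j) k ≡ c * sh a h k
sh-* zero c h k = refl
sh-* (suc a) c h zero = sym (*-zeroʳ c)
sh-* (suc a) c h (suc k) = sh-* a c h k

sh-sh : ∀ a b h k → sh a (sh b h) k ≡ sh (a + b) h k
sh-sh zero b h k = refl
sh-sh (suc a) b h zero = refl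
sh-sh (suc a) b h (suc k) = sh-sh a b h k

sh-comm : ∀ a b h k → sh a (sh b h) k ≡ sh b (sh a h) k
sh-comm a b h k = trans (sh-sh a b h k) (trans (cong (λ c → sh c h k) (+-comm a b)) (sym (sh-sh b a h k)))

sh-index : ∀ a h k → k * sh a h k ≡ a * sh a h k + sh a (λ j → j * h j) k
sh-index zero h k = refl
sh-index (suc a) h zero = sym (trans (+-identityʳ _) (*-zeroʳ a))
sh-index (suc a) h (suc k) =
  trans (cong (sh a h k +_) (sh-index a h k)) (sym (+-assoc (sh a h k) (a * sh a h k) _))

LogConcave : (ℕ → ℕ) → Set
LogConcave h = ∀ i j → i ≤ j → h i * h (suc j) ≤ h (suc i) * h j

lc-spread : ∀ {h} → LogConcave h → ∀ u {x z} → x ≤ z → h x * h (z + u) ≤ h (x + u) * h z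
lc-spread {h} lc zero {x} {z} x≤z = ≤-reflexive (cong₂ (λ i j → h i * h j) (sym (+-identityʳ x)) (+-identityʳ z))
lc-spread {h} lc (suc u) {x} {z} x≤z with m≤n⇒m<n∨m≡n x≤z
... | inj₂ refl = ≤-reflexive (*-comm (h x) _)
... | inj₁ x<z = begin
  h x * h (z + suc u)     ≡⟨ cong (λ i → h x * h i) (+-suc z u) ⟩
  h x * h (suc (z + u))   ≤⟨ lc x (z + u) (≤-trans x≤z (m≤m+n z u)) ⟩
  h (suc x) * h (z + u)   ≤⟨ lc-spread {h} lc u x<z ⟩
  h (suc x + u) * h z     ≡⟨ cong (λ i → h i * h z) (sym (+-suc x u)) ⟩
  h (x + suc u) * h z     ∎
  where open ≤-Reasoning

-- The more a log-concave sequence is delayed, the further right its mass lies, in the sense of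
-- likelihood ratios.
sh-lc : ∀ {h} → LogConcave h → ∀ {a b i j} → a ≤ b → i ≤ j →
        sh b h i * sh a h j ≤ sh a h i * sh b h j
sh-lc {h} lc {a} {b} {i} {j} a≤b i≤j with b ≤? i
... | no b≰i rewrite sh-< b h (≰⇒> b≰i) = z≤n
... | yes b≤i with m≤n⇒∃[o]m+o≡n a≤b | m≤n⇒∃[o]m+o≡n b≤i | m≤n⇒∃[o]m+o≡n i≤j
... | c , refl | x , refl | y , refl = begin
  sh (a + c) h (a + c + x) * sh a h (a + c + x + y)
    ≡⟨ cong₂ _*_ (sh-+ (a + c) h x) (trans (cong (sh a h) (assoc₁ a c x y)) (sh-+ a h _)) ⟩
  h x * h (x + y + c)
    ≤⟨ lc-spread {h} lc c (m≤m+n x y) ⟩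
  h (x + c) * h (x + y)
    ≡⟨ sym (cong₂ _*_ (trans (cong (sh a h) (assoc₂ a c x)) (sh-+ a h _))
                      (trans (cong (sh (a + c) h) (+-assoc (a + c) x y)) (sh-+ (a + c) h _))) ⟩
  sh a h (a + c + x) * sh (a + c) h (a + c + x + y) ∎
  where
  open ≤-Reasoning
  assoc₁ : ∀ a c x y → a + c + x + y ≡ a + (x + y + c)
  assoc₁ = solve-∀
  assoc₂ : ∀ a c x → a + c + x ≡ a + (x + c)
  assoc₂ = solve-∀

∑*∑-mono : ∀ n m {f f′ g g′ : ℕ → ℕ} → (∀ i j → i < n → j < m → f i * g j ≤ f′ i * g′ j) →
           ∑< n f * ∑< m g ≤ ∑< n f′ * ∑< m g′
∑*∑-mono n m {f} {f′} {g} {g′} h = begin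
  ∑< n f * ∑< m g                     ≡⟨ sym (∑-*ʳ (downFrom n) (∑< m g) f) ⟩
  ∑< n (λ i → f i * ∑< m g)           ≤⟨ ∑<-mono n (λ i i<n → begin
    f i * ∑< m g                        ≡⟨ sym (∑-*ˡ (downFrom m) (f i) g) ⟩
    ∑< m (λ j → f i * g j)              ≤⟨ ∑<-mono m (λ j j<m → h i j i<n j<m) ⟩
    ∑< m (λ j → f′ i * g′ j)            ≡⟨ ∑-*ˡ (downFrom m) (f′ i) g′ ⟩
    f′ i * ∑< m g′                      ∎) ⟩
  ∑< n (λ i → f′ i * ∑< m g′)         ≡⟨ ∑-*ʳ (downFrom n) (∑< m g′) f′ ⟩
  ∑< n f′ * ∑< m g′                   ∎
  where open ≤-Reasoning

*∑-mono : ∀ n c c′ {f g : ℕ → ℕ} → (∀ i → i < n → c * f i ≤ c′ * g i) → c * ∑< n f ≤ c′ * ∑< n g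
*∑-mono n c c′ {f} {g} h = begin
  c * ∑< n f              ≡⟨ sym (∑-*ˡ (downFrom n) c f) ⟩
  ∑< n (λ i → c * f i)    ≤⟨ ∑<-mono n h ⟩
  ∑< n (λ i → c′ * g i)   ≡⟨ ∑-*ˡ (downFrom n) c′ g ⟩
  c′ * ∑< n g             ∎
  where open ≤-Reasoning

-- When `k` grows by one, the window sum gains `h (suc k)` and loses its last term `e k`.
-- Log-concavity compares both, term by term, with the window sums at `i` and `j`.
window-lc : ∀ t {h} → LogConcave h → LogConcave (λ k → ∑< t (λ a → sh a h k))
window-lc zero lc i j i≤j = z≤n
window-lc (suc t) {h} lc i j i≤j = +-cancelʳ-≤ (H i * e j) _ _ (begin
  H i * H (suc j) + H i * e j          ≡⟨ sym (*-distribˡ-+ (H i) (H (suc j)) (e j)) ⟩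
  H i * (H (suc j) + e j)              ≡⟨ cong (H i *_) (shift j) ⟩
  H i * (h (suc j) + H j)              ≡⟨ *-distribˡ-+ (H i) (h (suc j)) (H j) ⟩
  H i * h (suc j) + H i * H j          ≤⟨ +-monoˡ-≤ (H i * H j) enter ⟩
  h (suc i) * H j + H i * H j          ≡⟨ sym (*-distribʳ-+ (H j) (h (suc i)) (H i)) ⟩
  (h (suc i) + H i) * H j              ≡⟨ cong (_* H j) (sym (shift i)) ⟩
  (H (suc i) + e i) * H j              ≡⟨ *-distribʳ-+ (H j) (H (suc i)) (e i) ⟩
  H (suc i) * H j + e i * H j          ≤⟨ +-monoʳ-≤ (H (suc i) * H j) leave ⟩
  H (suc i) * H j + e j * H i          ≡⟨ cong (H (suc i) * H j +_) (*-comm (e j) (H i)) ⟩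
  H (suc i) * H j + H i * e j          ∎)
  where
  open ≤-Reasoning
  H e : ℕ → ℕ
  H k = ∑< (suc t) (λ a → sh a h k)
  e k = sh t h k
  shift : ∀ k → H (suc k) + e k ≡ h (suc k) + H k
  shift k = trans (+-comm (H (suc k)) (e k)) (∑<-suc (suc t) (λ a → sh a h (suc k)))
  enter : H i * h (suc j) ≤ h (suc i) * H j
  enter = ≤-trans (≤-reflexive (*-comm (H i) (h (suc j))))
    (*∑-mono (suc t) (h (suc j)) (h (suc i)) (λ a _ →
      ≤-trans (≤-reflexive (*-comm (h (suc j)) (sh a h i)))
              (sh-lc {h} lc {a = 0} {b = suc a} {i = suc i} {j = suc j} z≤n (s≤s i≤j))))
  leave : e i * H j ≤ e j * H i
  leave = *∑-mono (suc t) (e i) (e j) (λ a a≤t →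
    ≤-trans (sh-lc {h} lc (≤-pred a≤t) i≤j) (≤-reflexive (*-comm (sh a h i) (e j))))

module Layers (t : ℕ) where

  -- N m k is the number of points of rank k in [t]^m.
  N : ℕ → ℕ → ℕ
  N zero zero = 1
  N zero (suc k) = 0
  N (suc m) k = ∑< t (λ a → sh a (N m) k)

  N-lc : ∀ m → LogConcave (N m)
  N-lc zero i j _ = ≤-trans (≤-reflexive (*-zeroʳ (N zero i))) z≤n
  N-lc (suc m) = window-lc t (N-lc m)

  -- By symmetry the first coordinate of a random point of rank k has mean k / (m + 1).
  mean : ∀ m k → suc m * ∑< t (λ a → a * sh a (N m) k) ≡ k * N (suc m) k
  mean m k = sym (begin
    k * N (suc m) k
      ≡⟨ sym (∑-*ˡ (downFrom t) k _) ⟩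
    ∑< t (λ a → k * sh a (N m) k)
      ≡⟨ trans (∑-cong (downFrom t) (λ a → sh-index a (N m) k)) (∑-+ (downFrom t) _ _) ⟩
    ∑< t (λ a → a * sh a (N m) k) + ∑< t (λ a → sh a (λ j → j * N m j) k)
      ≡⟨ cong (∑< t (λ a → a * sh a (N m) k) +_) (rest m) ⟩
    suc m * ∑< t (λ a → a * sh a (N m) k) ∎)
    where
    open ≡-Reasoning
    -- By `mean` for one coordinate fewer, the sum of the other coordinates is `m` times one of
    -- them; delays commute, so that coordinate trades places with the first.
    rest : ∀ m → ∑< t (λ a → sh a (λ j → j * N m j) k) ≡ m * ∑< t (λ b → b * sh b (N m) k)
    rest zero = trans (∑-cong (downFrom t) (λ a → trans (sh-cong a vanish k) (sh-* a 0 (λ _ → 0) k))) (∑-zero (downFrom t))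
      where
      vanish : ∀ j → j * N zero j ≡ 0
      vanish zero = refl
      vanish (suc j) = *-zeroʳ j
    rest (suc m) = begin
      ∑< t (λ a → sh a (λ j → j * N (suc m) j) k)
        ≡⟨ ∑-cong (downFrom t) (λ a → trans (sh-cong a (λ j → sym (mean m j)) k)
             (trans (sh-* a (suc m) (λ j → ∑< t (λ b → b * sh b (N m) j)) k)
                    (cong (suc m *_) (sh-∑ a (downFrom t) (λ b j → b * sh b (N m) j) k)))) ⟩
      ∑< t (λ a → suc m * ∑< t (λ b → sh a (λ j → b * sh b (N m) j) k))
        ≡⟨ ∑-*ˡ (downFrom t) (suc m) _ ⟩
      suc m * ∑< t (λ a → ∑< t (λ b → sh a (λ j → b * sh b (N m) j) k))
        ≡⟨ cong (suc m *_) (∑-swap (downFrom t) (downFrom t) _) ⟩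
      suc m * ∑< t (λ b → ∑< t (λ a → sh a (λ j → b * sh b (N m) j) k))
        ≡⟨ cong (suc m *_) (∑-cong (downFrom t) (λ b → trans
             (∑-cong (downFrom t) (λ a → trans (sh-* a b (sh b (N m)) k) (cong (b *_) (sh-comm a b (N m) k))))
             (trans (∑-*ˡ (downFrom t) b _) (cong (b *_) (sym (sh-∑ b (downFrom t) (λ a j → sh a (N m) j) k)))))) ⟩
      suc m * ∑< t (λ b → b * sh b (N (suc m)) k) ∎

  -- In P m k c / P m k t and Q m k c / Q m k t, the first coordinate is below c
  -- given rank k, respectively k + 1; f is the flow of mass across c, scaled by both totals.
  module _ (m k : ℕ) where

    u w P Q f : ℕ → ℕ
    u i = sh i (N m) k
    w i = sh i (N m) (suc k)
    P c = ∑< c u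
    Q c = ∑< c w
    f c = P c * Q t ∸ Q c * P t

    -- Monotone likelihood ratio: raising the rank pushes the first coordinate upwards. Hence the
    -- truncated subtraction in `f` loses nothing, and mass crosses each cut in one direction only.
    ratio : ∀ i j → i ≤ j → w i * u j ≤ u i * w j
    ratio i j i≤j = ≤-trans (≤-reflexive (*-comm (w i) (u j))) (sh-lc {N m} (N-lc m) i≤j (n≤1+n k))

    interval-ratio : ∀ c n₁ n₂ → ∑< n₁ (λ i → w (c + i)) * ∑< n₂ (λ j → u (c + n₁ + j)) ≤
                                 ∑< n₁ (λ i → u (c + i)) * ∑< n₂ (λ j → w (c + n₁ + j))
    interval-ratio c n₁ n₂ = ∑*∑-mono n₁ n₂ (λ i j i<n₁ _ →
      ratio (c + i) (c + n₁ + j) (≤-trans (+-monoʳ-≤ c (<⇒≤ i<n₁)) (m≤m+n (c + n₁) j)))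

    QP≤PQ : ∀ {c e} → c ≤ e → Q c * P e ≤ P c * Q e
    QP≤PQ {c} c≤e with m≤n⇒∃[o]m+o≡n c≤e
    ... | o , refl = begin
      Q c * P (c + o)                        ≡⟨ cong (Q c *_) (∑<-+ c o u) ⟩
      Q c * (P c + ∑< o (λ i → u (c + i)))   ≡⟨ *-distribˡ-+ (Q c) (P c) _ ⟩
      Q c * P c + Q c * ∑< o (λ i → u (c + i)) ≤⟨ +-mono-≤ (≤-reflexive (*-comm (Q c) (P c))) (interval-ratio 0 c o) ⟩
      P c * Q c + P c * ∑< o (λ i → w (c + i)) ≡⟨ sym (*-distribˡ-+ (P c) (Q c) _) ⟩
      P c * (Q c + ∑< o (λ i → w (c + i)))   ≡⟨ cong (P c *_) (sym (∑<-+ c o w)) ⟩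
      P c * Q (c + o)                        ∎
      where open ≤-Reasoning

    f-def : ∀ {c} → c ≤ t → f c + Q c * P t ≡ P c * Q t
    f-def c≤t = m∸n+n≡m (QP≤PQ c≤t)

    f-step : ∀ {b} → b < t → f b + Q t * u b ≡ f (suc b) + w b * P t
    f-step {b} b<t = +-cancelʳ-≡ (Q b * P t) _ _ (begin
      f b + Q t * u b + Q b * P t              ≡⟨ r₁ (f b) (Q t * u b) (Q b * P t) ⟩
      f b + Q b * P t + Q t * u b              ≡⟨ cong (_+ Q t * u b) (f-def (<⇒≤ b<t)) ⟩
      P b * Q t + Q t * u b                    ≡⟨ r₂ (P b) (Q t) (u b) ⟩
      (u b + P b) * Q t                        ≡⟨ sym (f-def b<t) ⟩
      f (suc b) + (w b + Q b) * P t            ≡⟨ r₃ (f (suc b)) (w b) (Q b) (P t) ⟩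
      f (suc b) + w b * P t + Q b * P t        ∎)
      where
      open ≡-Reasoning
      r₁ : ∀ a b c → a + b + c ≡ a + c + b
      r₁ = solve-∀
      r₂ : ∀ p q u → p * q + q * u ≡ (u + p) * q
      r₂ = solve-∀
      r₃ : ∀ f w q p → f + (w + q) * p ≡ f + w * p + q * p
      r₃ = solve-∀

    Q-suc : ∀ c → Q (suc c) ≡ w 0 + P c
    Q-suc c = ∑<-suc c w

    -- By `Q-suc` the slices of rank `k + 1` with positive first coordinate are those of rank `k`
    -- moved up by one. So raising the rank by one raises the first coordinate, stochastically, by
    -- at most one, and the mass needed beyond the cut `suc b` can all be taken from `b`.
    f-suc≤ : ∀ {b} → b < t → f (suc b) ≤ Q t * u b
    f-suc≤ {b} b<t = +-cancelʳ-≤ (Q (suc b) * P t) _ _ (begin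
      f (suc b) + Q (suc b) * P t              ≡⟨ f-def b<t ⟩
      (u b + P b) * Q t                        ≡⟨ r₁ (u b) (P b) (Q t) ⟩
      Q t * u b + P b * Q t                    ≤⟨ +-monoʳ-≤ (Q t * u b) inner ⟩
      Q t * u b + Q (suc b) * P t              ∎)
      where
      open ≤-Reasoning
      r₁ : ∀ u p q → (u + p) * q ≡ q * u + p * q
      r₁ = solve-∀
      r₂ : ∀ p w z → p * (w + z) ≡ p * w + p * z
      r₂ = solve-∀
      r₃ : ∀ p w z → z * w + p * z ≡ (w + p) * z
      r₃ = solve-∀
      Qt≤ : Q t ≤ w 0 + P t
      Qt≤ = ≤-trans (∑<-≤ w (n≤1+n t)) (≤-reflexive (Q-suc t))
      inner : P b * Q t ≤ Q (suc b) * P t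
      inner = begin
        P b * Q t              ≤⟨ *-monoʳ-≤ (P b) Qt≤ ⟩
        P b * (w 0 + P t)      ≡⟨ r₂ (P b) (w 0) (P t) ⟩
        P b * w 0 + P b * P t  ≤⟨ +-monoˡ-≤ (P b * P t) (*-monoˡ-≤ (w 0) (∑<-≤ u (<⇒≤ b<t))) ⟩
        P t * w 0 + P b * P t  ≡⟨ r₃ (P b) (w 0) (P t) ⟩
        (w 0 + P b) * P t      ≡⟨ cong (_* P t) (sym (Q-suc b)) ⟩
        Q (suc b) * P t        ∎

    -- The mass at `b` left for the case that the other coordinates gain the one.
    stay : ℕ → ℕ
    stay b = Q t * u b ∸ f (suc b)

    f+stay : ∀ {b} → b < t → f (suc b) + stay b ≡ Q t * u b
    f+stay b<t = m+[n∸m]≡n (f-suc≤ b<t)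

    f+stay′ : ∀ {b} → b < t → f b + stay b ≡ w b * P t
    f+stay′ {b} b<t = +-cancelˡ-≡ (f (suc b)) _ _ (begin
      f (suc b) + (f b + stay b)     ≡⟨ r (f (suc b)) (f b) (stay b) ⟩
      f b + (f (suc b) + stay b)     ≡⟨ cong (f b +_) (f+stay b<t) ⟩
      f b + Q t * u b                ≡⟨ f-step b<t ⟩
      f (suc b) + w b * P t          ∎)
      where
      open ≡-Reasoning
      r : ∀ a b c → a + (b + c) ≡ b + (a + c)
      r = solve-∀

    abel : ∀ n (g : ℕ → ℕ) → ∑< n (λ c → ∑< (suc c) g) + ∑< n (λ i → i * g i) ≡ n * ∑< n g
    abel zero g = refl
    abel (suc n) g = begin
      (g n + G) + S₁ + (n * g n + S₂)    ≡⟨ r₁ (g n) G S₁ n S₂ ⟩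
      (S₁ + S₂) + (g n + G + n * g n)    ≡⟨ cong (_+ (g n + G + n * g n)) (abel n g) ⟩
      n * G + (g n + G + n * g n)        ≡⟨ r₂ n G (g n) ⟩
      suc n * (g n + G)                  ∎
      where
      open ≡-Reasoning
      G S₁ S₂ : ℕ
      G = ∑< n g
      S₁ = ∑< n (λ c → ∑< (suc c) g)
      S₂ = ∑< n (λ i → i * g i)
      r₁ : ∀ x G S n T → (x + G) + S + (n * x + T) ≡ (S + T) + (x + G + n * x)
      r₁ = solve-∀
      r₂ : ∀ n G x → n * G + (x + G + n * x) ≡ suc n * (x + G)
      r₂ = solve-∀

    -- Raising the rank by one raises the mean of the first coordinate by 1 / (m + 1).
    ∑f : suc m * ∑< t (f ∘ suc) ≡ Q t * P t
    ∑f = +-cancelʳ-≡ (M * (Z * SQ) + k * (X * Z)) _ _ (begin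
      M * S + (M * (Z * SQ) + k * (X * Z))
        ≡⟨ r₁ M S Z SQ (k * (X * Z)) ⟩
      M * (S + SQ * Z) + k * (X * Z)
        ≡⟨ cong₂ (λ a b → M * a + b) summed (r₂ k X Z) ⟩
      M * (SP * X) + X * (k * Z)
        ≡⟨ cong (λ a → M * (SP * X) + X * a) (sym (mean m k)) ⟩
      M * (SP * X) + X * (M * ∑< t (λ i → i * u i))
        ≡⟨ r₃ M SP X (∑< t (λ i → i * u i)) ⟩
      M * X * (SP + ∑< t (λ i → i * u i))
        ≡⟨ cong (M * X *_) (abel t u) ⟩
      M * X * (t * Z)
        ≡⟨ r₄ M X t Z ⟩
      M * Z * (t * X)
        ≡⟨ cong (M * Z *_) (sym (abel t w)) ⟩
      M * Z * (SQ + ∑< t (λ i → i * w i))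
        ≡⟨ r₅ M Z SQ (∑< t (λ i → i * w i)) ⟩
      M * (Z * SQ) + Z * (M * ∑< t (λ i → i * w i))
        ≡⟨ cong (λ a → M * (Z * SQ) + Z * a) (mean m (suc k)) ⟩
      M * (Z * SQ) + Z * (suc k * X)
        ≡⟨ r₆ (M * (Z * SQ)) Z k X ⟩
      X * Z + (M * (Z * SQ) + k * (X * Z)) ∎)
      where
      open ≡-Reasoning
      M X Z S SP SQ : ℕ
      M = suc m
      X = Q t
      Z = P t
      S = ∑< t (f ∘ suc)
      SP = ∑< t (λ c → P (suc c))
      SQ = ∑< t (λ c → Q (suc c))
      summed : S + SQ * Z ≡ SP * X
      summed = trans (cong (S +_) (sym (∑-*ʳ (downFrom t) Z _)))
        (trans (sym (∑-+ (downFrom t) _ _))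
        (trans (∑<-cong t (λ c c<t → f-def c<t)) (∑-*ʳ (downFrom t) X _)))
      r₁ : ∀ M S Z R c → M * S + (M * (Z * R) + c) ≡ M * (S + R * Z) + c
      r₁ = solve-∀
      r₂ : ∀ k X Z → k * (X * Z) ≡ X * (k * Z)
      r₂ = solve-∀
      r₃ : ∀ M S X T → M * (S * X) + X * (M * T) ≡ M * X * (S + T)
      r₃ = solve-∀
      r₄ : ∀ M X t Z → M * X * (t * Z) ≡ M * Z * (t * X)
      r₄ = solve-∀
      r₅ : ∀ M Z S T → M * Z * (S + T) ≡ M * (Z * S) + Z * (M * T)
      r₅ = solve-∀
      r₆ : ∀ A Z k X → A + Z * (suc k * X) ≡ X * Z + (A + k * (X * Z))
      r₆ = solve-∀

    -- The quotient `f c / P c` is `Q t - P t * Q c / P c`, and `Q / P` increases by `QP≤PQ`.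
    f-left : ∀ {b c} → b ≤ c → c ≤ t → f c * P b ≤ f b * P c
    f-left {b} {c} b≤c c≤t = +-cancelʳ-≤ (Q c * Z * P b + Q b * Z * P c) _ _ (begin
      f c * P b + (Q c * Z * P b + Q b * Z * P c)   ≡⟨ r₁ (f c) (P b) (Q c) Z (Q b) (P c) ⟩
      (f c + Q c * Z) * P b + Q b * P c * Z         ≡⟨ cong (λ a → a * P b + Q b * P c * Z) (f-def c≤t) ⟩
      P c * X * P b + Q b * P c * Z                 ≤⟨ +-monoʳ-≤ (P c * X * P b) (*-monoˡ-≤ Z (QP≤PQ b≤c)) ⟩
      P c * X * P b + P b * Q c * Z                 ≡⟨ r₂ (P c) X (P b) (Q c) Z ⟩
      P b * X * P c + Q c * Z * P b                 ≡⟨ cong (λ a → a * P c + Q c * Z * P b) (sym (f-def (≤-trans b≤c c≤t))) ⟩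
      (f b + Q b * Z) * P c + Q c * Z * P b         ≡⟨ r₃ (f b) (Q b) Z (P c) (Q c * Z * P b) ⟩
      f b * P c + (Q c * Z * P b + Q b * Z * P c)   ∎)
      where
      open ≤-Reasoning
      X Z : ℕ
      X = Q t
      Z = P t
      r₁ : ∀ f p q z r s → f * p + (q * z * p + r * z * s) ≡ (f + q * z) * p + r * s * z
      r₁ = solve-∀
      r₂ : ∀ c x b q z → c * x * b + b * q * z ≡ b * x * c + q * z * b
      r₂ = solve-∀
      r₃ : ∀ f q z p y → (f + q * z) * p + y ≡ f * p + (y + q * z * p)
      r₃ = solve-∀

    -- The mirror image of `f-left`: the flow across a cut is also a difference of products with
    -- tails, so its quotient by the tail of `w` beyond the cut increases. The tail at `c` is
    -- finally replaced by the larger `Q t`.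
    f-right : ∀ c n₁ n₂ → c + n₁ + n₂ ≡ t →
      f c * ∑< n₂ (λ j → w (c + n₁ + j)) ≤ f (c + n₁) * Q t
    f-right c n₁ n₂ e = ≤-trans (+-cancelʳ-≤ (Qc * Z * q′ + Qb * Z * (q + q′)) _ _ (begin
      f c * q′ + (Qc * Z * q′ + Qb * Z * (q + q′))
        ≡⟨ r₁ (f c) q′ Qc Z (Qb * Z * (q + q′)) ⟩
      (f c + Qc * Z) * q′ + Qb * Z * (q + q′)
        ≡⟨ cong (λ a → a * q′ + Qb * Z * (q + q′)) (f-def c≤t) ⟩
      P c * X * q′ + Qb * Z * (q + q′)
        ≤⟨ +-cancelʳ-≤ (X * (q * p′)) _ _ (begin
          P c * X * q′ + Qb * Z * (q + q′) + X * (q * p′)  ≤⟨ +-monoʳ-≤ _ (*-monoʳ-≤ X (interval-ratio c n₁ n₂)) ⟩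
          P c * X * q′ + Qb * Z * (q + q′) + X * (p * q′)  ≡⟨ identity ⟩
          Pb * X * (q + q′) + Qc * Z * q′ + X * (q * p′)   ∎) ⟩
      Pb * X * (q + q′) + Qc * Z * q′
        ≡⟨ cong (λ a → a * (q + q′) + Qc * Z * q′) (sym (f-def b≤t)) ⟩
      (f (c + n₁) + Qb * Z) * (q + q′) + Qc * Z * q′
        ≡⟨ r₂ (f (c + n₁)) Qb Z (q + q′) (Qc * Z * q′) ⟩
      f (c + n₁) * (q + q′) + (Qc * Z * q′ + Qb * Z * (q + q′)) ∎))
      (*-monoʳ-≤ (f (c + n₁)) (≤-trans (m≤n+m (q + q′) Qc) (≤-reflexive (sym X≡))))
      where
      open ≤-Reasoning
      X Z p p′ q q′ Qc Qb Pb : ℕ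
      X = Q t
      Z = P t
      p = ∑< n₁ (λ i → u (c + i))
      q = ∑< n₁ (λ i → w (c + i))
      p′ = ∑< n₂ (λ j → u (c + n₁ + j))
      q′ = ∑< n₂ (λ j → w (c + n₁ + j))
      Qc = Q c
      Qb = Q (c + n₁)
      Pb = P (c + n₁)
      b≤t : c + n₁ ≤ t
      b≤t = ≤-trans (m≤m+n (c + n₁) n₂) (≤-reflexive e)
      c≤t : c ≤ t
      c≤t = ≤-trans (m≤m+n c n₁) b≤t
      Qb≡ : Qb ≡ Qc + q
      Qb≡ = ∑<-+ c n₁ w
      Pb≡ : Pb ≡ P c + p
      Pb≡ = ∑<-+ c n₁ u
      X≡ : X ≡ Qc + (q + q′)
      X≡ = trans (cong Q (sym e)) (trans (∑<-+ (c + n₁) n₂ w) (trans (cong (_+ q′) Qb≡) (+-assoc Qc q q′)))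
      Z≡ : Z ≡ P c + (p + p′)
      Z≡ = trans (cong P (sym e)) (trans (∑<-+ (c + n₁) n₂ u) (trans (cong (_+ p′) Pb≡) (+-assoc (P c) p p′)))
      poly : ∀ Pc p p′ Qc q q′ →
        Pc * (Qc + (q + q′)) * q′ + (Qc + q) * (Pc + (p + p′)) * (q + q′) + (Qc + (q + q′)) * (p * q′) ≡
        (Pc + p) * (Qc + (q + q′)) * (q + q′) + Qc * (Pc + (p + p′)) * q′ + (Qc + (q + q′)) * (q * p′)
      poly = solve-∀
      identity : P c * X * q′ + Qb * Z * (q + q′) + X * (p * q′) ≡ Pb * X * (q + q′) + Qc * Z * q′ + X * (q * p′)
      identity rewrite Qb≡ | Pb≡ | X≡ | Z≡ = poly (P c) p p′ Qc q q′
      r₁ : ∀ f q r z y → f * q + (r * z * q + y) ≡ (f + r * z) * q + y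
      r₁ = solve-∀
      r₂ : ∀ f b z s y → (f + b * z) * s + y ≡ f * s + (y + b * z * s)
      r₂ = solve-∀

    ∑<suc≡tri : ∀ n → ∑< n suc ≡ tri (suc n)
    ∑<suc≡tri zero = refl
    ∑<suc≡tri (suc n) = cong (suc n +_) (∑<suc≡tri n)

    -- f is at least a constant times f (suc a) on a positive proportion of [t], while its sum is Q t * P t / (m + 1).
    f-bound : ∀ a C → a < t →
      (∀ i → i < t → u i ≤ C * u a) → (∀ i → i < t → w i ≤ C * u a) →
      (∀ i → i < t → u a ≤ C * u i) → (∀ i → i < t → u a ≤ C * w i) →
      suc m * f (suc a) ≤ 8 * C ^ 3 * (Q t * u a)
    f-bound a C a<t u≤ w≤ ≤u ≤w with u a ≟ 0
    ... | yes ua≡0 = ≤-trans (*-monoʳ-≤ (suc m) (f-suc≤ a<t))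
          (≤-trans (≤-reflexive (trans (cong (λ x → suc m * (Q t * x)) ua≡0)
             (trans (cong (suc m *_) (*-zeroʳ (Q t))) (*-zeroʳ m)))) z≤n)
    ... | no ua≢0 = *-cancelˡ-≤ t ⦃ >-nonZero 0<t ⦄ (begin
      t * (suc m * fc)                          ≡⟨ r₁ t (suc m) fc ⟩
      suc m * (t * fc)                          ≤⟨ *-monoʳ-≤ (suc m) (*-cancelˡ-≤ t ⦃ >-nonZero 0<t ⦄ half) ⟩
      suc m * (8 * (C * C) * S)                 ≡⟨ r₂ (suc m) (C * C) S ⟩
      8 * (C * C) * (suc m * S)                 ≡⟨ cong (8 * (C * C) *_) ∑f ⟩
      8 * (C * C) * (Q t * P t)                 ≤⟨ *-monoʳ-≤ (8 * (C * C)) (*-monoʳ-≤ (Q t) Z≤) ⟩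
      8 * (C * C) * (Q t * (t * (C * x)))       ≡⟨ r₃ t C (Q t) x ⟩
      t * (8 * C ^ 3 * (Q t * x))               ∎)
      where
      open ≤-Reasoning
      x fc S : ℕ
      x = u a
      fc = f (suc a)
      S = ∑< t (f ∘ suc)
      0<t : 0 < t
      0<t = ≤-trans (s≤s z≤n) a<t
      r₁ : ∀ t m f → t * (m * f) ≡ m * (t * f)
      r₁ = solve-∀
      r₂ : ∀ m c s → m * (8 * c * s) ≡ 8 * c * (m * s)
      r₂ = solve-∀
      r₃ : ∀ t C q x → 8 * (C * C) * (q * (t * (C * x))) ≡ t * (8 * (C * (C * (C * 1))) * (q * x))
      r₃ = solve-∀
      Z≤ : P t ≤ t * (C * x)
      Z≤ = ≤-trans (∑<-mono t u≤) (≤-reflexive (∑<-const t (C * x)))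
      X≤ : Q t ≤ t * (C * x)
      X≤ = ≤-trans (∑<-mono t w≤) (≤-reflexive (∑<-const t (C * x)))
      -- The mass `s` of `n` cells is at least `n * x / C`, so the flow `fb` at the other cut is at
      -- least `fc * n / (t * C * C)`.
      transfer : ∀ n s y fb → n * x ≤ C * s → fc * s ≤ fb * y → y ≤ t * (C * x) → fc * n ≤ fb * (t * (C * C))
      transfer n s y fb n≤ fs≤ y≤ = *-cancelʳ-≤ (fc * n) (fb * (t * (C * C))) x ⦃ ≢-nonZero ua≢0 ⦄ (begin
        fc * n * x                     ≡⟨ *-assoc fc n x ⟩
        fc * (n * x)                   ≤⟨ *-monoʳ-≤ fc n≤ ⟩
        fc * (C * s)                   ≡⟨ q₁ fc C s ⟩
        C * (fc * s)                   ≤⟨ *-monoʳ-≤ C fs≤ ⟩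
        C * (fb * y)                   ≤⟨ *-monoʳ-≤ C (*-monoʳ-≤ fb y≤) ⟩
        C * (fb * (t * (C * x)))       ≡⟨ q₂ C fb t x ⟩
        fb * (t * (C * C)) * x         ∎)
        where
        q₁ : ∀ f c s → f * (c * s) ≡ c * (f * s)
        q₁ = solve-∀
        q₂ : ∀ c f t x → c * (f * (t * (c * x))) ≡ f * (t * (c * c)) * x
        q₂ = solve-∀
      square : ∀ n T → t ≤ 2 * n → fc * tri (suc n) ≤ T * (t * (C * C)) → T ≤ S → t * (t * fc) ≤ t * (8 * (C * C) * S)
      square n T t≤ fT T≤S = begin
        t * (t * fc)                  ≤⟨ *-mono-≤ t≤ (*-monoˡ-≤ fc t≤) ⟩
        2 * n * (2 * n * fc)          ≡⟨ q₁ n fc ⟩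
        4 * fc * (n * n)              ≤⟨ *-monoʳ-≤ (4 * fc) (*-monoʳ-≤ n (n≤1+n n)) ⟩
        4 * fc * (n * suc n)          ≡⟨ cong (4 * fc *_) (sym (2*tri n)) ⟩
        4 * fc * (2 * tri (suc n))    ≡⟨ q₂ fc (tri (suc n)) ⟩
        8 * (fc * tri (suc n))        ≤⟨ *-monoʳ-≤ 8 (≤-trans fT (*-monoˡ-≤ (t * (C * C)) T≤S)) ⟩
        8 * (S * (t * (C * C)))       ≡⟨ q₃ S t C ⟩
        t * (8 * (C * C) * S)         ∎
        where
        q₁ : ∀ n f → 2 * n * (2 * n * f) ≡ 4 * f * (n * n)
        q₁ = solve-∀
        q₂ : ∀ f s → 4 * f * (2 * s) ≡ 8 * (f * s)
        q₂ = solve-∀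
        q₃ : ∀ s t c → 8 * (s * (t * (c * c))) ≡ t * (8 * (c * c) * s)
        q₃ = solve-∀
      half : t * (t * fc) ≤ t * (8 * (C * C) * S)
      -- The side of the cut with at least half of all cells is used; the lower bounds from
      -- `transfer` for `n` = 1, 2, ... then add up to order `t * t`, which is where the 8 comes
      -- from.
      half with t ≤? 2 * suc a
      ... | yes t≤2c = square (suc a) (∑< (suc a) (f ∘ suc)) t≤2c (begin
          fc * tri (suc (suc a))                          ≡⟨ cong (fc *_) (sym (∑<suc≡tri (suc a))) ⟩
          fc * ∑< (suc a) suc                             ≡⟨ sym (∑-*ˡ (downFrom (suc a)) fc suc) ⟩
          ∑< (suc a) (λ i → fc * suc i)                   ≤⟨ ∑<-mono (suc a) left ⟩
          ∑< (suc a) (λ i → f (suc i) * (t * (C * C)))    ≡⟨ ∑-*ʳ (downFrom (suc a)) (t * (C * C)) (f ∘ suc) ⟩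
          ∑< (suc a) (f ∘ suc) * (t * (C * C))            ∎)
          (∑<-≤ (f ∘ suc) a<t)
        where
        left : ∀ i → i < suc a → fc * suc i ≤ f (suc i) * (t * (C * C))
        left i i<c = transfer (suc i) (P (suc i)) (P (suc a)) (f (suc i))
          (≤-trans (≤-reflexive (sym (∑<-const (suc i) x)))
            (≤-trans (∑<-mono (suc i) (λ j j≤i → ≤u j (≤-trans j≤i (≤-trans i<c a<t))))
                     (≤-reflexive (∑-*ˡ (downFrom (suc i)) C u))))
          (f-left i<c a<t)
          (≤-trans (∑<-≤ u a<t) Z≤)
      ... | no t≰2c with m≤n⇒∃[o]m+o≡n a<t
      ... | e , c+e≡t = square e (∑< e (λ i → f (suc a + i))) t≤2e (begin
          fc * tri (suc e)                                 ≡⟨ cong (fc *_) (trans (sym (∑<suc≡tri e)) (sym (∑<-reverse e suc))) ⟩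
          fc * ∑< e (λ i → suc (e ∸ suc i))                ≡⟨ sym (∑-*ˡ (downFrom e) fc _) ⟩
          ∑< e (λ i → fc * suc (e ∸ suc i))                ≤⟨ ∑<-mono e right ⟩
          ∑< e (λ i → f (suc a + i) * (t * (C * C)))       ≡⟨ ∑-*ʳ (downFrom e) (t * (C * C)) (λ i → f (suc a + i)) ⟩
          ∑< e (λ i → f (suc a + i)) * (t * (C * C))       ∎)
          (begin
          ∑< e (λ i → f (suc (a + i)))                     ≤⟨ ∑<-≤ (λ i → f (suc (a + i))) (n≤1+n e) ⟩
          ∑< (suc e) (λ i → f (suc (a + i)))               ≤⟨ m≤n+m _ (∑< a (f ∘ suc)) ⟩
          ∑< a (f ∘ suc) + ∑< (suc e) (λ i → f (suc (a + i))) ≡⟨ sym (∑<-+ a (suc e) (f ∘ suc)) ⟩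
          ∑< (a + suc e) (f ∘ suc)                         ≡⟨ cong (λ n → ∑< n (f ∘ suc)) (trans (+-suc a e) c+e≡t) ⟩
          S                                                ∎)
        where
        t≤2e : t ≤ 2 * e
        t≤2e = +-cancelˡ-≤ (suc a) t (2 * e) (begin
          suc a + t                ≤⟨ +-cancelˡ-≤ (suc a) (suc a + t) (suc a + 2 * e) (begin
            suc a + (suc a + t)      ≡⟨ s₁ (suc a) t ⟩
            2 * suc a + t            ≤⟨ +-monoˡ-≤ t (<⇒≤ (≰⇒> t≰2c)) ⟩
            t + t                    ≡⟨ cong₂ _+_ (sym c+e≡t) (sym c+e≡t) ⟩
            (suc a + e) + (suc a + e) ≡⟨ s₂ (suc a) e ⟩
            suc a + (suc a + 2 * e)  ∎) ⟩
          suc a + 2 * e            ∎)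
          where
          s₁ : ∀ c t → c + (c + t) ≡ 2 * c + t
          s₁ = solve-∀
          s₂ : ∀ c e → (c + e) + (c + e) ≡ c + (c + 2 * e)
          s₂ = solve-∀
        right : ∀ i → i < e → fc * suc (e ∸ suc i) ≤ f (suc a + i) * (t * (C * C))
        right i i<e with m≤n⇒∃[o]m+o≡n i<e
        ... | o , refl rewrite m+n∸m≡n i o = transfer (suc o) (∑< (suc o) (λ j → w (suc a + i + j))) (Q t) (f (suc a + i))
          (≤-trans (≤-reflexive (sym (∑<-const (suc o) x)))
            (≤-trans (∑<-mono (suc o) (λ j j≤o → ≤w (suc a + i + j)
                       (≤-trans (s≤s (+-monoʳ-≤ (suc a + i) (≤-pred j≤o))) (≤-reflexive (trans (cong suc (+-assoc (suc a) i o)) (trans (sym (+-suc (suc a) (i + o))) c+e≡t))))))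
                     (≤-reflexive (∑-*ˡ (downFrom (suc o)) C (λ j → w (suc a + i + j))))))
          (f-right (suc a) i (suc o) (trans (+-assoc (suc a) i (suc o)) (trans (cong (suc a +_) (+-suc i o)) c+e≡t)))
          X≤

-- The points of the grid as lists of naturals

-- Without the indices, coordinates can be rotated, cut and joined freely; `Valid` keeps the bounds.
el : ∀ {t n} → Point t n → List ℕ
el [] = []
el (a ∷ p) = toℕ a ∷ el p

module Points (t : ℕ) where

  open Layers t

  lists : ℕ → List (List ℕ)
  lists n = map el (points t n)

  ∑-lists-suc : ∀ n (h : List ℕ → ℕ) → ∑ (lists (suc n)) h ≡ ∑< t (λ a → ∑ (lists n) (λ x → h (a ∷ x)))
  ∑-lists-suc n h = begin
    ∑ (lists (suc n)) h
      ≡⟨ ∑-map el (points t (suc n)) h ⟩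
    ∑ (points t (suc n)) (h ∘ el)
      ≡⟨ ∑-concatMap (λ i → map (i ∷_) (points t n)) (allFin t) (h ∘ el) ⟩
    ∑ (allFin t) (λ i → ∑ (map (i ∷_) (points t n)) (h ∘ el))
      ≡⟨ ∑-cong (allFin t) (λ i → trans (∑-map (i ∷_) (points t n) (h ∘ el)) (sym (∑-map el (points t n) (λ x → h (toℕ i ∷ x))))) ⟩
    ∑ (allFin t) (λ i → ∑ (lists n) (λ x → h (toℕ i ∷ x)))
      ≡⟨ ∑-allFin t (λ a → ∑ (lists n) (λ x → h (a ∷ x))) ⟩
    ∑< t (λ a → ∑ (lists n) (λ x → h (a ∷ x))) ∎
    where open ≡-Reasoning

  Valid : ℕ → List ℕ → Set
  Valid n x = length x ≡ n × All (_< t) x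

  el-valid : ∀ {n} (p : Point t n) → Valid n (el p)
  el-valid [] = refl , []
  el-valid (a ∷ p) = cong suc (proj₁ (el-valid p)) , Fin.toℕ<n a ∷ proj₂ (el-valid p)

  ∈lists⇒valid : ∀ {n x} → x ∈ lists n → Valid n x
  ∈lists⇒valid x∈ with ∈-map⁻ el x∈
  ... | p , _ , refl = el-valid p

  ∑-lists-const : ∀ n c → ∑ (lists n) (λ _ → c) ≡ t ^ n * c
  ∑-lists-const zero c = refl
  ∑-lists-const (suc n) c = trans (∑-lists-suc n (λ _ → c))
    (trans (∑-cong (downFrom t) (λ _ → ∑-lists-const n c))
    (trans (∑<-const t (t ^ n * c)) (sym (*-assoc t (t ^ n) c))))

  length-lists : ∀ n → length (lists n) ≡ t ^ n
  length-lists n = trans (length-∑ (lists n)) (trans (∑-lists-const n 1) (*-identityʳ _))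

  ∑-rank-+ : ∀ m a k → ∑ (lists m) (λ x → ⟦ a + sum x ≡ᵇ k ⟧) ≡ sh a (N m) k
  ∑-rank : ∀ m k → ∑ (lists m) (λ x → ⟦ sum x ≡ᵇ k ⟧) ≡ N m k

  ∑-rank-+ m a k = begin
    ∑ (lists m) (λ x → ⟦ a + sum x ≡ᵇ k ⟧)             ≡⟨ ∑-cong (lists m) (λ x → delayed a (sum x) k) ⟩
    ∑ (lists m) (λ x → sh a (λ j → ⟦ sum x ≡ᵇ j ⟧) k)  ≡⟨ sym (sh-∑ a (lists m) (λ x j → ⟦ sum x ≡ᵇ j ⟧) k) ⟩
    sh a (λ j → ∑ (lists m) (λ x → ⟦ sum x ≡ᵇ j ⟧)) k  ≡⟨ sh-cong a (∑-rank m) k ⟩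
    sh a (N m) k                                       ∎
    where
    open ≡-Reasoning
    delayed : ∀ a s k → ⟦ a + s ≡ᵇ k ⟧ ≡ sh a (λ j → ⟦ s ≡ᵇ j ⟧) k
    delayed zero s k = refl
    delayed (suc a) s zero = refl
    delayed (suc a) s (suc k) = delayed a s k

  ∑-rank zero zero = refl
  ∑-rank zero (suc k) = refl
  ∑-rank (suc m) k = trans (∑-lists-suc m _) (∑-cong (downFrom t) (λ a → ∑-rank-+ m a k))

  N-positive : ∀ {m x} → x ∈ lists m → 0 < N m (sum x)
  N-positive {m} {x} x∈ = subst₂ _≤_ (⟦≡ᵇ⟧-refl (sum x)) (∑-rank m (sum x)) (term≤∑ (λ y → ⟦ sum y ≡ᵇ sum x ⟧) x∈)
    where
    ⟦≡ᵇ⟧-refl : ∀ k → ⟦ k ≡ᵇ k ⟧ ≡ 1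
    ⟦≡ᵇ⟧-refl zero = refl
    ⟦≡ᵇ⟧-refl (suc k) = ⟦≡ᵇ⟧-refl k

  ∑-lists-reflect : ∀ m (h : List ℕ → ℕ) → ∑ (lists m) (λ x → h (map (λ a → t ∸ suc a) x)) ≡ ∑ (lists m) h
  ∑-lists-reflect zero h = refl
  ∑-lists-reflect (suc m) h = begin
    ∑ (lists (suc m)) (λ x → h (map (λ a → t ∸ suc a) x))
      ≡⟨ ∑-lists-suc m _ ⟩
    ∑< t (λ a → ∑ (lists m) (λ x → h (t ∸ suc a ∷ map (λ a → t ∸ suc a) x)))
      ≡⟨ ∑-cong (downFrom t) (λ a → ∑-lists-reflect m (λ x → h (t ∸ suc a ∷ x))) ⟩
    ∑< t (λ a → ∑ (lists m) (λ x → h (t ∸ suc a ∷ x)))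
      ≡⟨ ∑<-reverse t (λ a → ∑ (lists m) (λ x → h (a ∷ x))) ⟩
    ∑< t (λ a → ∑ (lists m) (λ x → h (a ∷ x)))
      ≡⟨ sym (∑-lists-suc m h) ⟩
    ∑ (lists (suc m)) h ∎
    where open ≡-Reasoning

  sum-reflect : ∀ {x} → All (_< t) x → sum x + sum (map (λ a → t ∸ suc a) x) ≡ length x * pred t
  sum-reflect [] = refl
  sum-reflect {a ∷ x} (a<t ∷ x<t) = begin
    a + sum x + (t ∸ suc a + sum (map (λ a → t ∸ suc a) x))     ≡⟨ r a (sum x) (t ∸ suc a) _ ⟩
    (a + (t ∸ suc a)) + (sum x + sum (map (λ a → t ∸ suc a) x)) ≡⟨ cong₂ _+_ (cong (a +_) (∸-suc a)) (sum-reflect x<t) ⟩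
    (a + (pred t ∸ a)) + length x * pred t                      ≡⟨ cong (_+ length x * pred t) (m+[n∸m]≡n (pred-mono-≤ a<t)) ⟩
    pred t + length x * pred t                                  ∎
    where
    open ≡-Reasoning
    r : ∀ a b c d → a + b + (c + d) ≡ (a + c) + (b + d)
    r = solve-∀
    ∸-suc : ∀ a → t ∸ suc a ≡ pred t ∸ a
    ∸-suc a = trans (sym (∸-+-assoc t 1 a)) (cong (_∸ a) (sym (pred[n]≡n∸1 t)))
      where
      pred[n]≡n∸1 : ∀ n → pred n ≡ n ∸ 1
      pred[n]≡n∸1 zero = refl
      pred[n]≡n∸1 (suc n) = refl

  N-sym : ∀ m {i j} → i + j ≡ m * pred t → N m i ≡ N m j
  N-sym m {i} {j} i+j = begin
    N m i                                                             ≡⟨ sym (∑-rank m i) ⟩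
    ∑ (lists m) (λ x → ⟦ sum x ≡ᵇ i ⟧)                                ≡⟨ sym (∑-lists-reflect m (λ x → ⟦ sum x ≡ᵇ i ⟧)) ⟩
    ∑ (lists m) (λ x → ⟦ sum (map (λ a → t ∸ suc a) x) ≡ᵇ i ⟧)        ≡⟨ ∑-cong-∈ (lists m) (λ x x∈ → same x (∈lists⇒valid x∈)) ⟩
    ∑ (lists m) (λ x → ⟦ sum x ≡ᵇ j ⟧)                                ≡⟨ ∑-rank m j ⟩
    N m j                                                             ∎
    where
    open ≡-Reasoning
    same : ∀ x → Valid m x → ⟦ sum (map (λ a → t ∸ suc a) x) ≡ᵇ i ⟧ ≡ ⟦ sum x ≡ᵇ j ⟧
    same x (l , x<t) with sum (map (λ a → t ∸ suc a) x) ≟ i | sum x ≟ j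
    ... | yes p | yes q rewrite dec-true (sum (map (λ a → t ∸ suc a) x) ≟ i) p | dec-true (sum x ≟ j) q = refl
    ... | no p | no q rewrite dec-false (sum (map (λ a → t ∸ suc a) x) ≟ i) p | dec-false (sum x ≟ j) q = refl
    ... | yes p | no q = ⊥-elim (q (+-cancelʳ-≡ i (sum x) j
            (trans (cong (sum x +_) (sym p)) (trans (sum-reflect x<t) (trans (cong (_* pred t) l) (trans (sym i+j) (+-comm i j)))))))
    ... | no p | yes q = ⊥-elim (p (+-cancelˡ-≡ j _ i
            (trans (cong (_+ sum (map (λ a → t ∸ suc a) x)) (sym q)) (trans (sum-reflect x<t) (trans (cong (_* pred t) l) (trans (sym i+j) (+-comm i j)))))))

  -- Layer sizes vary slowly away from both ends

  ∑-half : ∀ (g : ℕ → ℕ) → ∑< t (g ∘ ⌊_/2⌋) ≤ 2 * ∑< t g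
  ∑-half g = ≤-trans (∑<-≤ (g ∘ ⌊_/2⌋) (m≤m+n t t)) (≤-reflexive (doubled t))
    where
    double : ∀ a b → a + (a + b) ≡ 2 * a + b
    double = solve-∀
    doubled : ∀ n → ∑< (n + n) (g ∘ ⌊_/2⌋) ≡ 2 * ∑< n g
    doubled zero = refl
    doubled (suc n) = begin
      ∑< (suc n + suc n) (g ∘ ⌊_/2⌋)                                        ≡⟨ cong (λ k → ∑< (suc k) (g ∘ ⌊_/2⌋)) (+-suc n n) ⟩
      g ⌊ suc (n + n) /2⌋ + (g ⌊ n + n /2⌋ + ∑< (n + n) (g ∘ ⌊_/2⌋))        ≡⟨ cong₂ (λ x y → g x + (g y + ∑< (n + n) (g ∘ ⌊_/2⌋))) (sym (n≡⌈n+n/2⌉ n)) (sym (n≡⌊n+n/2⌋ n)) ⟩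
      g n + (g n + ∑< (n + n) (g ∘ ⌊_/2⌋))                                  ≡⟨ double (g n) _ ⟩
      2 * g n + ∑< (n + n) (g ∘ ⌊_/2⌋)                                      ≡⟨ cong (2 * g n +_) (doubled n) ⟩
      2 * g n + 2 * ∑< n g                                                  ≡⟨ sym (*-distribˡ-+ 2 (g n) _) ⟩
      2 * (g n + ∑< n g)                                                    ∎
      where open ≡-Reasoning

  ∑-lists-half : ∀ m (h : List ℕ → ℕ) → ∑ (lists m) (λ x → h (map ⌊_/2⌋ x)) ≤ 2 ^ m * ∑ (lists m) h
  ∑-lists-half zero h = ≤-reflexive (sym (+-identityʳ _))
  ∑-lists-half (suc m) h = begin
    ∑ (lists (suc m)) (λ x → h (map ⌊_/2⌋ x))                        ≡⟨ ∑-lists-suc m _ ⟩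
    ∑< t (λ a → ∑ (lists m) (λ x → h (⌊ a /2⌋ ∷ map ⌊_/2⌋ x)))       ≤⟨ ∑-mono (downFrom t) (λ a → ∑-lists-half m (λ x → h (⌊ a /2⌋ ∷ x))) ⟩
    ∑< t (λ a → 2 ^ m * ∑ (lists m) (λ x → h (⌊ a /2⌋ ∷ x)))         ≡⟨ ∑-*ˡ (downFrom t) (2 ^ m) _ ⟩
    2 ^ m * ∑< t (λ a → ∑ (lists m) (λ x → h (⌊ a /2⌋ ∷ x)))         ≤⟨ *-monoʳ-≤ (2 ^ m) (∑-half (λ a → ∑ (lists m) (λ x → h (a ∷ x)))) ⟩
    2 ^ m * (2 * ∑< t (λ a → ∑ (lists m) (λ x → h (a ∷ x))))         ≡⟨ r (2 ^ m) _ ⟩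
    2 * 2 ^ m * ∑< t (λ a → ∑ (lists m) (λ x → h (a ∷ x)))           ≡⟨ cong (2 * 2 ^ m *_) (sym (∑-lists-suc m h)) ⟩
    2 * 2 ^ m * ∑ (lists (suc m)) h                                  ∎
    where
    open ≤-Reasoning
    r : ∀ a b → a * (2 * b) ≡ 2 * a * b
    r = solve-∀

  ball : ℕ → ℕ → ℕ
  ball m j = ∑< (suc j) (N m)

  ∑-≡ᵇ : ∀ s J → ∑< J (λ i → ⟦ s ≡ᵇ i ⟧) ≡ ⟦ does (s <? J) ⟧
  ∑-≡ᵇ s zero rewrite dec-false (s <? 0) (λ ()) = refl
  ∑-≡ᵇ s (suc J) rewrite ∑-≡ᵇ s J with s ≟ J
  ... | yes refl rewrite dec-true (s ≟ s) refl | dec-false (s <? s) (<-irrefl refl) | dec-true (s <? suc s) ≤-refl = refl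
  ... | no s≢J rewrite dec-false (s ≟ J) s≢J with s <? J
  ... | yes s<J rewrite dec-true (s <? suc J) (m<n⇒m<1+n s<J) | dec-true (s <? J) s<J = refl
  ... | no s≮J rewrite dec-false (s <? suc J) (λ s≤J → s≮J (≤∧≢⇒< (≤-pred s≤J) s≢J)) | dec-false (s <? J) s≮J = refl

  ball≡ : ∀ m j → ball m j ≡ ∑ (lists m) (λ x → ⟦ does (sum x <? suc j) ⟧)
  ball≡ m j = trans (∑-cong (downFrom (suc j)) (λ i → sym (∑-rank m i)))
    (trans (∑-swap (downFrom (suc j)) (lists m) _) (∑-cong (lists m) (λ x → ∑-≡ᵇ (sum x) (suc j))))

  -- Rounding every coordinate down to its half at least halves the rank and is at most `2 ^ m` to
  -- one.
  ball-half : ∀ m j → ball m j ≤ 2 ^ m * ball m ⌊ j /2⌋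
  ball-half m j = begin
    ball m j                                                               ≡⟨ ball≡ m j ⟩
    ∑ (lists m) (λ x → ⟦ does (sum x <? suc j) ⟧)                          ≤⟨ ∑-mono (lists m) (λ x → monotone (sum x) (sum (map ⌊_/2⌋ x)) (sum-half x)) ⟩
    ∑ (lists m) (λ x → ⟦ does (sum (map ⌊_/2⌋ x) <? suc ⌊ j /2⌋) ⟧)        ≤⟨ ∑-lists-half m _ ⟩
    2 ^ m * ∑ (lists m) (λ x → ⟦ does (sum x <? suc ⌊ j /2⌋) ⟧)            ≡⟨ cong (2 ^ m *_) (sym (ball≡ m ⌊ j /2⌋)) ⟩
    2 ^ m * ball m ⌊ j /2⌋                                                 ∎
    where
    open ≤-Reasoning
    ⌊/2⌋+⌊/2⌋≤ : ∀ a → ⌊ a /2⌋ + ⌊ a /2⌋ ≤ a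
    ⌊/2⌋+⌊/2⌋≤ a = ≤-trans (+-monoʳ-≤ ⌊ a /2⌋ (⌊n/2⌋≤⌈n/2⌉ a)) (≤-reflexive (⌊n/2⌋+⌈n/2⌉≡n a))
    four : ∀ a b → a + b + (a + b) ≡ (a + a) + (b + b)
    four = solve-∀
    sum-half : ∀ x → sum (map ⌊_/2⌋ x) + sum (map ⌊_/2⌋ x) ≤ sum x
    sum-half [] = z≤n
    sum-half (a ∷ x) = ≤-trans (≤-reflexive (four ⌊ a /2⌋ (sum (map ⌊_/2⌋ x)))) (+-mono-≤ (⌊/2⌋+⌊/2⌋≤ a) (sum-half x))
    monotone : ∀ s s′ → s′ + s′ ≤ s → ⟦ does (s <? suc j) ⟧ ≤ ⟦ does (s′ <? suc ⌊ j /2⌋) ⟧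
    monotone s s′ le with s <? suc j
    ... | no ¬p rewrite dec-false (s <? suc j) ¬p = z≤n
    ... | yes p rewrite dec-true (s′ <? suc ⌊ j /2⌋) (s≤s (≤-trans (≤-reflexive (n≡⌊n+n/2⌋ s′)) (⌊n/2⌋-mono (≤-trans le (≤-pred p))))) =
      ⟦⟧≤1 (does (s <? suc j))

  N-zero : 0 < t → ∀ m → N m 0 ≡ 1
  N-zero 0<t zero = refl
  N-zero 0<t (suc m) = go t 0<t
    where
    go : ∀ s → 0 < s → ∑< s (λ a → sh a (N m) 0) ≡ 1
    go (suc zero) _ = trans (+-identityʳ _) (N-zero 0<t m)
    go (suc (suc s)) _ = go (suc s) (s≤s z≤n)

  -- If N (j + u) were larger than 2 ^ g * N j then, by log-concavity, balls of radius at most j would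
  -- grow by a factor 2 ^ g whenever the radius grows by u; but doubling the radius costs at most 2 ^ m.
  flat-up : 0 < t → ∀ m g l j u → 2 * (l * u) ≤ j + u → m < g * l → N m (j + u) ≤ 2 ^ g * N m j
  flat-up 0<t m g l j u far m<gl with N m (j + u) ≤? 2 ^ g * N m j
  ... | yes p = p
  ... | no ¬p = ⊥-elim (<-irrefl refl (<-≤-trans (^-monoʳ-< 2 (s≤s (s≤s z≤n)) m<gl) (*-cancelʳ-≤ _ _ (ball m h) ⦃ >-nonZero 0<ball ⦄ (begin
      2 ^ (g * l) * ball m h     ≤⟨ iterate l (≤-trans (+-monoʳ-≤ h lu≤) (≤-reflexive (⌊n/2⌋+⌈n/2⌉≡n (j + u)))) ⟩
      ball m (h + l * u)         ≤⟨ ∑<-≤ (N m) (s≤s (≤-trans (+-monoʳ-≤ h lu≤) (≤-reflexive (⌊n/2⌋+⌈n/2⌉≡n (j + u))))) ⟩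
      ball m (j + u)             ≤⟨ ball-half m (j + u) ⟩
      2 ^ m * ball m h           ∎))))
    where
    open ≤-Reasoning
    h : ℕ
    h = ⌊ j + u /2⌋
    -- If `N m j` vanished, log-concavity together with `N m 0 = 1` would make `N m (j + u)` vanish
    -- too.
    Nj>0 : 0 < N m j
    Nj>0 with N m j in e
    ... | suc _ = s≤s z≤n
    ... | zero = ⊥-elim (¬p (≤-trans (≤-trans (≤-reflexive (sym (trans (cong (_* N m (j + u)) (N-zero 0<t m)) (+-identityʳ _))))
            (≤-trans (lc-spread {N m} (N-lc m) u {0} {j} z≤n) (≤-reflexive (trans (cong (N m u *_) e) (*-zeroʳ (N m u)))))) z≤n))
    grow : ∀ i → i ≤ j → 2 ^ g * N m i ≤ N m (i + u)
    grow i i≤j = *-cancelʳ-≤ _ _ (N m j) ⦃ >-nonZero Nj>0 ⦄ (begin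
      2 ^ g * N m i * N m j        ≡⟨ r (2 ^ g) (N m i) (N m j) ⟩
      N m i * (2 ^ g * N m j)      ≤⟨ *-monoʳ-≤ (N m i) (<⇒≤ (≰⇒> ¬p)) ⟩
      N m i * N m (j + u)          ≤⟨ lc-spread {N m} (N-lc m) u i≤j ⟩
      N m (i + u) * N m j          ∎)
      where
      r : ∀ a b c → a * b * c ≡ b * (a * c)
      r = solve-∀
    ball-grow : ∀ i → i ≤ j → 2 ^ g * ball m i ≤ ball m (i + u)
    ball-grow i i≤j = begin
      2 ^ g * ball m i                                       ≡⟨ sym (∑-*ˡ (downFrom (suc i)) (2 ^ g) (N m)) ⟩
      ∑< (suc i) (λ a → 2 ^ g * N m a)                       ≤⟨ ∑<-mono (suc i) (λ a a≤i → grow a (≤-trans (≤-pred a≤i) i≤j)) ⟩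
      ∑< (suc i) (λ a → N m (a + u))                         ≡⟨ ∑-cong (downFrom (suc i)) (λ a → cong (N m) (+-comm a u)) ⟩
      ∑< (suc i) (λ a → N m (u + a))                         ≤⟨ m≤n+m _ (∑< u (N m)) ⟩
      ∑< u (N m) + ∑< (suc i) (λ a → N m (u + a))            ≡⟨ sym (∑<-+ u (suc i) (N m)) ⟩
      ∑< (u + suc i) (N m)                                   ≡⟨ cong (λ a → ∑< a (N m)) (+-comm u (suc i)) ⟩
      ball m (i + u)                                         ∎
    iterate : ∀ l → h + l * u ≤ j + u → 2 ^ (g * l) * ball m h ≤ ball m (h + l * u)
    iterate zero _ = ≤-reflexive (trans (cong (λ a → 2 ^ a * ball m h) (*-zeroʳ g)) (trans (+-identityʳ _) (cong (ball m) (sym (+-identityʳ h)))))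
    iterate (suc l) le = begin
      2 ^ (g * suc l) * ball m h                 ≡⟨ cong (λ a → 2 ^ a * ball m h) (*-suc g l) ⟩
      2 ^ (g + g * l) * ball m h                 ≡⟨ cong (_* ball m h) (^-distribˡ-+-* 2 g (g * l)) ⟩
      2 ^ g * 2 ^ (g * l) * ball m h             ≡⟨ *-assoc (2 ^ g) _ _ ⟩
      2 ^ g * (2 ^ (g * l) * ball m h)           ≤⟨ *-monoʳ-≤ (2 ^ g) (iterate l (≤-trans hl≤j (m≤m+n j u))) ⟩
      2 ^ g * ball m (h + l * u)                 ≤⟨ ball-grow (h + l * u) hl≤j ⟩
      ball m (h + l * u + u)                     ≡⟨ cong (ball m) (r h (l * u) u) ⟩
      ball m (h + suc l * u)                     ∎
      where
      r : ∀ a b c → a + b + c ≡ a + (c + b)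
      r = solve-∀
      hl≤j : h + l * u ≤ j
      hl≤j = +-cancelʳ-≤ u _ _ (≤-trans (≤-reflexive (r h (l * u) u)) le)
    lu≤ : l * u ≤ ⌈ j + u /2⌉
    lu≤ = ≤-trans (≤-reflexive (n≡⌈n+n/2⌉ (l * u))) (⌈n/2⌉-mono (≤-trans (≤-reflexive (cong (l * u +_) (sym (+-identityʳ (l * u))))) far))
    0<ball : 0 < ball m h
    0<ball = ≤-trans (≤-reflexive (sym (N-zero 0<t m))) (term≤∑ (N m) (∈-downFrom⁺ {suc h} {0} (s≤s z≤n)))

  -- For `j ≤ i` this is `flat-up`; for `i ≤ j` it is `flat-up` for the reflected ranks. Therefore
  -- distance from both ends is required.
  flat : 0 < t → ∀ m g l {i j} → m < g * l → i ≤ j + t → j ≤ i + t → 2 * (l * t) ≤ i → 2 * (l * t) ≤ j →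
    i + 2 * (l * t) ≤ m * pred t → j + 2 * (l * t) ≤ m * pred t → N m i ≤ 2 ^ g * N m j
  flat 0<t m g l {i} {j} m<gl i≤ j≤ lo-i lo-j hi-i hi-j with ≤-total j i
  ... | inj₁ j≤i with m≤n⇒∃[o]m+o≡n j≤i
  ... | u , refl = flat-up 0<t m g l j u
        (≤-trans (*-monoʳ-≤ 2 (*-monoʳ-≤ l (+-cancelˡ-≤ j u t i≤))) (≤-trans lo-j (m≤m+n j u))) m<gl
  flat 0<t m g l {i} {j} m<gl i≤ j≤ lo-i lo-j hi-i hi-j | inj₂ i≤j with m≤n⇒∃[o]m+o≡n i≤j | m≤n⇒∃[o]m+o≡n (≤-trans (m≤m+n j (2 * (l * t))) hi-j)
  ... | u , refl | o , e = begin
        N m i                   ≡⟨ N-sym m (trans (sym (r i u o)) e) ⟩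
        N m (o + u)             ≤⟨ flat-up 0<t m g l o u (≤-trans (≤-trans (*-monoʳ-≤ 2 (*-monoʳ-≤ l (+-cancelˡ-≤ i u t j≤)))
                                     (+-cancelˡ-≤ (i + u) _ _ (≤-trans hi-j (≤-reflexive (sym e))))) (m≤m+n o u)) m<gl ⟩
        2 ^ g * N m o           ≡⟨ cong (2 ^ g *_) (N-sym m (trans (+-comm o (i + u)) e)) ⟩
        2 ^ g * N m (i + u)     ∎
    where
    open ≤-Reasoning
    r : ∀ i u o → i + u + o ≡ i + (o + u)
    r = solve-∀

  sh-∸ : ∀ a h {k} → a ≤ k → sh a h k ≡ h (k ∸ a)
  sh-∸ zero h a≤k = refl
  sh-∸ (suc a) h (s≤s a≤k) = sh-∸ a h a≤k

  -- The slices `u` and `w` are layers of `[t]^m` whose ranks lie at most `t` below `k + 1`. In the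
  -- central region `flat` makes any two of them equal up to the factor `2 ^ g`, as `f-bound`
  -- demands.
  central-bound : ∀ m k l g a → a < t → m < g * l → 2 * (l * t) + t ≤ suc k → suc k + 2 * (l * t) ≤ m * pred t →
    suc m * f m k (suc a) ≤ 8 * (2 ^ g) ^ 3 * (Q m k t * u m k a)
  central-bound m k l g a a<t m<gl lo hi = f-bound m k a (2 ^ g) a<t
    (λ i i<t → comparable (u-in i<t) (u-in a<t))
    (λ i i<t → comparable (w-in i<t) (u-in a<t))
    (λ i i<t → comparable (u-in a<t) (u-in i<t))
    (λ i i<t → comparable (u-in a<t) (w-in i<t))
    where
    L : ℕ
    L = 2 * (l * t)
    InWindow : ℕ → Set
    InWindow x = Σ ℕ (λ i → N m i ≡ x × i ≤ suc k × suc k ≤ i + t)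
    comparable : ∀ {x y} → InWindow x → InWindow y → x ≤ 2 ^ g * y
    comparable (i , refl , i≤ , ≤i) (j , refl , j≤ , ≤j) = flat (≤-trans (s≤s z≤n) a<t) m g l m<gl
      (≤-trans i≤ ≤j) (≤-trans j≤ ≤i) (+-cancelʳ-≤ t _ _ (≤-trans lo ≤i)) (+-cancelʳ-≤ t _ _ (≤-trans lo ≤j))
      (≤-trans (+-monoˡ-≤ L i≤) hi) (≤-trans (+-monoˡ-≤ L j≤) hi)
    t≤sk : t ≤ suc k
    t≤sk = ≤-trans (m≤n+m t L) lo
    w-in : ∀ {i} → i < t → InWindow (w m k i)
    w-in {i} i<t = suc k ∸ i , sym (sh-∸ i (N m) (≤-trans (<⇒≤ i<t) t≤sk)) , m∸n≤m (suc k) i ,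
      ≤-trans (m≤n+m∸n (suc k) i) (≤-trans (≤-reflexive (+-comm i _)) (+-monoʳ-≤ (suc k ∸ i) (<⇒≤ i<t)))
    u-in : ∀ {i} → i < t → InWindow (u m k i)
    u-in {i} i<t = k ∸ i , sym (sh-∸ i (N m) (≤-pred (≤-trans i<t t≤sk))) , ≤-trans (m∸n≤m k i) (n≤1+n k) ,
      ≤-trans (s≤s (m≤n+m∸n k i)) (≤-trans (≤-reflexive (+-comm (suc i) _)) (+-monoʳ-≤ (k ∸ i) i<t))

-- A random step upwards that maps layers uniformly onto layers

_≟L_ : (x y : List ℕ) → Dec (x ≡ y)
_≟L_ = ≡-dec _≟_

≡ᵇ-refl : ∀ k → (k ≡ᵇ k) ≡ true
≡ᵇ-refl k = dec-true (k ≟ k) refl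

≡ᵇ-≢ : ∀ {i k} → i ≢ k → (i ≡ᵇ k) ≡ false
≡ᵇ-≢ {i} {k} = dec-false (i ≟ k)

⟦∧⟧ : ∀ p q → ⟦ p ∧ q ⟧ ≡ ⟦ p ⟧ * ⟦ q ⟧
⟦∧⟧ true q = sym (+-identityʳ ⟦ q ⟧)
⟦∧⟧ false q = refl

∑<-pick : ∀ n b (h : ℕ → ℕ) → b < n → ∑< n (λ a → ⟦ a ≡ᵇ b ⟧ * h a) ≡ h b
∑<-pick (suc n) b h b<sn with n ≟ b
... | yes refl = trans (cong₂ _+_ (trans (cong (λ c → ⟦ c ⟧ * h n) (≡ᵇ-refl n)) (+-identityʳ (h n)))
    (trans (∑<-cong n (λ a a<n → cong (λ c → ⟦ c ⟧ * h a) (≡ᵇ-≢ (<⇒≢ a<n)))) (∑-zero (downFrom n)))) (+-identityʳ (h n))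
... | no n≢b = trans (cong (λ c → ⟦ c ⟧ * h n + ∑< n (λ a → ⟦ a ≡ᵇ b ⟧ * h a)) (≡ᵇ-≢ n≢b))
    (∑<-pick n b h (≤∧≢⇒< (≤-pred b<sn) (n≢b ∘ sym)))

∑<-pick-≤ : ∀ n b c → ∑< n (λ a → ⟦ a ≡ᵇ b ⟧ * c) ≤ c
∑<-pick-≤ n b c with b <? n
... | yes b<n = ≤-reflexive (∑<-pick n b (λ _ → c) b<n)
... | no b≮n = ≤-trans (≤-reflexive (trans (∑<-cong n (λ a a<n →
    cong (λ e → ⟦ e ⟧ * c) (≡ᵇ-≢ (λ a≡b → b≮n (subst (_< n) a≡b a<n))))) (∑-zero (downFrom n)))) z≤n

≡ᵇ-sym : ∀ i j → (i ≡ᵇ j) ≡ (j ≡ᵇ i)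
≡ᵇ-sym zero zero = refl
≡ᵇ-sym zero (suc j) = refl
≡ᵇ-sym (suc i) zero = refl
≡ᵇ-sym (suc i) (suc j) = ≡ᵇ-sym i j

-- The covering relation of the grid; the number of `hold` constructors locates the coordinate that
-- gains one.
data Edge : List ℕ → List ℕ → Set where
  move : ∀ a x → Edge (a ∷ x) (suc a ∷ x)
  hold : ∀ a {x y} → Edge x y → Edge (a ∷ x) (a ∷ y)

Edge-sum : ∀ {x y} → Edge x y → sum y ≡ suc (sum x)
Edge-sum (move a x) = refl
Edge-sum (hold a e) = trans (cong (a +_) (Edge-sum e)) (+-suc a _)

Edge-≤ : ∀ {x y} → Edge x y → Pointwise _≤_ x y
Edge-≤ (move a x) = n≤1+n a ∷ Pointwise.refl ≤-refl
Edge-≤ (hold a e) = ≤-refl ∷ Edge-≤ e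

module Kernel (t n : ℕ) (0<t : 0 < t) where

  open Layers t
  open Points t

  ∑-lists-pick : ∀ m {y} → Valid m y → (h : List ℕ → ℕ) → ∑ (lists m) (λ z → h z * ⟦ does (z ≟L y) ⟧) ≡ h y
  ∑-lists-pick zero {[]} _ h = trans (+-identityʳ _) (*-identityʳ (h []))
  ∑-lists-pick (suc m) {b ∷ y} (l , b<t ∷ y<t) h = begin
    ∑ (lists (suc m)) (λ z → h z * ⟦ does (z ≟L (b ∷ y)) ⟧)
      ≡⟨ ∑-lists-suc m _ ⟩
    ∑< t (λ a → ∑ (lists m) (λ z → h (a ∷ z) * ⟦ (a ≡ᵇ b) ∧ does (z ≟L y) ⟧))
      ≡⟨ ∑-cong (downFrom t) (λ a → trans (∑-cong (lists m) (λ z → regroup (h (a ∷ z)) (a ≡ᵇ b) (does (z ≟L y))))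
           (∑-*ˡ (lists m) ⟦ a ≡ᵇ b ⟧ _)) ⟩
    ∑< t (λ a → ⟦ a ≡ᵇ b ⟧ * ∑ (lists m) (λ z → h (a ∷ z) * ⟦ does (z ≟L y) ⟧))
      ≡⟨ ∑<-pick t b _ b<t ⟩
    ∑ (lists m) (λ z → h (b ∷ z) * ⟦ does (z ≟L y) ⟧)
      ≡⟨ ∑-lists-pick m (cong pred l , y<t) (λ z → h (b ∷ z)) ⟩
    h (b ∷ y) ∎
    where
    open ≡-Reasoning
    swap : ∀ a b c → a * (b * c) ≡ b * (a * c)
    swap = solve-∀
    regroup : ∀ h p q → h * ⟦ p ∧ q ⟧ ≡ ⟦ p ⟧ * (h * ⟦ q ⟧)
    regroup h p q = trans (cong (h *_) (⟦∧⟧ p q)) (swap h ⟦ p ⟧ ⟦ q ⟧)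

  lists-distinct : ∀ m x → ∑ (lists m) (λ y → ⟦ does (x ≟L y) ⟧) ≤ 1
  lists-distinct zero [] = ≤-refl
  lists-distinct zero (a ∷ x) = z≤n
  lists-distinct (suc m) [] = ≤-trans (≤-reflexive (trans (∑-lists-suc m _)
    (trans (∑-cong (downFrom t) (λ a → ∑-zero (lists m))) (∑-zero (downFrom t))))) z≤n
  lists-distinct (suc m) (a ∷ x) = begin
    ∑ (lists (suc m)) (λ y → ⟦ does ((a ∷ x) ≟L y) ⟧)
      ≡⟨ ∑-lists-suc m _ ⟩
    ∑< t (λ b → ∑ (lists m) (λ y → ⟦ (a ≡ᵇ b) ∧ does (x ≟L y) ⟧))
      ≡⟨ ∑-cong (downFrom t) (λ b → trans (∑-cong (lists m) (λ y → ⟦∧⟧ (a ≡ᵇ b) (does (x ≟L y)))) (∑-*ˡ (lists m) ⟦ a ≡ᵇ b ⟧ _)) ⟩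
    ∑< t (λ b → ⟦ a ≡ᵇ b ⟧ * ∑ (lists m) (λ y → ⟦ does (x ≟L y) ⟧))
      ≤⟨ ∑-mono (downFrom t) (λ b → *-mono-≤ (≤-reflexive (cong ⟦_⟧ (≡ᵇ-sym a b))) (lists-distinct m x)) ⟩
    ∑< t (λ b → ⟦ b ≡ᵇ a ⟧ * 1)
      ≤⟨ ∑<-pick-≤ t a 1 ⟩
    1 ∎
    where open ≤-Reasoning

  -- All denominators are at most Max, so D is a common denominator and inv q = D / q.
  Max D : ℕ
  Max = t ^ n * t ^ n
  D = Max !

  inv : ℕ → ℕ
  inv zero = 0
  inv (suc q) = D / suc q

  inv-* : ∀ {q} → 0 < q → q ≤ Max → q * inv q ≡ D
  inv-* {suc q} _ q≤ with ∣-trans (m∣m*n {suc q} (q !)) (m≤n⇒m!∣n! q≤)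
  ... | divides c eq = trans (cong (λ d → suc q * (d / suc q)) eq)
    (trans (cong (suc q *_) (m*n/n≡m c (suc q))) (trans (*-comm (suc q) c) (sym eq)))

  inv-≤ : ∀ {q} → q ≤ Max → q * inv q ≤ D
  inv-≤ {zero} _ = z≤n
  inv-≤ {suc q} q≤ = ≤-reflexive (inv-* (s≤s z≤n) q≤)

  N≤ : ∀ m k → N m k ≤ t ^ m
  N≤ m k = ≤-trans (≤-reflexive (sym (∑-rank m k)))
    (≤-trans (∑-mono (lists m) (λ x → ⟦⟧≤1 (sum x ≡ᵇ k))) (≤-reflexive (trans (∑-lists-const m 1) (*-identityʳ _))))

  t^≤ : ∀ {m} → m ≤ n → t ^ m ≤ t ^ n
  t^≤ = ^-monoʳ-≤ t ⦃ >-nonZero 0<t ⦄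

  N≤Max : ∀ {m} → m ≤ n → ∀ k → N m k ≤ Max
  N≤Max {m} m≤n k = ≤-trans (N≤ m k) (≤-trans (t^≤ m≤n)
    (≤-trans (≤-reflexive (sym (*-identityʳ _))) (*-monoʳ-≤ (t ^ n) (m^n>0 t ⦃ >-nonZero 0<t ⦄ n))))

  sh≤ : ∀ a {h B} → (∀ k → h k ≤ B) → ∀ k → sh a h k ≤ B
  sh≤ zero h≤ k = h≤ k
  sh≤ (suc a) h≤ zero = z≤n
  sh≤ (suc a) h≤ (suc k) = sh≤ a h≤ k

  den : ℕ → ℕ → ℕ → ℕ
  den m k a = Q m k t * u m k a

  den≤ : ∀ {m} → suc m ≤ n → ∀ k a → den m k a ≤ Max
  den≤ {m} m<n k a = *-mono-≤ (≤-trans (N≤ (suc m) (suc k)) (t^≤ m<n))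
    (≤-trans (sh≤ a (N≤ m) k) (t^≤ (<⇒≤ m<n)))

  -- The probabilities, scaled by D, that the first coordinate a of a ∷ x moves, respectively stays.
  moves holds : ℕ → List ℕ → ℕ
  moves a x = f m k (suc a) * inv (den m k a)
    where m = length x ; k = a + sum x
  holds a x = stay m k a * inv (den m k a)
    where m = length x ; k = a + sum x

  -- Scaled by `D ^ length x`: each coordinate that is asked contributes one factor, and after a
  -- move the power `D ^ length x` stands for the coordinates that are no longer asked. On the empty
  -- list the chain stops.
  κ : List ℕ → List ℕ → ℕ
  κ (a ∷ x) (b ∷ y) = ⟦ b ≡ᵇ suc a ⟧ * (moves a x * D ^ length x * ⟦ does (x ≟L y) ⟧) + ⟦ a ≡ᵇ b ⟧ * (holds a x * κ x y)
  κ _ _ = 0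

  κ-support : ∀ x y → κ x y ≢ 0 → Edge x y
  κ-support [] y ne = ⊥-elim (ne refl)
  κ-support (a ∷ x) [] ne = ⊥-elim (ne refl)
  κ-support (a ∷ x) (b ∷ y) ne with b ≟ suc a | a ≟ b
  ... | yes refl | yes a≡sa = ⊥-elim (1+n≢n (sym a≡sa))
  ... | no p | no q = ⊥-elim (ne (cong₂ (λ c d → ⟦ c ⟧ * (moves a x * D ^ length x * ⟦ does (x ≟L y) ⟧) + ⟦ d ⟧ * (holds a x * κ x y)) (≡ᵇ-≢ p) (≡ᵇ-≢ q)))
  ... | no p | yes refl = hold a (κ-support x y (λ z → ne (trans
        (cong₂ (λ c d → ⟦ c ⟧ * (moves a x * D ^ length x * ⟦ does (x ≟L y) ⟧) + ⟦ a ≡ᵇ a ⟧ * (holds a x * d)) (≡ᵇ-≢ p) z)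
        (trans (cong (⟦ a ≡ᵇ a ⟧ *_) (*-zeroʳ (holds a x))) (*-zeroʳ ⟦ a ≡ᵇ a ⟧)))))
  ... | yes refl | no q with x ≟L y
  ... | yes refl = move a x
  ... | no x≢y = ⊥-elim (ne (trans (cong (λ d → ⟦ a ≡ᵇ a ⟧ * (moves a x * D ^ length x * 0) + ⟦ d ⟧ * (holds a x * κ x y)) (≡ᵇ-≢ q))
        (trans (+-identityʳ _) (trans (cong (⟦ a ≡ᵇ a ⟧ *_) (*-zeroʳ (moves a x * D ^ length x))) (*-zeroʳ ⟦ a ≡ᵇ a ⟧)))))

  moves+holds≤ : ∀ a x → suc (length x) ≤ n → a < t → moves a x + holds a x ≤ D
  moves+holds≤ a x l a<t = ≤-trans (≤-reflexive (trans (sym (*-distribʳ-+ (inv (den m k a)) (f m k (suc a)) (stay m k a)))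
    (cong (_* inv (den m k a)) (f+stay m k a<t)))) (inv-≤ (den≤ l k a))
    where
    m k : ℕ
    m = length x
    k = a + sum x

  κ-out : ∀ m {x} → m ≤ n → Valid m x → ∑ (lists m) (κ x) ≤ D ^ m
  κ-out zero {[]} _ _ = z≤n
  κ-out (suc m) {a ∷ x} m<n (refl , a<t ∷ x<t) = begin
    ∑ (lists (suc m)) (κ (a ∷ x))
      ≡⟨ ∑-lists-suc m _ ⟩
    ∑< t (λ b → ∑ (lists m) (λ y → ⟦ b ≡ᵇ suc a ⟧ * (moves a x * D ^ m * ⟦ does (x ≟L y) ⟧) + ⟦ a ≡ᵇ b ⟧ * (holds a x * κ x y)))
      ≡⟨ ∑-cong (downFrom t) (λ b → trans (∑-+ (lists m) _ _) (cong₂ _+_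
           (trans (∑-*ˡ (lists m) ⟦ b ≡ᵇ suc a ⟧ _) (cong (⟦ b ≡ᵇ suc a ⟧ *_) (∑-*ˡ (lists m) (moves a x * D ^ m) _)))
           (trans (∑-*ˡ (lists m) ⟦ a ≡ᵇ b ⟧ _) (cong (⟦ a ≡ᵇ b ⟧ *_) (∑-*ˡ (lists m) (holds a x) (κ x)))))) ⟩
    ∑< t (λ b → ⟦ b ≡ᵇ suc a ⟧ * (moves a x * D ^ m * S) + ⟦ a ≡ᵇ b ⟧ * (holds a x * ∑ (lists m) (κ x)))
      ≤⟨ ∑-mono (downFrom t) (λ b → +-mono-≤
           (*-monoʳ-≤ ⟦ b ≡ᵇ suc a ⟧ (≤-trans (*-monoʳ-≤ (moves a x * D ^ m) (lists-distinct m x)) (≤-reflexive (*-identityʳ _))))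
           (*-mono-≤ (≤-reflexive (cong ⟦_⟧ (≡ᵇ-sym a b))) (*-monoʳ-≤ (holds a x) (κ-out m (<⇒≤ m<n) (refl , x<t))))) ⟩
    ∑< t (λ b → ⟦ b ≡ᵇ suc a ⟧ * (moves a x * D ^ m) + ⟦ b ≡ᵇ a ⟧ * (holds a x * D ^ m))
      ≡⟨ ∑-+ (downFrom t) _ _ ⟩
    ∑< t (λ b → ⟦ b ≡ᵇ suc a ⟧ * (moves a x * D ^ m)) + ∑< t (λ b → ⟦ b ≡ᵇ a ⟧ * (holds a x * D ^ m))
      ≤⟨ +-mono-≤ (∑<-pick-≤ t (suc a) _) (∑<-pick-≤ t a _) ⟩
    moves a x * D ^ m + holds a x * D ^ m
      ≡⟨ sym (*-distribʳ-+ (D ^ m) (moves a x) (holds a x)) ⟩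
    (moves a x + holds a x) * D ^ m
      ≤⟨ *-monoˡ-≤ (D ^ m) (moves+holds≤ a x m<n a<t) ⟩
    D * D ^ m ∎
    where
    open ≤-Reasoning
    S : ℕ
    S = ∑ (lists m) (λ y → ⟦ does (x ≟L y) ⟧)

  private
    -- The arithmetic of `κ-in`: a point arrives at `b ∷ y` by moving its first coordinate (`fb`) or
    -- by holding it while the rest arrives at `y` (`g`), where `vS` is the induction hypothesis. If
    -- the layer below `y` is empty, then `g` vanishes, so the default `inv 0 = 0` is harmless.
    balance : ∀ X v₁ v₂ fb g Z S D Dm i₁ i₂ → fb + g ≡ v₁ * Z → v₁ * S ≡ Dm * v₂ → 0 < v₁ →
      X * v₁ * i₁ ≡ D → (v₂ ≡ 0 → g ≡ 0) → (0 < v₂ → X * v₂ * i₂ ≡ D) →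
      X * (fb * i₁ * Dm + g * i₂ * S) ≡ D * Dm * Z
    balance X v₁ v₂ fb g Z S D Dm i₁ i₂ fg vS 0<v₁ e₁ g0 e₂ = *-cancelˡ-≡ _ _ v₁ ⦃ >-nonZero 0<v₁ ⦄ (begin
      v₁ * (X * (fb * i₁ * Dm + g * i₂ * S))                 ≡⟨ r₁ v₁ X fb i₁ Dm g i₂ S ⟩
      fb * (X * v₁ * i₁) * Dm + X * g * i₂ * (v₁ * S)        ≡⟨ cong₂ (λ p q → fb * p * Dm + X * g * i₂ * q) e₁ vS ⟩
      fb * D * Dm + X * g * i₂ * (Dm * v₂)                   ≡⟨ cong (fb * D * Dm +_) second ⟩
      fb * D * Dm + g * D * Dm                               ≡⟨ r₂ fb D Dm g ⟩
      (fb + g) * (D * Dm)                                    ≡⟨ cong (_* (D * Dm)) fg ⟩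
      v₁ * Z * (D * Dm)                                      ≡⟨ r₃ v₁ Z D Dm ⟩
      v₁ * (D * Dm * Z)                                      ∎)
      where
      open ≡-Reasoning
      r₁ : ∀ v X f i D g j S → v * (X * (f * i * D + g * j * S)) ≡ f * (X * v * i) * D + X * g * j * (v * S)
      r₁ = solve-∀
      r₂ : ∀ f D E g → f * D * E + g * D * E ≡ (f + g) * (D * E)
      r₂ = solve-∀
      r₃ : ∀ v Z D E → v * Z * (D * E) ≡ v * (D * E * Z)
      r₃ = solve-∀
      r₄ : ∀ X g i D v → X * g * i * (D * v) ≡ g * (X * v * i) * D
      r₄ = solve-∀
      second : X * g * i₂ * (Dm * v₂) ≡ g * D * Dm
      second with v₂ ≟ 0
      ... | yes v₂≡0 rewrite v₂≡0 | g0 refl = trans (cong (X * 0 * i₂ *_) (*-zeroʳ Dm)) (*-zeroʳ (X * 0 * i₂))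
      ... | no v₂≢0 = trans (r₄ X g i₂ Dm v₂) (cong (λ p → g * p * Dm) (e₂ (n≢0⇒n>0 v₂≢0)))

  valid-positive : ∀ m {y} → Valid m y → 0 < N m (sum y)
  valid-positive m {y} v = ≤-trans (≤-reflexive (sym (trans (∑-lists-pick m v (λ _ → 1)) refl)))
    (≤-trans (∑-mono (lists m) within) (≤-reflexive (∑-rank m (sum y))))
    where
    within : ∀ z → 1 * ⟦ does (z ≟L y) ⟧ ≤ ⟦ sum z ≡ᵇ sum y ⟧
    within z with z ≟L y
    ... | no _ = z≤n
    ... | yes refl = ≤-reflexive (cong ⟦_⟧ (sym (≡ᵇ-refl (sum z))))

  -- This is preservation of uniformity: a uniform point of the layer below `y` steps to `y` with
  -- probability `1 / N m (sum y)`. `sh 1 (N m) (sum y)` is the size of that lower layer and 0 at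
  -- the bottom.
  κ-in : ∀ m {y} → m ≤ n → Valid m y → N m (sum y) * ∑ (lists m) (λ z → κ z y) ≡ D ^ m * sh 1 (N m) (sum y)
  κ-in zero {[]} _ _ = refl
  κ-in (suc m) {b ∷ y} m<n (l , b<t ∷ y<t) with b + sum y in K
  ... | zero = trans (cong (N (suc m) 0 *_) (∑-zero-∈ (lists (suc m)) (λ z _ → none z))) (trans (*-zeroʳ (N (suc m) 0)) (sym (*-zeroʳ (D ^ suc m))))
    where
    none : ∀ z → κ z (b ∷ y) ≡ 0
    none z with κ z (b ∷ y) ≟ 0
    ... | yes e = e
    ... | no ne with () ← trans (sym (Edge-sum (κ-support z (b ∷ y) ne))) K
  ... | suc k = begin
    X * ∑ (lists (suc m)) (λ z → κ z (b ∷ y))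
      ≡⟨ cong (X *_) (trans (∑-lists-suc m _) (trans (∑-cong (downFrom t) (λ a → ∑-+ (lists m) _ _)) (∑-+ (downFrom t) _ _))) ⟩
    X * (∑< t (λ a → ∑ (lists m) (λ z → ⟦ b ≡ᵇ suc a ⟧ * (moves a z * D ^ length z * ⟦ does (z ≟L y) ⟧))) +
         ∑< t (λ a → ∑ (lists m) (λ z → ⟦ a ≡ᵇ b ⟧ * (holds a z * κ z y))))
      ≡⟨ cong₂ (λ p q → X * (p + q)) first second ⟩
    X * (f m k b * inv (X * v₁) * D ^ m + stay m k b * inv (X * v₂) * S)
      ≡⟨ balance X v₁ v₂ (f m k b) (stay m k b) (P m k t) S D (D ^ m) (inv (X * v₁)) (inv (X * v₂))
           (trans (f+stay′ m k b<t) (cong (_* P m k t) w≡))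
           (κ-in m (<⇒≤ m<n) vy)
           0<v₁
           (inv-* (*-mono-≤ 0<X 0<v₁) (subst (_≤ Max) (cong (X *_) w≡) (*-mono-≤ (≤-trans (N≤ (suc m) (suc k)) (t^≤ m<n)) (≤-trans (sh≤ b (N≤ m) (suc k)) (t^≤ (<⇒≤ m<n))))))
           (λ v₂≡0 → n≤0⇒n≡0 (≤-trans (m∸n≤m _ (f m k (suc b))) (≤-reflexive (trans (cong (X *_) (trans u≡ v₂≡0)) (*-zeroʳ X)))))
           (λ 0<v₂ → inv-* (*-mono-≤ 0<X 0<v₂) (subst (_≤ Max) (cong (X *_) u≡) (den≤ m<n k b))) ⟩
    D * D ^ m * P m k t ∎
    where
    open ≡-Reasoning
    X v₁ v₂ S : ℕ
    X = Q m k t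
    v₁ = N m (sum y)
    v₂ = sh 1 (N m) (sum y)
    S = ∑ (lists m) (λ z → κ z y)
    vy : Valid m y
    vy = cong pred l , y<t
    0<v₁ : 0 < v₁
    0<v₁ = valid-positive m vy
    0<X : 0 < X
    0<X = subst (λ i → 0 < N (suc m) i) K (valid-positive (suc m) {b ∷ y} (l , b<t ∷ y<t))
    w≡ : w m k b ≡ v₁
    w≡ = trans (cong (sh b (N m)) (sym K)) (sh-+ b (N m) (sum y))
    u≡ : u m k b ≡ v₂
    u≡ = trans (cong (sh (suc b) (N m)) (sym K)) (trans (cong (λ c → sh c (N m) (b + sum y)) (+-comm 1 b))
           (trans (sym (sh-sh b 1 (N m) (b + sum y))) (sh-+ b (sh 1 (N m)) (sum y))))
    first : ∑< t (λ a → ∑ (lists m) (λ z → ⟦ b ≡ᵇ suc a ⟧ * (moves a z * D ^ length z * ⟦ does (z ≟L y) ⟧))) ≡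
            f m k b * inv (X * v₁) * D ^ m
    first = trans (∑-cong (downFrom t) (λ a → trans (∑-*ˡ (lists m) ⟦ b ≡ᵇ suc a ⟧ _)
              (cong (⟦ b ≡ᵇ suc a ⟧ *_) (∑-lists-pick m vy (λ z → moves a z * D ^ length z)))))
              (by-cases b K w≡ b<t)
      where
      by-cases : ∀ b → b + sum y ≡ suc k → w m k b ≡ v₁ → b < t →
        ∑< t (λ a → ⟦ b ≡ᵇ suc a ⟧ * (moves a y * D ^ length y)) ≡ f m k b * inv (X * v₁) * D ^ m
      by-cases zero _ _ _ = trans (∑-zero (downFrom t)) refl
      by-cases (suc b′) K′ w≡′ b<t = begin
        ∑< t (λ a → ⟦ b′ ≡ᵇ a ⟧ * (moves a y * D ^ length y))
          ≡⟨ ∑-cong (downFrom t) (λ a → cong (λ c → ⟦ c ⟧ * (moves a y * D ^ length y)) (≡ᵇ-sym b′ a)) ⟩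
        ∑< t (λ a → ⟦ a ≡ᵇ b′ ⟧ * (moves a y * D ^ length y))
          ≡⟨ ∑<-pick t b′ _ (<⇒≤ b<t) ⟩
        moves b′ y * D ^ length y
          ≡⟨ cong₂ (λ i j → f i j (suc b′) * inv (den i j b′) * D ^ i) (proj₁ vy) (cong pred K′) ⟩
        f m k (suc b′) * inv (X * u m k b′) * D ^ m
          ≡⟨ cong (λ v → f m k (suc b′) * inv (X * v) * D ^ m) w≡′ ⟩
        f m k (suc b′) * inv (X * v₁) * D ^ m ∎
    second : ∑< t (λ a → ∑ (lists m) (λ z → ⟦ a ≡ᵇ b ⟧ * (holds a z * κ z y))) ≡ stay m k b * inv (X * v₂) * S
    second = begin
      ∑< t (λ a → ∑ (lists m) (λ z → ⟦ a ≡ᵇ b ⟧ * (holds a z * κ z y)))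
        ≡⟨ ∑-cong (downFrom t) (λ a → ∑-*ˡ (lists m) ⟦ a ≡ᵇ b ⟧ _) ⟩
      ∑< t (λ a → ⟦ a ≡ᵇ b ⟧ * ∑ (lists m) (λ z → holds a z * κ z y))
        ≡⟨ ∑<-pick t b _ b<t ⟩
      ∑ (lists m) (λ z → holds b z * κ z y)
        ≡⟨ ∑-cong-∈ (lists m) (λ z z∈ → constant z (proj₁ (∈lists⇒valid z∈))) ⟩
      ∑ (lists m) (λ z → stay m k b * inv (X * v₂) * κ z y)
        ≡⟨ ∑-*ˡ (lists m) (stay m k b * inv (X * v₂)) _ ⟩
      stay m k b * inv (X * v₂) * S ∎
      where
      constant : ∀ z → length z ≡ m → holds b z * κ z y ≡ stay m k b * inv (X * v₂) * κ z y
      constant z lz with κ z y ≟ 0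
      ... | yes e = trans (cong (holds b z *_) e) (trans (*-zeroʳ (holds b z)) (sym (trans (cong (stay m k b * inv (X * v₂) *_) e) (*-zeroʳ (stay m k b * inv (X * v₂))))))
      ... | no ne = cong (_* κ z y) (trans (cong₂ (λ i j → stay i j b * inv (den i j b)) lz rank)
                      (cong (λ v → stay m k b * inv (X * v)) u≡))
        where
        rank : b + sum z ≡ k
        rank = suc-injective (trans (sym (+-suc b (sum z))) (trans (cong (b +_) (sym (Edge-sum (κ-support z y ne)))) K))

  κ-hold : ∀ c {m} x y → suc m ≤ n → length x ≡ m → c < t → κ (c ∷ x) (c ∷ y) ≤ D * κ x y
  κ-hold c x y l refl c<t = begin
    κ (c ∷ x) (c ∷ y)
      ≡⟨ cong₂ (λ p q → ⟦ p ⟧ * (moves c x * D ^ length x * ⟦ does (x ≟L y) ⟧) + ⟦ q ⟧ * (holds c x * κ x y)) (≡ᵇ-≢ {c} {suc c} (λ e → 1+n≢n (sym e))) (≡ᵇ-refl c) ⟩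
    holds c x * κ x y + 0
      ≡⟨ +-identityʳ _ ⟩
    holds c x * κ x y
      ≤⟨ *-monoˡ-≤ (κ x y) (≤-trans (m≤n+m (holds c x) (moves c x)) (moves+holds≤ c x l c<t)) ⟩
    D * κ x y ∎
    where open ≤-Reasoning

  κ-move : ∀ a x → κ (a ∷ x) (suc a ∷ x) ≡ moves a x * D ^ length x
  κ-move a x = trans (cong₂ (λ p q → ⟦ p ⟧ * (moves a x * D ^ length x * ⟦ does (x ≟L x) ⟧) + ⟦ q ⟧ * (holds a x * κ x x)) (≡ᵇ-refl a) (≡ᵇ-≢ {a} {suc a} (λ e → 1+n≢n (sym e))))
    (trans (+-identityʳ _) (trans (+-identityʳ _) (trans (cong (λ b → moves a x * D ^ length x * ⟦ b ⟧) (dec-true (x ≟L x) refl)) (*-identityʳ _))))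

  κ-move≤ : ∀ a x → suc (length x) ≤ n → a < t → κ (a ∷ x) (suc a ∷ x) ≤ D ^ suc (length x)
  κ-move≤ a x l a<t = ≤-trans (≤-reflexive (κ-move a x))
    (*-monoˡ-≤ (D ^ length x) (≤-trans (m≤m+n (moves a x) (holds a x)) (moves+holds≤ a x l a<t)))

  κ-move-central : ∀ a x g l → suc (length x) ≤ n → a < t → length x < g * l →
    2 * (l * t) + t ≤ suc (a + sum x) → suc (a + sum x) + 2 * (l * t) ≤ length x * pred t →
    suc (length x) * κ (a ∷ x) (suc a ∷ x) ≤ 8 * (2 ^ g) ^ 3 * D ^ suc (length x)
  κ-move-central a x g l len a<t x<gl lo hi = begin
    suc m * κ (a ∷ x) (suc a ∷ x)                ≡⟨ cong (suc m *_) (κ-move a x) ⟩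
    suc m * (f m k (suc a) * i * D ^ m)          ≡⟨ r₁ (suc m) (f m k (suc a)) i (D ^ m) ⟩
    suc m * f m k (suc a) * (i * D ^ m)          ≤⟨ *-monoˡ-≤ (i * D ^ m) (central-bound m k l g a a<t x<gl lo hi) ⟩
    8 * (2 ^ g) ^ 3 * den m k a * (i * D ^ m)    ≡⟨ r₂ (8 * (2 ^ g) ^ 3) (den m k a) i (D ^ m) ⟩
    8 * (2 ^ g) ^ 3 * (den m k a * i * D ^ m)    ≤⟨ *-monoʳ-≤ (8 * (2 ^ g) ^ 3) (*-monoˡ-≤ (D ^ m) (inv-≤ (den≤ len k a))) ⟩
    8 * (2 ^ g) ^ 3 * (D * D ^ m)                ∎
    where
    open ≤-Reasoning
    m k i : ℕ
    m = length x
    k = a + sum x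
    i = inv (den m k a)
    r₁ : ∀ m f i d → m * (f * i * d) ≡ m * f * (i * d)
    r₁ = solve-∀
    r₂ : ∀ c q i d → c * q * (i * d) ≡ c * (q * i * d)
    r₂ = solve-∀

-- Averaging the step over all rotations of the coordinates

rot : List ℕ → List ℕ
rot [] = []
rot (a ∷ x) = x ++ [ a ]

rots : ℕ → List ℕ → List ℕ
rots zero x = x
rots (suc ρ) x = rots ρ (rot x)

rots-++ : ∀ u w → rots (length u) (u ++ w) ≡ w ++ u
rots-++ [] w = sym (++-identityʳ w)
rots-++ (a ∷ u) w = trans (cong (rots (length u)) (++-assoc u w [ a ]))
  (trans (rots-++ u (w ++ [ a ])) (++-assoc w [ a ] u))

rots-length : ∀ x → rots (length x) x ≡ x
rots-length x = trans (cong (rots (length x)) (sym (++-identityʳ x))) (rots-++ x [])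

rots-+ : ∀ i j x → rots (i + j) x ≡ rots j (rots i x)
rots-+ zero j x = refl
rots-+ (suc i) j x = rots-+ i j (rot x)

length-rots : ∀ ρ x → length (rots ρ x) ≡ length x
length-rots zero x = refl
length-rots (suc ρ) x = trans (length-rots ρ (rot x)) (length-rot x)
  where
  length-rot : ∀ x → length (rot x) ≡ length x
  length-rot [] = refl
  length-rot (a ∷ x) = trans (length-++ x) (+-comm (length x) 1)

sum-rots : ∀ ρ x → sum (rots ρ x) ≡ sum x
sum-rots zero x = refl
sum-rots (suc ρ) x = trans (sum-rots ρ (rot x)) (sum-rot x)
  where
  sum-rot : ∀ x → sum (rot x) ≡ sum x
  sum-rot [] = refl
  sum-rot (a ∷ x) = trans (sum-++ x [ a ]) (trans (cong (sum x +_) (+-identityʳ a)) (+-comm (sum x) a))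

All-rots : ∀ {P : ℕ → Set} ρ {x} → All P x → All P (rots ρ x)
All-rots zero px = px
All-rots (suc ρ) [] = All-rots ρ []
All-rots (suc ρ) (pa ∷ px) = All-rots ρ (All.++⁺ px (pa ∷ []))

Edge-∷ʳ : ∀ a {x y} → Edge x y → Edge (x ++ [ a ]) (y ++ [ a ])
Edge-∷ʳ a (move b x) = move b (x ++ [ a ])
Edge-∷ʳ a (hold b e) = hold b (Edge-∷ʳ a e)

Edge-move-last : ∀ a x → Edge (x ++ [ a ]) (x ++ [ suc a ])
Edge-move-last a [] = move a []
Edge-move-last a (b ∷ x) = hold b (Edge-move-last a x)

Edge-rots : ∀ ρ {x y} → Edge x y → Edge (rots ρ x) (rots ρ y)
Edge-rots zero e = e
Edge-rots (suc ρ) (move a x) = Edge-rots ρ (Edge-move-last a x)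
Edge-rots (suc ρ) (hold a e) = Edge-rots ρ (Edge-∷ʳ a e)

rots-back : ∀ {n ρ x} → length x ≡ n → ρ ≤ n → rots (n ∸ ρ) (rots ρ x) ≡ x
rots-back {n} {ρ} {x} refl ρ≤n = trans (sym (rots-+ ρ (n ∸ ρ) x)) (trans (cong (λ i → rots i x) (m+[n∸m]≡n ρ≤n)) (rots-length x))

Edge-length : ∀ {x y} → Edge x y → length x ≡ length y
Edge-length (move a x) = refl
Edge-length (hold a e) = cong suc (Edge-length e)

below : List ℕ → List ℕ → Bool
below x y = does (Pointwise.decidable _≤?_ x y)

below⇒≤ : ∀ {x y} → below x y ≡ true → Pointwise _≤_ x y
below⇒≤ {x} {y} e with Pointwise.decidable _≤?_ x y
... | yes p = p
below⇒≤ () | no _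

≤⇒below : ∀ {x y} → Pointwise _≤_ x y → below x y ≡ true
≤⇒below {x} {y} p = dec-true (Pointwise.decidable _≤?_ x y) p

lt : List ℕ → List ℕ → Bool
lt x y = below x y ∧ does (sum x <? sum y)

lt⇒≤ : ∀ x y → lt x y ≡ true → Pointwise _≤_ x y × sum x < sum y
lt⇒≤ x y e with below x y in b | sum x <? sum y
lt⇒≤ x y e | true | yes p = below⇒≤ b , p
lt⇒≤ x y e | true | no ¬p with () ← trans (sym (dec-false (sum x <? sum y) ¬p)) e

≤⇒lt : ∀ x y → Pointwise _≤_ x y → sum x < sum y → lt x y ≡ true
≤⇒lt x y p q = trans (cong (_∧ does (sum x <? sum y)) (≤⇒below p)) (dec-true (sum x <? sum y) q)

module RandomChain (t n : ℕ) (0<t : 0 < t) (0<n : 0 < n) where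

  open Layers t
  open Points t
  open Kernel t n 0<t

  ∑-lists-snoc : ∀ m (h : List ℕ → ℕ) → ∑ (lists (suc m)) h ≡ ∑< t (λ a → ∑ (lists m) (λ x → h (x ++ [ a ])))
  ∑-lists-snoc zero h = ∑-lists-suc zero h
  ∑-lists-snoc (suc m) h = begin
    ∑ (lists (suc (suc m))) h
      ≡⟨ ∑-lists-suc (suc m) h ⟩
    ∑< t (λ b → ∑ (lists (suc m)) (λ x → h (b ∷ x)))
      ≡⟨ ∑-cong (downFrom t) (λ b → ∑-lists-snoc m (λ x → h (b ∷ x))) ⟩
    ∑< t (λ b → ∑< t (λ a → ∑ (lists m) (λ x → h (b ∷ x ++ [ a ]))))
      ≡⟨ ∑-swap (downFrom t) (downFrom t) _ ⟩
    ∑< t (λ a → ∑< t (λ b → ∑ (lists m) (λ x → h (b ∷ x ++ [ a ]))))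
      ≡⟨ ∑-cong (downFrom t) (λ a → sym (∑-lists-suc m (λ x → h (x ++ [ a ])))) ⟩
    ∑< t (λ a → ∑ (lists (suc m)) (λ x → h (x ++ [ a ]))) ∎
    where open ≡-Reasoning

  ∑-lists-rots : ∀ m ρ (h : List ℕ → ℕ) → ∑ (lists m) (h ∘ rots ρ) ≡ ∑ (lists m) h
  ∑-lists-rots m zero h = refl
  ∑-lists-rots m (suc ρ) h = trans (one m) (∑-lists-rots m ρ h)
    where
    one : ∀ m → ∑ (lists m) (h ∘ rots (suc ρ)) ≡ ∑ (lists m) (h ∘ rots ρ)
    one zero = refl
    one (suc m) = trans (∑-lists-suc m _) (sym (∑-lists-snoc m (h ∘ rots ρ)))

  Valid-rots : ∀ ρ {m x} → Valid m x → Valid m (rots ρ x)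
  Valid-rots ρ {m} {x} (l , x<t) = trans (length-rots ρ x) l , All-rots ρ x<t

  Φ : List ℕ → List ℕ → ℕ
  Φ x y = ∑< n (λ ρ → κ (rots ρ x) (rots ρ y))

  Φ-support : ∀ x y → Φ x y ≢ 0 → Σ ℕ (λ ρ → ρ < n × Edge (rots ρ x) (rots ρ y))
  Φ-support x y ne with ∑-nonzero (downFrom n) (λ ρ → κ (rots ρ x) (rots ρ y)) ne
  ... | ρ , ρ∈ , κ≢0 = ρ , ∈-downFrom⁻ ρ∈ , κ-support (rots ρ x) (rots ρ y) κ≢0

  Φ-edge : ∀ x y → length x ≡ n → Φ x y ≢ 0 → Edge x y
  Φ-edge x y lx ne with Φ-support x y ne
  ... | ρ , ρ<n , e = subst₂ Edge (rots-back lx (<⇒≤ ρ<n)) (rots-back ly (<⇒≤ ρ<n)) (Edge-rots (n ∸ ρ) e)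
    where
    ly : length y ≡ n
    ly = trans (sym (length-rots ρ y)) (trans (sym (Edge-length e)) (trans (length-rots ρ x) lx))

  Φ-rank : ∀ x y → Φ x y ≢ 0 → sum y ≡ suc (sum x)
  Φ-rank x y ne with Φ-support x y ne
  ... | ρ , _ , e = trans (sym (sum-rots ρ y)) (trans (Edge-sum e) (cong suc (sum-rots ρ x)))

  Φ-lt : ∀ x y → x ∈ lists n → Φ x y ≢ 0 → lt x y ≡ true
  Φ-lt x y x∈ ne = ≤⇒lt x y (Edge-≤ edge) (≤-reflexive (sym (Edge-sum edge)))
    where
    edge : Edge x y
    edge = Φ-edge x y (proj₁ (∈lists⇒valid x∈)) ne

  E : ℕ
  E = n * D ^ n

  -- The uniform distribution on each layer, scaled by `D`.
  μ : List ℕ → ℕ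
  μ x = inv (N n (sum x))

  outflow : ∀ x → x ∈ lists n → ∑ (lists n) (Φ x) ≤ E
  outflow x x∈ = begin
    ∑ (lists n) (λ y → ∑< n (λ ρ → κ (rots ρ x) (rots ρ y)))   ≡⟨ ∑-swap (lists n) (downFrom n) _ ⟩
    ∑< n (λ ρ → ∑ (lists n) (λ y → κ (rots ρ x) (rots ρ y)))   ≡⟨ ∑-cong (downFrom n) (λ ρ → ∑-lists-rots n ρ (κ (rots ρ x))) ⟩
    ∑< n (λ ρ → ∑ (lists n) (κ (rots ρ x)))                    ≤⟨ ∑-mono (downFrom n) (λ ρ → κ-out n ≤-refl (Valid-rots ρ (∈lists⇒valid x∈))) ⟩
    ∑< n (λ _ → D ^ n)                                         ≡⟨ ∑<-const n (D ^ n) ⟩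
    n * D ^ n                                                  ∎
    where open ≤-Reasoning

  N-pred-positive : ∀ m k → 0 < N m (suc k) → 0 < N m k
  N-pred-positive m k pos with N m k in e
  ... | suc _ = s≤s z≤n
  ... | zero = ⊥-elim (<-irrefl refl (≤-trans (≤-trans pos (≤-reflexive (sym (trans (cong (_* N m (suc k)) (N-zero 0<t m)) (+-identityʳ _)))))
      (≤-trans (N-lc m 0 k z≤n) (≤-reflexive (trans (cong (N m 1 *_) e) (*-zeroʳ (N m 1)))))))

  inflow : ∀ y → y ∈ lists n → sum y ≢ 0 → ∑ (lists n) (λ x → μ x * Φ x y) ≡ E * μ y
  inflow y y∈ sy≢0 with sum y in sy
  ... | zero = ⊥-elim (sy≢0 refl)
  ... | suc k = begin
    ∑ (lists n) (λ x → μ x * Φ x y)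
      ≡⟨ ∑-cong (lists n) (λ x → sym (∑-*ˡ (downFrom n) (μ x) _)) ⟩
    ∑ (lists n) (λ x → ∑< n (λ ρ → μ x * κ (rots ρ x) (rots ρ y)))
      ≡⟨ ∑-swap (lists n) (downFrom n) _ ⟩
    ∑< n (λ ρ → ∑ (lists n) (λ x → μ x * κ (rots ρ x) (rots ρ y)))
      ≡⟨ ∑-cong (downFrom n) (λ ρ → trans (∑-cong (lists n) (λ x → cong (λ s → inv (N n s) * κ (rots ρ x) (rots ρ y)) (sym (sum-rots ρ x))))
           (trans (∑-lists-rots n ρ (λ x → μ x * κ x (rots ρ y))) (fixed ρ))) ⟩
    ∑< n (λ _ → D ^ n * inv v₁)
      ≡⟨ ∑<-const n (D ^ n * inv v₁) ⟩
    n * (D ^ n * inv v₁)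
      ≡⟨ sym (*-assoc n (D ^ n) (inv v₁)) ⟩
    n * D ^ n * inv v₁ ∎
    where
    open ≡-Reasoning
    v₁ v₀ : ℕ
    v₁ = N n (suc k)
    v₀ = N n k
    vy : Valid n y
    vy = ∈lists⇒valid y∈
    0<v₁ : 0 < v₁
    0<v₁ = subst (λ s → 0 < N n s) sy (valid-positive n vy)
    r₁ : ∀ a b c → a * (b * c) ≡ b * (a * c)
    r₁ = solve-∀
    r₂ : ∀ a d b → a * (d * b) ≡ b * a * d
    r₂ = solve-∀
    r₃ : ∀ a b d → a * b * d ≡ a * (d * b)
    r₃ = solve-∀
    fixed : ∀ ρ → ∑ (lists n) (λ x → μ x * κ x (rots ρ y)) ≡ D ^ n * inv v₁
    fixed ρ = *-cancelˡ-≡ _ _ v₁ ⦃ >-nonZero 0<v₁ ⦄ (begin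
      v₁ * ∑ (lists n) (λ x → μ x * κ x z)
        ≡⟨ cong (v₁ *_) (trans (∑-cong (lists n) constant) (∑-*ˡ (lists n) (inv v₀) _)) ⟩
      v₁ * (inv v₀ * ∑ (lists n) (λ x → κ x z))
        ≡⟨ r₁ v₁ (inv v₀) _ ⟩
      inv v₀ * (v₁ * ∑ (lists n) (λ x → κ x z))
        ≡⟨ cong (inv v₀ *_) (subst (λ s → N n s * ∑ (lists n) (λ x → κ x z) ≡ D ^ n * sh 1 (N n) s) sz (κ-in n ≤-refl (Valid-rots ρ vy))) ⟩
      inv v₀ * (D ^ n * v₀)
        ≡⟨ r₂ (inv v₀) (D ^ n) v₀ ⟩
      v₀ * inv v₀ * D ^ n
        ≡⟨ cong (_* D ^ n) (trans (inv-* (N-pred-positive n k 0<v₁) (N≤Max ≤-refl k)) (sym (inv-* 0<v₁ (N≤Max ≤-refl (suc k))))) ⟩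
      v₁ * inv v₁ * D ^ n
        ≡⟨ r₃ v₁ (inv v₁) (D ^ n) ⟩
      v₁ * (D ^ n * inv v₁) ∎)
      where
      z : List ℕ
      z = rots ρ y
      sz : sum z ≡ suc k
      sz = trans (sum-rots ρ y) sy
      constant : ∀ x → μ x * κ x z ≡ inv v₀ * κ x z
      constant x with κ x z ≟ 0
      ... | yes e = trans (cong (μ x *_) e) (trans (*-zeroʳ (μ x)) (sym (trans (cong (inv v₀ *_) e) (*-zeroʳ (inv v₀)))))
      ... | no ne = cong (λ s → inv (N n s) * κ x z) (suc-injective (trans (sym (Edge-sum (κ-support x z ne))) sz))

  bottom : ∑ (lists n) (λ x → ⟦ sum x ≡ᵇ 0 ⟧ * μ x) ≤ D
  bottom = begin
    ∑ (lists n) (λ x → ⟦ sum x ≡ᵇ 0 ⟧ * μ x)            ≡⟨ ∑-cong (lists n) at-zero ⟩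
    ∑ (lists n) (λ x → ⟦ sum x ≡ᵇ 0 ⟧ * inv (N n 0))    ≡⟨ ∑-*ʳ (lists n) (inv (N n 0)) _ ⟩
    ∑ (lists n) (λ x → ⟦ sum x ≡ᵇ 0 ⟧) * inv (N n 0)    ≡⟨ cong (_* inv (N n 0)) (∑-rank n 0) ⟩
    N n 0 * inv (N n 0)                                 ≤⟨ inv-≤ (N≤Max ≤-refl 0) ⟩
    D                                                   ∎
    where
    open ≤-Reasoning
    at-zero : ∀ x → ⟦ sum x ≡ᵇ 0 ⟧ * μ x ≡ ⟦ sum x ≡ᵇ 0 ⟧ * inv (N n 0)
    at-zero x with sum x
    ... | zero = refl
    ... | suc _ = refl

  0<D : 0 < D
  0<D = n!>0 Max
    where
    n!>0 : ∀ m → 0 < m !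
    n!>0 zero = s≤s z≤n
    n!>0 (suc m) = ≤-trans (n!>0 m) (m≤m+n (m !) _)

  0<D^n : 0 < D ^ n
  0<D^n = m^n>0 D ⦃ >-nonZero 0<D ⦄ n

  sum≤ : ∀ {x} → All (_< t) x → sum x ≤ length x * t
  sum≤ [] = z≤n
  sum≤ (a<t ∷ x<t) = +-mono-≤ (<⇒≤ a<t) (sum≤ x<t)

  -- No layer exceeds `α`, so every point has weight `μ` at least `D / α`, as in the LYM inequality.
  -- Multiplying the weighted inequality by `length F` and cancelling `∑ F μ` then leaves an
  -- inequality between sizes.
  supersaturated : ∀ α K d F → (∀ k → N n k ≤ α) → (∀ x → x ∈ F → x ∈ lists n) →
    (∀ x → ∑ F (λ y → ⟦ does (x ≟L y) ⟧) ≤ 1) →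
    (∀ x y → x ∈ lists n → y ∈ F → Φ x y ≤ K * D ^ n) →
    (∀ x → x ∈ F → ∑ F (λ y → ⟦ lt x y ⟧) ≤ d) →
    ∀ s → s * n * length F ≤ tri (suc s) * n * α + d * K * length F
  supersaturated α K d [] N≤α F⊆ F-distinct Φ≤ deg s = ≤-trans (≤-reflexive (*-zeroʳ (s * n))) z≤n
  supersaturated α K d F@(x₀ ∷ _) N≤α F⊆ F-distinct Φ≤ deg s = *-cancelʳ-≤ _ _ M ⦃ >-nonZero 0<M ⦄ (begin
    s * n * L * M                          ≡⟨ r₁ (s * n) L M ⟩
    L * (s * n * M)                        ≤⟨ *-monoʳ-≤ L core ⟩
    L * (tri (suc s) * n * D + d * K * M)  ≡⟨ r₂ L (tri (suc s) * n) D (d * K) M ⟩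
    tri (suc s) * n * (L * D) + d * K * L * M ≤⟨ +-monoˡ-≤ (d * K * L * M) (*-monoʳ-≤ (tri (suc s) * n) LD≤) ⟩
    tri (suc s) * n * (α * M) + d * K * L * M ≡⟨ r₃ (tri (suc s) * n) α M (d * K * L) ⟩
    (tri (suc s) * n * α + d * K * L) * M  ∎)
    where
    open ≤-Reasoning
    L M : ℕ
    L = length F
    M = ∑ F μ
    r₁ : ∀ a b c → a * b * c ≡ b * (a * c)
    r₁ = solve-∀
    r₂ : ∀ l a d b m → l * (a * d + b * m) ≡ a * (l * d) + b * l * m
    r₂ = solve-∀
    r₃ : ∀ a b m c → a * (b * m) + c * m ≡ (a * b + c) * m
    r₃ = solve-∀
    D≤ : ∀ x → x ∈ F → D ≤ α * μ x
    D≤ x x∈ = ≤-trans (≤-reflexive (sym (inv-* (N-positive (F⊆ x x∈)) (N≤Max ≤-refl (sum x))))) (*-monoˡ-≤ (μ x) (N≤α (sum x)))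
    LD≤ : L * D ≤ α * M
    LD≤ = ≤-trans (≤-reflexive (sym (∑-const F D))) (≤-trans (∑-mono-∈ F D≤) (≤-reflexive (∑-*ˡ F α μ)))
    0<μ : 0 < μ x₀
    0<μ with μ x₀ in e
    ... | suc _ = s≤s z≤n
    ... | zero = ⊥-elim (<-irrefl refl (≤-trans 0<D (≤-trans (D≤ x₀ (here refl)) (≤-reflexive (trans (cong (α *_) e) (*-zeroʳ α))))))
    0<M : 0 < M
    0<M = ≤-trans 0<μ (term≤∑ {xs = F} {x₀} μ (here refl))
    module Chain = Flow _≟L_ (lists n) sum (n * t) E D (K * D ^ n) Φ μ lt (*-mono-≤ 0<n 0<D^n)
      (λ y y∈ h → ∑-lists-pick n (∈lists⇒valid y∈) h)
      outflow inflow bottom Φ-rank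
      Φ-lt
      (λ x y z xy yz → ≤⇒lt x z (Pointwise.transitive ≤-trans (proj₁ (lt⇒≤ x y xy)) (proj₁ (lt⇒≤ y z yz)))
                                (<-trans (proj₂ (lt⇒≤ x y xy)) (proj₂ (lt⇒≤ y z yz))))
      (λ x y xy → proj₂ (lt⇒≤ x y xy))
      (λ x x∈ → ≤-trans (sum≤ (proj₂ (∈lists⇒valid x∈))) (≤-reflexive (cong (_* t) (proj₁ (∈lists⇒valid x∈)))))
      F F⊆ F-distinct Φ≤ d deg
    core : s * n * M ≤ tri (suc s) * n * D + d * K * M
    core = *-cancelˡ-≤ (D ^ n) ⦃ >-nonZero 0<D^n ⦄ (begin
      D ^ n * (s * n * M)                                   ≡⟨ q₁ (D ^ n) s n M ⟩
      s * (n * D ^ n) * M                                   ≤⟨ Chain.supersaturation s ⟩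
      tri (suc s) * (n * D ^ n) * D + d * (K * D ^ n) * M   ≡⟨ q₂ (tri (suc s)) n (D ^ n) D d K M ⟩
      D ^ n * (tri (suc s) * n * D + d * K * M)             ∎)
      where
      q₁ : ∀ e s n m → e * (s * n * m) ≡ s * (n * e) * m
      q₁ = solve-∀
      q₂ : ∀ u n e D d k m → u * (n * e) * D + d * (k * e) * m ≡ e * (u * n * D + d * k * m)
      q₂ = solve-∀

-- The averaged step into a balanced point is spread out

Edge-split : ∀ {x y} → Edge x y → Σ (List ℕ) (λ p → Σ ℕ (λ a → Σ (List ℕ) (λ q → x ≡ p ++ a ∷ q × y ≡ p ++ suc a ∷ q)))
Edge-split (move a x) = [] , a , x , refl , refl
Edge-split (hold b e) with Edge-split e
... | p , a , q , refl , refl = b ∷ p , a , q , refl , refl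

∑<-periodic : ∀ n i (h : ℕ → ℕ) → (∀ j → h (n + j) ≡ h j) → ∑< n h ≡ ∑< n (λ j → h (i + j))
∑<-periodic n i h periodic = +-cancelʳ-≡ (∑< i h) _ _ (begin
  ∑< n h + ∑< i h                       ≡⟨ cong (∑< n h +_) (∑-cong (downFrom i) (λ j → sym (periodic j))) ⟩
  ∑< n h + ∑< i (λ j → h (n + j))       ≡⟨ sym (∑<-+ n i h) ⟩
  ∑< (n + i) h                          ≡⟨ cong (λ k → ∑< k h) (+-comm n i) ⟩
  ∑< (i + n) h                          ≡⟨ ∑<-+ i n h ⟩
  ∑< i h + ∑< n (λ j → h (i + j))       ≡⟨ +-comm (∑< i h) _ ⟩
  ∑< n (λ j → h (i + j)) + ∑< i h       ∎)
  where open ≡-Reasoning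

-- Dyadic blocks: the indices from `2 ^ i` up to `2 ^ suc i` contribute at most `Z` together.
harmonic : ∀ i Z (h : ℕ → ℕ) → (∀ j → suc j * h j ≤ Z) → ∑< (2 ^ i) h ≤ suc i * Z
harmonic zero Z h h≤ = ≤-trans (≤-reflexive (cong (_+ 0) (sym (+-identityʳ (h 0))))) (+-monoˡ-≤ 0 (h≤ 0))
harmonic (suc i) Z h h≤ = begin
  ∑< (2 ^ i + (2 ^ i + 0)) h                           ≡⟨ ∑<-+ (2 ^ i) (2 ^ i + 0) h ⟩
  ∑< (2 ^ i) h + ∑< (2 ^ i + 0) (λ j → h (2 ^ i + j))  ≤⟨ +-mono-≤ (harmonic i Z h h≤) block ⟩
  suc i * Z + Z                                        ≡⟨ +-comm (suc i * Z) Z ⟩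
  Z + suc i * Z                                        ∎
  where
  open ≤-Reasoning
  block : ∑< (2 ^ i + 0) (λ j → h (2 ^ i + j)) ≤ Z
  block = *-cancelˡ-≤ (2 ^ i) ⦃ m^n≢0 2 i ⦄ (begin
    2 ^ i * ∑< (2 ^ i + 0) (λ j → h (2 ^ i + j))       ≡⟨ sym (∑-*ˡ (downFrom (2 ^ i + 0)) (2 ^ i) _) ⟩
    ∑< (2 ^ i + 0) (λ j → 2 ^ i * h (2 ^ i + j))       ≤⟨ ∑-mono (downFrom (2 ^ i + 0)) (λ j → ≤-trans
                                                            (*-monoˡ-≤ (h (2 ^ i + j)) (≤-trans (m≤m+n (2 ^ i) j) (n≤1+n _))) (h≤ (2 ^ i + j))) ⟩
    ∑< (2 ^ i + 0) (λ _ → Z)                           ≡⟨ ∑<-const (2 ^ i + 0) Z ⟩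
    (2 ^ i + 0) * Z                                    ≡⟨ cong (_* Z) (+-identityʳ (2 ^ i)) ⟩
    2 ^ i * Z                                          ∎)

∑<-initial : ∀ n l → ∑< n (λ j → ⟦ does (j <? l) ⟧) ≤ l
∑<-initial n l with n ≤? l
... | yes n≤l = ≤-trans (∑-mono (downFrom n) (λ j → ⟦⟧≤1 (does (j <? l)))) (≤-trans (≤-reflexive (trans (∑<-const n 1) (*-identityʳ n))) n≤l)
... | no n≰l with m≤n⇒∃[o]m+o≡n (<⇒≤ (≰⇒> n≰l))
... | o , refl = begin
  ∑< (l + o) (λ j → ⟦ does (j <? l) ⟧)                                             ≡⟨ ∑<-+ l o _ ⟩
  ∑< l (λ j → ⟦ does (j <? l) ⟧) + ∑< o (λ j → ⟦ does (l + j <? l) ⟧)              ≤⟨ +-mono-≤ (∑-mono (downFrom l) (λ j → ⟦⟧≤1 (does (j <? l))))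
                                                                                       (≤-reflexive (∑-cong (downFrom o) (λ j → cong ⟦_⟧ (dec-false (l + j <? l) (m+n≮m l j))))) ⟩
  ∑< l (λ _ → 1) + ∑< o (λ _ → 0)                                                  ≡⟨ cong₂ _+_ (trans (∑<-const l 1) (*-identityʳ l)) (∑-zero (downFrom o)) ⟩
  l + 0                                                                            ≡⟨ +-identityʳ l ⟩
  l                                                                                ∎
  where open ≤-Reasoning

take-++-≤ : ∀ (m : ℕ) (x y : List ℕ) → m ≤ length x → take m (x ++ y) ≡ take m x
take-++-≤ zero x y _ = refl
take-++-≤ (suc m) (a ∷ x) y (s≤s l) = cong (a ∷_) (take-++-≤ m x y l)

take-split : ∀ (l o : ℕ) (x : List ℕ) → take (l + o) x ≡ take l x ++ take o (drop l x)
take-split zero o x = refl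
take-split (suc l) o [] = sym (take-[] o)
  where
  take-[] : ∀ o → take o [] ≡ ([] {A = ℕ})
  take-[] zero = refl
  take-[] (suc o) = refl
take-split (suc l) o (a ∷ x) = cong (a ∷_) (take-split l o x)

rots-drop : ∀ l x → l ≤ length x → rots l x ≡ drop l x ++ take l x
rots-drop l x l≤ = trans (cong₂ rots (sym (trans (length-take l x) (m≤n⇒m⊓n≡m l≤))) (sym (take++drop≡id l x))) (rots-++ (take l x) (drop l x))

take-rots : ∀ l o x → l + o ≤ length x → take (l + o) x ≡ take l x ++ take o (rots l x)
take-rots l o x le = trans (take-split l o x) (cong (take l x ++_) (sym (trans (cong (take o) (rots-drop l x (≤-trans (m≤m+n l o) le)))
  (take-++-≤ o (drop l x) (take l x) (≤-trans (+-cancelˡ-≤ l o (length x ∸ l) (≤-trans le (m≤n+m∸n (length x) l))) (≤-reflexive (sym (length-drop l x))))))))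

m<n*suc[m/n] : ∀ m n .⦃ _ : NonZero n ⦄ → m < n * suc (m / n)
m<n*suc[m/n] m n = begin-strict
  m                    ≡⟨ m≡m%n+[m/n]*n m n ⟩
  m % n + m / n * n    <⟨ +-monoˡ-< (m / n * n) (m%n<n m n) ⟩
  n + m / n * n        ≡⟨ cong (n +_) (*-comm (m / n) n) ⟩
  n + n * (m / n)      ≡⟨ sym (*-suc n (m / n)) ⟩
  n * suc (m / n)      ∎
  where open ≤-Reasoning

module Spread (t n : ℕ) (1<t : 1 < t) (0<n : 0 < n) where

  0<t : 0 < t
  0<t = <⇒≤ 1<t

  open Layers t
  open Points t
  open Kernel t n 0<t
  open RandomChain t n 0<t 0<n

  upper lower : ℕ → Bool
  upper a = does (pred t ≤? 2 * a)
  lower a = does (2 * a ≤? pred t)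

  many : (ℕ → Bool) → List ℕ → ℕ
  many p x = ∑ x (⟦_⟧ ∘ p)

  -- Every cyclic window of length `l` has at least `l′` coordinates in the upper half of `[t]` and
  -- as many in the lower half. Starting points run up to `2 * n`, so that consecutive windows can
  -- be joined across the end without reduction modulo `n`.
  Balanced : ℕ → ℕ → List ℕ → Set
  Balanced l l′ y = ∀ ρ → ρ < 2 * n → l′ ≤ many upper (take l (rots ρ y)) × l′ ≤ many lower (take l (rots ρ y))

  many-blocks : ∀ p l l′ y → length y ≡ n → 0 < l → (∀ ρ → ρ < 2 * n → l′ ≤ many p (take l (rots ρ y))) →
    ∀ c i m → c * l ≤ m → m ≤ n → i + c * l ≤ 2 * n → c * l′ ≤ many p (take m (rots i y))
  many-blocks p l l′ y ly 0<l window zero i m _ _ _ = z≤n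
  many-blocks p l l′ y ly 0<l window (suc c) i m cl≤m m≤n i+cl≤ with m≤n⇒∃[o]m+o≡n (≤-trans (m≤m+n l (c * l)) cl≤m)
  ... | o , refl = begin
    l′ + c * l′
      ≤⟨ +-mono-≤ (window i (≤-trans (m<m+n i (≤-trans 0<l (m≤m+n l (c * l)))) i+cl≤))
                  (many-blocks p l l′ y ly 0<l window c (i + l) o (+-cancelˡ-≤ l _ _ cl≤m) (≤-trans (m≤n+m o l) m≤n)
                     (≤-trans (≤-reflexive (+-assoc i l (c * l))) i+cl≤)) ⟩
    many p (take l (rots i y)) + many p (take o (rots (i + l) y))
      ≡⟨ cong (λ z → many p (take l (rots i y)) + many p (take o z)) (rots-+ i l y) ⟩
    many p (take l (rots i y)) + many p (take o (rots l (rots i y)))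
      ≡⟨ sym (∑-++ (take l (rots i y)) _ _) ⟩
    many p (take l (rots i y) ++ take o (rots l (rots i y)))
      ≡⟨ cong (many p) (sym (take-rots l o (rots i y) (≤-trans m≤n (≤-reflexive (sym (trans (length-rots i y) ly)))))) ⟩
    many p (take (l + o) (rots i y)) ∎
    where open ≤-Reasoning

  upper-sum : ∀ x → many upper x * pred t ≤ 2 * sum x
  upper-sum [] = z≤n
  upper-sum (a ∷ x) = begin
    (⟦ upper a ⟧ + many upper x) * pred t            ≡⟨ *-distribʳ-+ (pred t) ⟦ upper a ⟧ _ ⟩
    ⟦ upper a ⟧ * pred t + many upper x * pred t     ≤⟨ +-mono-≤ single (upper-sum x) ⟩
    2 * a + 2 * sum x                                ≡⟨ sym (*-distribˡ-+ 2 a (sum x)) ⟩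
    2 * (a + sum x)                                  ∎
    where
    open ≤-Reasoning
    single : ⟦ upper a ⟧ * pred t ≤ 2 * a
    single with pred t ≤? 2 * a
    ... | yes p = ≤-trans (*-monoˡ-≤ (pred t) (⟦⟧≤1 (upper a))) (≤-trans (≤-reflexive (+-identityʳ _)) p)
    ... | no ¬p rewrite dec-false (pred t ≤? 2 * a) ¬p = z≤n

  lower-sum : ∀ x → All (_< t) x → many lower x * pred t + 2 * sum x ≤ 2 * (length x * pred t)
  lower-sum [] _ = z≤n
  lower-sum (a ∷ x) (a<t ∷ x<t) = begin
    (⟦ lower a ⟧ + many lower x) * pred t + 2 * (a + sum x)                       ≡⟨ r₁ ⟦ lower a ⟧ (many lower x) (pred t) a (sum x) ⟩
    (⟦ lower a ⟧ * pred t + 2 * a) + (many lower x * pred t + 2 * sum x)          ≤⟨ +-mono-≤ single (lower-sum x x<t) ⟩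
    2 * pred t + 2 * (length x * pred t)                                          ≡⟨ sym (*-distribˡ-+ 2 (pred t) _) ⟩
    2 * (pred t + length x * pred t)                                              ∎
    where
    open ≤-Reasoning
    r₁ : ∀ b m p a s → (b + m) * p + 2 * (a + s) ≡ (b * p + 2 * a) + (m * p + 2 * s)
    r₁ = solve-∀
    r₂ : ∀ p → 1 * p + p ≡ 2 * p
    r₂ = solve-∀
    single : ⟦ lower a ⟧ * pred t + 2 * a ≤ 2 * pred t
    single with 2 * a ≤? pred t
    ... | yes p = ≤-trans (+-mono-≤ (*-monoˡ-≤ (pred t) (⟦⟧≤1 (lower a))) p) (≤-reflexive (r₂ (pred t)))
    ... | no ¬p rewrite dec-false (2 * a ≤? pred t) ¬p = *-monoʳ-≤ 2 (pred-mono-≤ a<t)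

  -- Whole blocks of length `8 * l′` have density at least 1/8 and cover at least half of a window
  -- that contains one of them.
  many-balanced : ∀ p l′ y → length y ≡ n → 0 < l′ → (∀ ρ → ρ < 2 * n → l′ ≤ many p (take (8 * l′) (rots ρ y))) →
    ∀ i m → i ≤ n → 8 * l′ ≤ m → m ≤ n → m ≤ 16 * many p (take m (rots i y))
  many-balanced p l′ y ly 0<l′ window i m i≤n l≤m m≤n = begin
    m                                     ≤⟨ <⇒≤ (m<n*suc[m/n] m l ⦃ l≢0 ⦄) ⟩
    l * suc c                             ≡⟨ *-suc l c ⟩
    l + l * c                             ≤⟨ +-monoˡ-≤ (l * c) (≤-trans (≤-reflexive (sym (*-identityʳ l))) (*-monoʳ-≤ l 1≤c)) ⟩
    l * c + l * c                         ≡⟨ r l′ c ⟩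
    16 * (c * l′)                         ≤⟨ *-monoʳ-≤ 16 (many-blocks p l l′ y ly 0<l window c i m cl≤m m≤n
                                               (≤-trans (+-mono-≤ i≤n (≤-trans cl≤m m≤n)) (≤-reflexive (cong (n +_) (sym (+-identityʳ n)))))) ⟩
    16 * many p (take m (rots i y))       ∎
    where
    open ≤-Reasoning
    l : ℕ
    l = 8 * l′
    0<l : 0 < l
    0<l = ≤-trans 0<l′ (m≤m+n l′ _)
    l≢0 : NonZero l
    l≢0 = >-nonZero 0<l
    c : ℕ
    c = _/_ m l ⦃ l≢0 ⦄
    cl≤m : c * l ≤ m
    cl≤m = m/n*n≤m m l ⦃ l≢0 ⦄
    1≤c : 1 ≤ c
    1≤c with c in e
    ... | suc _ = s≤s z≤n
    ... | zero = ⊥-elim (<-irrefl refl (≤-trans (m<n*suc[m/n] m l ⦃ l≢0 ⦄) (≤-trans (≤-reflexive (trans (cong (λ k → l * suc k) e) (*-identityʳ l))) l≤m)))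
    r : ∀ l c → 8 * l * c + 8 * l * c ≡ 16 * (c * l)
    r = solve-∀

  -- If `j` coordinates follow the gaining one in a rotation, the coordinates before it only hold,
  -- and it then gains with probability at most 1, or at most `C / (j + 1)` if the window of `y`
  -- formed by it and its followers has central rank. Balance guarantees the latter for
  -- `j ≥ 8 * l′`.
  spread : ∀ g → 512 ≤ g → ∀ l′ λ′ → 32 ≤ l′ → n ≤ 2 ^ λ′ → ∀ x y → x ∈ lists n → Valid n y → Balanced (8 * l′) l′ y →
    Φ x y ≤ (8 * l′ + suc λ′ * (8 * (2 ^ g) ^ 3)) * D ^ n
  spread g 512≤g l′ λ′ 32≤l′ n≤ x y x∈ (ly , y<t) balanced with Φ x y ≟ 0
  ... | yes e = ≤-trans (≤-reflexive e) z≤n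
  ... | no Φ≢0 with Edge-split (Φ-edge x y (proj₁ (∈lists⇒valid x∈)) Φ≢0)
  ... | p , a , q , refl , refl = begin
    -- Reindexed so that in rotation `suc (length p) + j` the gaining coordinate has exactly `j`
    -- followers.
    ∑< n h                                                           ≡⟨ ∑<-periodic n (suc (length p)) h periodic ⟩
    ∑< n (λ j → h (suc (length p) + j))                              ≤⟨ ∑<-mono n each ⟩
    ∑< n (λ j → ⟦ does (j <? l) ⟧ * Y + late j)                      ≡⟨ trans (∑-+ (downFrom n) _ _) (cong (_+ ∑< n late) (∑-*ʳ (downFrom n) Y _)) ⟩
    ∑< n (λ j → ⟦ does (j <? l) ⟧) * Y + ∑< n late                   ≤⟨ +-mono-≤ (*-monoˡ-≤ Y (∑<-initial n l)) (≤-trans (∑<-≤ late n≤) (harmonic λ′ (C * Y) late late≤)) ⟩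
    l * Y + suc λ′ * (C * Y)                                         ≡⟨ r₁ l Y (suc λ′) C ⟩
    (l + suc λ′ * C) * Y                                             ∎
    where
    open ≤-Reasoning
    r₁ : ∀ l Y s c → l * Y + s * (c * Y) ≡ (l + s * c) * Y
    r₁ = solve-∀
    l C Y τ : ℕ
    l = 8 * l′
    C = 8 * (2 ^ g) ^ 3
    Y = D ^ n
    τ = pred t
    X₀ Y₀ z : List ℕ
    X₀ = p ++ a ∷ q
    Y₀ = p ++ suc a ∷ q
    z = q ++ p
    lx : length X₀ ≡ n
    lx = proj₁ (∈lists⇒valid x∈)
    h : ℕ → ℕ
    h ρ = κ (rots ρ X₀) (rots ρ Y₀)
    rots-n : ∀ w → length w ≡ n → ∀ j → rots (n + j) w ≡ rots j w
    rots-n w lw j = trans (rots-+ n j w) (cong (rots j) (trans (cong (λ i → rots i w) (sym lw)) (rots-length w)))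
    periodic : ∀ j → h (n + j) ≡ h j
    periodic j = cong₂ κ (rots-n X₀ lx j) (rots-n Y₀ ly j)
    lz : suc (length z) ≡ n
    lz = trans (cong suc (trans (length-++ q) (+-comm (length q) (length p)))) (trans (sym (+-suc (length p) (length q))) (trans (sym (length-++ p)) lx))
    z<t : All (_< t) z
    z<t = All.++⁺ (All.tail (All.++⁻ʳ p y<t)) (All.++⁻ˡ p y<t)
    sa<t : suc a < t
    sa<t = All.head (All.++⁻ʳ p y<t)
    a<t : a < t
    a<t = <⇒≤ sa<t
    turned : ∀ b j → j < n → rots (suc (length p) + j) (p ++ b ∷ q) ≡ drop j z ++ b ∷ take j z
    turned b j j<n = trans (cong (λ i → rots i (p ++ b ∷ q)) (sym (+-suc (length p) j)))
      (trans (rots-+ (length p) (suc j) (p ++ b ∷ q)) (trans (cong (rots (suc j)) (rots-++ p (b ∷ q)))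
      (trans (cong (λ w → rots j (w ++ [ b ])) (sym (take++drop≡id j z)))
      (trans (cong (rots j) (++-assoc (take j z) (drop j z) [ b ]))
      (trans (cong (λ i → rots i (take j z ++ (drop j z ++ [ b ]))) (sym (trans (length-take j z) (m≤n⇒m⊓n≡m (≤-pred (≤-trans j<n (≤-reflexive (sym lz))))))))
      (trans (rots-++ (take j z) (drop j z ++ [ b ])) (++-assoc (drop j z) [ b ] (take j z))))))))
    prefix : ∀ u v w → length (u ++ v) ≤ n → All (_< t) u → κ (u ++ v) (u ++ w) ≤ D ^ length u * κ v w
    prefix [] v w _ _ = ≤-reflexive (sym (+-identityʳ _))
    prefix (c ∷ u) v w len (c<t ∷ u<t) = begin
      κ (c ∷ u ++ v) (c ∷ u ++ w)      ≤⟨ κ-hold c (u ++ v) (u ++ w) len refl c<t ⟩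
      D * κ (u ++ v) (u ++ w)          ≤⟨ *-monoʳ-≤ D (prefix u v w (<⇒≤ len) u<t) ⟩
      D * (D ^ length u * κ v w)       ≡⟨ sym (*-assoc D _ _) ⟩
      D ^ suc (length u) * κ v w       ∎
    ltake : ∀ {j} → j < n → length (take j z) ≡ j
    ltake {j} j<n = trans (length-take j z) (m≤n⇒m⊓n≡m (≤-pred (≤-trans j<n (≤-reflexive (sym lz)))))
    sizes : ∀ j → j < n → length (drop j z) + suc j ≡ n
    sizes j j<n = trans (cong (_+ suc j) (length-drop j z)) (trans (+-suc (length z ∸ j) j) (trans (cong suc (m∸n+n≡m (≤-pred (≤-trans j<n (≤-reflexive (sym lz)))))) lz))
    step : ∀ j → j < n → h (suc (length p) + j) ≤ D ^ length (drop j z) * κ (a ∷ take j z) (suc a ∷ take j z)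
    step j j<n = ≤-trans (≤-reflexive (cong₂ κ (turned a j j<n) (turned (suc a) j j<n)))
      (prefix (drop j z) (a ∷ take j z) (suc a ∷ take j z)
        (≤-reflexive (trans (length-++ (drop j z)) (trans (cong (λ i → length (drop j z) + suc i) (ltake j<n)) (sizes j j<n))))
        (All.drop⁺ j z<t))
    D^-split : ∀ j → j < n → D ^ length (drop j z) * D ^ suc (length (take j z)) ≡ Y
    D^-split j j<n = trans (sym (^-distribˡ-+-* D (length (drop j z)) (suc (length (take j z)))))
      (cong (D ^_) (trans (cong (λ i → length (drop j z) + suc i) (ltake j<n)) (sizes j j<n)))
    len≤ : ∀ {j} → j < n → suc (length (take j z)) ≤ n
    len≤ j<n = ≤-trans (≤-reflexive (cong suc (ltake j<n))) j<n
    trivial : ∀ j → j < n → h (suc (length p) + j) ≤ Y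
    trivial j j<n = ≤-trans (step j j<n) (≤-trans (*-monoʳ-≤ (D ^ length (drop j z)) (κ-move≤ a (take j z) (len≤ j<n) a<t)) (≤-reflexive (D^-split j j<n)))
    central : ∀ j → j < n → l ≤ j → suc j * h (suc (length p) + j) ≤ C * Y
    central j j<n l≤j = begin
      m * h (suc (length p) + j)
        ≤⟨ *-monoʳ-≤ m (step j j<n) ⟩
      m * (D ^ length (drop j z) * κ (a ∷ take j z) (suc a ∷ take j z))
        ≡⟨ r₂ m (D ^ length (drop j z)) _ ⟩
      D ^ length (drop j z) * (m * κ (a ∷ take j z) (suc a ∷ take j z))
        ≡⟨ cong (λ i → D ^ length (drop j z) * (suc i * κ (a ∷ take j z) (suc a ∷ take j z))) (sym (ltake j<n)) ⟩
      D ^ length (drop j z) * (suc (length (take j z)) * κ (a ∷ take j z) (suc a ∷ take j z))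
        ≤⟨ *-monoʳ-≤ (D ^ length (drop j z)) (κ-move-central a (take j z) g b (len≤ j<n) a<t (subst (_< g * b) (sym (ltake j<n)) j<gb) lo hi) ⟩
      D ^ length (drop j z) * (C * D ^ suc (length (take j z)))
        ≡⟨ r₂ (D ^ length (drop j z)) C _ ⟩
      C * (D ^ length (drop j z) * D ^ suc (length (take j z)))
        ≡⟨ cong (C *_) (D^-split j j<n) ⟩
      C * Y ∎
      where
      r₂ : ∀ a b c → a * (b * c) ≡ b * (a * c)
      r₂ = solve-∀
      m b s : ℕ
      m = suc j
      -- Large enough for `j < g * b`, as `g` is at least 512, and small enough that
      -- `2 * (b * t) + t` is at most a 32nd of the largest rank `m * τ`; balance keeps the window
      -- that far from both ends.
      b = m / 256
      s = suc (a + sum (take j z))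
      256≤m : 256 ≤ m
      256≤m = ≤-trans (*-monoʳ-≤ 8 32≤l′) (≤-trans l≤j (n≤1+n j))
      256b≤m : 256 * b ≤ m
      256b≤m = ≤-trans (≤-reflexive (*-comm 256 b)) (m/n*n≤m m 256)
      1≤b : 1 ≤ b
      1≤b = /-monoˡ-≤ 256 256≤m
      j<gb : j < g * b
      j<gb = ≤-trans (<⇒≤ (m<n*suc[m/n] m 256)) (≤-trans (≤-trans (≤-reflexive (*-suc 256 b)) (≤-trans (+-monoˡ-≤ (256 * b) (*-monoʳ-≤ 256 1≤b)) (≤-reflexive (r₃ b)))) (*-monoˡ-≤ b 512≤g))
        where
        r₃ : ∀ b → 256 * b + 256 * b ≡ 512 * b
        r₃ = solve-∀
      window : take m (rots (length p) Y₀) ≡ suc a ∷ take j z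
      window = trans (cong (take m) (rots-++ p (suc a ∷ q))) refl
      |p|≤n : length p ≤ n
      |p|≤n = ≤-trans (m≤m+n (length p) _) (≤-reflexive (trans (sym (length-++ p)) lx))
      0<l′ : 0 < l′
      0<l′ = ≤-trans (s≤s z≤n) 32≤l′
      enough : ∀ f → (∀ ρ → ρ < 2 * n → l′ ≤ many f (take (8 * l′) (rots ρ Y₀))) → m ≤ 16 * many f (suc a ∷ take j z)
      enough f w = subst (λ v → m ≤ 16 * many f v) window
        (many-balanced f l′ Y₀ ly 0<l′ w (length p) m |p|≤n (≤-trans l≤j (n≤1+n j)) j<n)
      ups lows : ℕ
      ups = many upper (suc a ∷ take j z)
      lows = many lower (suc a ∷ take j z)
      t≤2τ : t ≤ 2 * τ
      t≤2τ = go t 1<t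
        where
        go : ∀ t → 1 < t → t ≤ 2 * pred t
        go (suc zero) (s≤s ())
        go (suc (suc t)) _ = s≤s (≤-trans (≤-reflexive (sym (+-identityʳ (suc t)))) (m≤n+m (suc t + 0) t))
      mτ≤32s : m * τ ≤ 32 * s
      mτ≤32s = begin
        m * τ              ≤⟨ *-monoˡ-≤ τ (enough upper (λ ρ ρ< → proj₁ (balanced ρ ρ<))) ⟩
        16 * ups * τ       ≡⟨ *-assoc 16 ups τ ⟩
        16 * (ups * τ)     ≤⟨ *-monoʳ-≤ 16 (upper-sum (suc a ∷ take j z)) ⟩
        16 * (2 * s)       ≡⟨ sym (*-assoc 16 2 s) ⟩
        32 * s             ∎
      mτ+32s≤ : m * τ + 32 * s ≤ 32 * (m * τ)
      mτ+32s≤ = begin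
        m * τ + 32 * s                    ≤⟨ +-monoˡ-≤ (32 * s) (*-monoˡ-≤ τ (enough lower (λ ρ ρ< → proj₂ (balanced ρ ρ<)))) ⟩
        16 * lows * τ + 32 * s            ≡⟨ r₄ lows τ s ⟩
        16 * (lows * τ + 2 * s)           ≤⟨ *-monoʳ-≤ 16 (lower-sum (suc a ∷ take j z) (sa<t ∷ All.take⁺ j z<t)) ⟩
        16 * (2 * (suc (length (take j z)) * τ)) ≡⟨ cong (λ i → 16 * (2 * (suc i * τ))) (ltake j<n) ⟩
        16 * (2 * (m * τ))                ≡⟨ sym (*-assoc 16 2 (m * τ)) ⟩
        32 * (m * τ)                      ∎
        where
        r₄ : ∀ l p s → 16 * l * p + 32 * s ≡ 16 * (l * p + 2 * s)
        r₄ = solve-∀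
      -- 2 b t + t ≤ (4 b + 2) τ, and 32 (4 b + 2) ≤ 256 b ≤ m.
      slack : 32 * (2 * (b * t) + t) ≤ m * τ
      slack = begin
        32 * (2 * (b * t) + t)                    ≤⟨ *-monoʳ-≤ 32 (+-mono-≤ (*-monoʳ-≤ 2 (*-monoʳ-≤ b t≤2τ)) t≤2τ) ⟩
        32 * (2 * (b * (2 * τ)) + 2 * τ)          ≡⟨ r₅ b τ ⟩
        (128 * b + 64) * τ                        ≤⟨ *-monoˡ-≤ τ (≤-trans (+-monoʳ-≤ (128 * b) (≤-trans (*-monoʳ-≤ 64 1≤b) (*-monoˡ-≤ b (m≤m+n 64 64)))) (≤-trans (≤-reflexive (r₆ b)) 256b≤m)) ⟩
        m * τ                                     ∎
        where
        r₅ : ∀ b p → 32 * (2 * (b * (2 * p)) + 2 * p) ≡ (128 * b + 64) * p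
        r₅ = solve-∀
        r₆ : ∀ b → 128 * b + 128 * b ≡ 256 * b
        r₆ = solve-∀
      lo : 2 * (b * t) + t ≤ s
      lo = *-cancelˡ-≤ 32 (≤-trans slack mτ≤32s)
      hi : s + 2 * (b * t) ≤ length (take j z) * τ
      hi = subst (λ i → s + 2 * (b * t) ≤ i * τ) (sym (ltake j<n)) (+-cancelʳ-≤ τ _ _ (*-cancelˡ-≤ 32 (begin
        32 * (s + 2 * (b * t) + τ)           ≡⟨ r₇ s (2 * (b * t)) τ ⟩
        32 * (2 * (b * t) + τ) + 32 * s      ≤⟨ +-monoˡ-≤ (32 * s) (≤-trans (*-monoʳ-≤ 32 (+-monoʳ-≤ (2 * (b * t)) (pred[n]≤n {t}))) slack) ⟩
        m * τ + 32 * s                       ≤⟨ mτ+32s≤ ⟩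
        32 * (τ + j * τ)                     ≡⟨ cong (32 *_) (+-comm τ (j * τ)) ⟩
        32 * (j * τ + τ)                     ∎)))
        where
        r₇ : ∀ s x p → 32 * (s + x + p) ≡ 32 * (x + p) + 32 * s
        r₇ = solve-∀
    -- Cut off outside `l ≤ j < n`, so that `harmonic` can be applied to all `2 ^ λ′` indices.
    late : ℕ → ℕ
    late j = ⟦ does (l ≤? j) ∧ does (j <? n) ⟧ * h (suc (length p) + j)
    late≤ : ∀ j → suc j * late j ≤ C * Y
    late≤ j with l ≤? j | j <? n
    ... | yes l≤j | yes j<n rewrite dec-true (l ≤? j) l≤j | dec-true (j <? n) j<n =
      ≤-trans (≤-reflexive (cong (suc j *_) (+-identityʳ (h (suc (length p) + j))))) (central j j<n l≤j)
    ... | no l≰j | _ rewrite dec-false (l ≤? j) l≰j = ≤-trans (≤-reflexive (*-zeroʳ j)) z≤n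
    ... | yes l≤j | no j≮n rewrite dec-true (l ≤? j) l≤j | dec-false (j <? n) j≮n = ≤-trans (≤-reflexive (*-zeroʳ j)) z≤n
    each : ∀ j → j < n → h (suc (length p) + j) ≤ ⟦ does (j <? l) ⟧ * Y + late j
    each j j<n with j <? l
    ... | yes j<l rewrite dec-true (j <? l) j<l = ≤-trans (trivial j j<n) (≤-trans (≤-reflexive (sym (+-identityʳ Y))) (m≤m+n _ (late j)))
    ... | no j≮l rewrite dec-true (l ≤? j) (≮⇒≥ j≮l) | dec-true (j <? n) j<n =
      ≤-trans (≤-reflexive (sym (+-identityʳ _))) (m≤n+m _ (⟦ does (j <? l) ⟧ * Y))

-- Containers of antichains in a family of planes

fil-fil : ∀ {V : Set} (p q : V → Bool) xs → fil p (fil q xs) ≡ fil (λ x → q x ∧ p x) xs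
fil-fil p q [] = refl
fil-fil p q (x ∷ xs) with q x
... | true = cong (keep (p x) x) (fil-fil p q xs)
... | false = fil-fil p q xs

fil-none : ∀ {V : Set} (p : V → Bool) xs → (∀ x → x ∈ xs → p x ≡ false) → length (fil p xs) ≡ 0
fil-none p xs h = trans (length-fil p xs) (∑-zero-∈ xs (λ x x∈ → cong ⟦_⟧ (h x x∈)))

∧-true : ∀ {a b} → a ∧ b ≡ true → a ≡ true × b ≡ true
∧-true {true} e = refl , e

true-∧ : ∀ {a b} → a ≡ true → b ≡ true → a ∧ b ≡ true
true-∧ refl refl = refl

does-true : ∀ {P : Set} (d : Dec P) → does d ≡ true → P
does-true (yes p) _ = p

not-true : ∀ {b} → not b ≡ true → b ≡ false
not-true {false} _ = refl

≡ᵇ-true : ∀ i j → (i ≡ᵇ j) ≡ true → i ≡ j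
≡ᵇ-true i j = does-true (i ≟ j)

-- An antichain inside one plane, cut into blocks, is contained in the blocks met by a monotone path
-- from the top left to the bottom right: from the block (i , r) the path goes right if the antichain
-- misses the blocks below (i , r), and otherwise goes down, as then it misses the blocks to the right.
module Planes {V Key : Set} (inc : V → V → Bool) (cls : Key → V → Bool) (col row : V → ℕ) (last B : ℕ)
  (Ok : List V → Set) (Ok-fil : ∀ p xs → Ok xs → Ok (fil p xs))
  (col≤ : ∀ xs x → Ok xs → x ∈ xs → col x ≤ last) (row≤ : ∀ xs x → Ok xs → x ∈ xs → row x ≤ last)
  (comparable : ∀ κ xs x y → Ok xs → x ∈ xs → y ∈ xs → cls κ x ≡ true → cls κ y ≡ true →
                col x < col y → row x < row y → inc x y ≡ false × inc y x ≡ false)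
  (cell : ∀ κ i j xs → Ok xs → length (fil (λ x → cls κ x ∧ ((col x ≡ᵇ i) ∧ (row x ≡ᵇ j))) xs) ≤ B)
  where

  open Antichains inc

  private
    column : ∀ κ i r xs → Ok xs → length (fil (λ x → cls κ x ∧ ((col x ≡ᵇ i) ∧ does (row x ≤? r))) xs) ≤ suc r * B
    column κ i zero xs ok = ≤-trans (length-fil-∨ _ (λ x → cls κ x ∧ ((col x ≡ᵇ i) ∧ (row x ≡ᵇ 0))) (λ _ → false) xs imp)
      (+-mono-≤ (cell κ i 0 xs ok) (≤-reflexive (fil-none (λ _ → false) xs (λ _ _ → refl))))
      where
      imp : ∀ x → x ∈ xs → cls κ x ∧ ((col x ≡ᵇ i) ∧ does (row x ≤? 0)) ≡ true →
            cls κ x ∧ ((col x ≡ᵇ i) ∧ (row x ≡ᵇ 0)) ≡ true ⊎ false ≡ true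
      imp x _ e with ∧-true {cls κ x} e
      ... | e₁ , e₂ with ∧-true {col x ≡ᵇ i} e₂
      ... | e₃ , e₄ = inj₁ (true-∧ e₁ (true-∧ e₃ (dec-true (row x ≟ 0) (n≤0⇒n≡0 (does-true (row x ≤? 0) e₄)))))
    column κ i (suc r) xs ok = ≤-trans (length-fil-∨ _ (λ x → cls κ x ∧ ((col x ≡ᵇ i) ∧ (row x ≡ᵇ suc r)))
      (λ x → cls κ x ∧ ((col x ≡ᵇ i) ∧ does (row x ≤? r))) xs imp) (+-mono-≤ (cell κ i (suc r) xs ok) (column κ i r xs ok))
      where
      imp : ∀ x → x ∈ xs → cls κ x ∧ ((col x ≡ᵇ i) ∧ does (row x ≤? suc r)) ≡ true →
            cls κ x ∧ ((col x ≡ᵇ i) ∧ (row x ≡ᵇ suc r)) ≡ true ⊎ cls κ x ∧ ((col x ≡ᵇ i) ∧ does (row x ≤? r)) ≡ true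
      imp x _ e with ∧-true {cls κ x} e
      ... | e₁ , e₂ with ∧-true {col x ≡ᵇ i} e₂
      ... | e₃ , e₄ with m≤n⇒m<n∨m≡n (does-true (row x ≤? suc r) e₄)
      ... | inj₁ lt = inj₂ (true-∧ e₁ (true-∧ e₃ (dec-true (row x ≤? r) (≤-pred lt))))
      ... | inj₂ eq = inj₁ (true-∧ e₁ (true-∧ e₃ (dec-true (row x ≟ suc r) eq)))

    bottom-row : ∀ κ i c xs → Ok xs → length (fil (λ x → cls κ x ∧ ((does (i ≤? col x) ∧ does (col x ≤? i + c)) ∧ (row x ≡ᵇ 0))) xs) ≤ suc c * B
    bottom-row κ i zero xs ok = ≤-trans (length-fil-∨ _ (λ x → cls κ x ∧ ((col x ≡ᵇ i) ∧ (row x ≡ᵇ 0))) (λ _ → false) xs imp)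
      (+-mono-≤ (cell κ i 0 xs ok) (≤-reflexive (fil-none (λ _ → false) xs (λ _ _ → refl))))
      where
      imp : ∀ x → x ∈ xs → cls κ x ∧ ((does (i ≤? col x) ∧ does (col x ≤? i + 0)) ∧ (row x ≡ᵇ 0)) ≡ true →
            cls κ x ∧ ((col x ≡ᵇ i) ∧ (row x ≡ᵇ 0)) ≡ true ⊎ false ≡ true
      imp x _ e with ∧-true {cls κ x} e
      ... | e₁ , e₂ with ∧-true {does (i ≤? col x) ∧ does (col x ≤? i + 0)} e₂
      ... | e₃ , e₄ with ∧-true {does (i ≤? col x)} e₃
      ... | e₅ , e₆ = inj₁ (true-∧ e₁ (true-∧ (dec-true (col x ≟ i)
            (≤-antisym (≤-trans (does-true (col x ≤? i + 0) e₆) (≤-reflexive (+-identityʳ i))) (does-true (i ≤? col x) e₅))) e₄))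
    bottom-row κ i (suc c) xs ok = ≤-trans (length-fil-∨ _ (λ x → cls κ x ∧ ((col x ≡ᵇ i + suc c) ∧ (row x ≡ᵇ 0)))
      (λ x → cls κ x ∧ ((does (i ≤? col x) ∧ does (col x ≤? i + c)) ∧ (row x ≡ᵇ 0))) xs imp) (+-mono-≤ (cell κ (i + suc c) 0 xs ok) (bottom-row κ i c xs ok))
      where
      imp : ∀ x → x ∈ xs → cls κ x ∧ ((does (i ≤? col x) ∧ does (col x ≤? i + suc c)) ∧ (row x ≡ᵇ 0)) ≡ true →
            cls κ x ∧ ((col x ≡ᵇ i + suc c) ∧ (row x ≡ᵇ 0)) ≡ true ⊎ cls κ x ∧ ((does (i ≤? col x) ∧ does (col x ≤? i + c)) ∧ (row x ≡ᵇ 0)) ≡ true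
      imp x _ e with ∧-true {cls κ x} e
      ... | e₁ , e₂ with ∧-true {does (i ≤? col x) ∧ does (col x ≤? i + suc c)} e₂
      ... | e₃ , e₄ with ∧-true {does (i ≤? col x)} e₃
      ... | e₅ , e₆ with m≤n⇒m<n∨m≡n (does-true (col x ≤? i + suc c) e₆)
      ... | inj₁ lt = inj₂ (true-∧ e₁ (true-∧ (true-∧ e₅ (dec-true (col x ≤? i + c) (≤-pred (≤-trans lt (≤-reflexive (+-suc i c)))))) e₄))
      ... | inj₂ eq = inj₁ (true-∧ e₁ (true-∧ (dec-true (col x ≟ i + suc c) eq) e₄))

    active : ℕ → ℕ → V → Bool
    active i r x = does (i ≤? col x) ∧ does (row x ≤? r)

    done : Key → ℕ → ℕ → V → Bool
    done κ i r x = cls κ x ∧ not (active i r x)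

    whole : ∀ {P : List V → Set} xs → P (fil (λ _ → true) xs) → P xs
    whole {P} xs = subst P (fil-id (λ _ → true) xs (λ _ _ → refl))

    -- The path still has `c` columns and `r` rows to go, and `u` bounds the number of points in
    -- blocks already left behind. Each step is one binary choice by `cnt-split` and leaves one
    -- block behind. `leaf` is a continuation: it receives the thinned list at the end of each path.
    follow : ∀ κ c r i u xs X → i + c ≡ last → Ok xs → length (fil (done κ i r) xs) ≤ u →
      (∀ p → length (fil (cls κ) (fil p xs)) ≤ u + (c + r + 1) * B → cnt (fil p xs) ≤ X) →
      cnt xs ≤ 2 ^ (c + r) * X
    follow κ zero r i u xs X i≡ ok done≤ leaf =
      ≤-trans (whole {λ ys → cnt ys ≤ X} xs (leaf (λ _ → true) (subst (λ ys → length (fil (cls κ) ys) ≤ u + (r + 1) * B)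
        (sym (fil-id (λ _ → true) xs (λ _ _ → refl))) small)))
        (≤-trans (≤-reflexive (sym (+-identityʳ X))) (*-monoˡ-≤ X (m^n>0 2 r)))
      where
      imp : ∀ x → x ∈ xs → cls κ x ≡ true → done κ i r x ≡ true ⊎ cls κ x ∧ ((col x ≡ᵇ i) ∧ does (row x ≤? r)) ≡ true
      imp x x∈ e with active i r x in a
      ... | false = inj₁ (true-∧ e refl)
      ... | true with ∧-true {does (i ≤? col x)} a
      ... | e₁ , e₂ = inj₂ (true-∧ e (true-∧ (dec-true (col x ≟ i) (≤-antisym
              (≤-trans (col≤ xs x ok x∈) (≤-reflexive (trans (sym i≡) (+-identityʳ i)))) (does-true (i ≤? col x) e₁))) e₂))
      small : length (fil (cls κ) xs) ≤ u + (r + 1) * B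
      small = ≤-trans (length-fil-∨ (cls κ) (done κ i r) _ xs imp) (+-mono-≤ done≤ (≤-trans (column κ i r xs ok) (≤-reflexive (cong (_* B) (+-comm 1 r)))))
    follow κ (suc c) zero i u xs X i≡ ok done≤ leaf =
      ≤-trans (whole {λ ys → cnt ys ≤ X} xs (leaf (λ _ → true) (subst (λ ys → length (fil (cls κ) ys) ≤ u + (suc c + 0 + 1) * B)
        (sym (fil-id (λ _ → true) xs (λ _ _ → refl))) small)))
        (≤-trans (≤-reflexive (sym (+-identityʳ X))) (*-monoˡ-≤ X (m^n>0 2 (suc c + 0))))
      where
      imp : ∀ x → x ∈ xs → cls κ x ≡ true → done κ i 0 x ≡ true ⊎
            cls κ x ∧ ((does (i ≤? col x) ∧ does (col x ≤? i + suc c)) ∧ (row x ≡ᵇ 0)) ≡ true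
      imp x x∈ e with active i 0 x in a
      ... | false = inj₁ (true-∧ e refl)
      ... | true with ∧-true {does (i ≤? col x)} a
      ... | e₁ , e₂ = inj₂ (true-∧ e (true-∧ (true-∧ e₁ (dec-true (col x ≤? i + suc c) (≤-trans (col≤ xs x ok x∈) (≤-reflexive (sym i≡)))))
              (dec-true (row x ≟ 0) (n≤0⇒n≡0 (does-true (row x ≤? 0) e₂)))))
      small : length (fil (cls κ) xs) ≤ u + (suc c + 0 + 1) * B
      small = ≤-trans (length-fil-∨ (cls κ) (done κ i 0) _ xs imp) (+-mono-≤ done≤ (≤-trans (bottom-row κ i (suc c) xs ok)
        (≤-reflexive (cong (_* B) (trans (+-comm 1 (suc c)) (cong (_+ 1) (sym (+-identityʳ (suc c)))))))))
    follow κ (suc c) (suc r) i u xs X i≡ ok done≤ leaf = begin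
      cnt xs                                            ≤⟨ cnt-split S₁ S₂ xs disjoint cross ⟩
      cnt xs₁ + cnt xs₂                                 ≤⟨ +-mono-≤ right down ⟩
      2 ^ (c + suc r) * X + 2 ^ (suc c + r) * X         ≡⟨ cong (λ k → 2 ^ (c + suc r) * X + 2 ^ k * X) (sym (+-suc c r)) ⟩
      2 ^ (c + suc r) * X + 2 ^ (c + suc r) * X         ≡⟨ r₀ (2 ^ (c + suc r)) X ⟩
      2 ^ (suc c + suc r) * X                           ∎
      where
      open ≤-Reasoning
      r₀ : ∀ a x → a * x + a * x ≡ 2 * a * x
      r₀ = solve-∀
      r₁ : ∀ u b c r → u + b + (c + suc r + 1) * b ≡ u + (suc c + suc r + 1) * b
      r₁ = solve-∀
      r₂ : ∀ u b c r → u + b + (suc c + r + 1) * b ≡ u + (suc c + suc r + 1) * b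
      r₂ = solve-∀
      -- Blocks below `(i , suc r)` and blocks to its right: the former are strictly smaller in both
      -- indices, hence comparable to the latter.
      S₁ S₂ : V → Bool
      S₁ x = cls κ x ∧ ((col x ≡ᵇ i) ∧ does (row x <? suc r))
      S₂ x = cls κ x ∧ (does (i <? col x) ∧ (row x ≡ᵇ suc r))
      xs₁ xs₂ : List V
      xs₁ = fil (not ∘ S₁) xs
      xs₂ = fil (not ∘ S₂) xs
      disjoint : ∀ x → S₁ x ≡ true → S₂ x ≡ false
      disjoint x e with S₂ x in e′
      ... | false = refl
      ... | true = ⊥-elim (<-irrefl (sym (≡ᵇ-true (col x) i (proj₁ (∧-true {col x ≡ᵇ i} (proj₂ (∧-true {cls κ x} e))))))
                     (does-true (i <? col x) (proj₁ (∧-true {does (i <? col x)} (proj₂ (∧-true {cls κ x} e′))))))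
      cross : ∀ x y → x ∈ xs → y ∈ xs → S₁ x ≡ true → S₂ y ≡ true → inc x y ≡ false × inc y x ≡ false
      cross x y x∈ y∈ e e′ with ∧-true {cls κ x} e | ∧-true {cls κ y} e′
      ... | kx , e₁ | ky , e₁′ with ∧-true {col x ≡ᵇ i} e₁ | ∧-true {does (i <? col y)} e₁′
      ... | cx , rx | cy , ry = comparable κ xs x y ok x∈ y∈ kx ky
            (≤-trans (s≤s (≤-reflexive (≡ᵇ-true (col x) i cx))) (does-true (i <? col y) cy))
            (≤-trans (does-true (row x <? suc r) rx) (≤-reflexive (sym (≡ᵇ-true (row y) (suc r) ry))))
      done₁ : ∀ x → x ∈ xs₁ → done κ (suc i) (suc r) x ≡ true →
              done κ i (suc r) x ≡ true ⊎ cls κ x ∧ ((col x ≡ᵇ i) ∧ (row x ≡ᵇ suc r)) ≡ true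
      done₁ x x∈ e with ∧-true {cls κ x} e
      ... | k , na with active i (suc r) x in a
      ... | false = inj₁ (true-∧ k refl)
      ... | true with ∧-true {does (i ≤? col x)} a
      ... | e₁ , e₂ = inj₂ (true-∧ k (true-∧ (dec-true (col x ≟ i) col≡) (dec-true (row x ≟ suc r) row≡)))
        where
        col≡ : col x ≡ i
        col≡ with m≤n⇒m<n∨m≡n (does-true (i ≤? col x) e₁)
        ... | inj₂ eq = sym eq
        ... | inj₁ lt with () ← trans (sym (not-true na)) (true-∧ (dec-true (suc i ≤? col x) lt) e₂)
        row≡ : row x ≡ suc r
        row≡ with m≤n⇒m<n∨m≡n (does-true (row x ≤? suc r) e₂)
        ... | inj₂ eq = eq
        ... | inj₁ lt with () ← trans (sym (not-true (proj₂ (∈-fil⁻ (not ∘ S₁) xs x∈)))) (true-∧ k (true-∧ (dec-true (col x ≟ i) col≡) (dec-true (row x <? suc r) lt)))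
      done₂ : ∀ x → x ∈ xs₂ → done κ i r x ≡ true →
              done κ i (suc r) x ≡ true ⊎ cls κ x ∧ ((col x ≡ᵇ i) ∧ (row x ≡ᵇ suc r)) ≡ true
      done₂ x x∈ e with ∧-true {cls κ x} e
      ... | k , na with active i (suc r) x in a
      ... | false = inj₁ (true-∧ k refl)
      ... | true with ∧-true {does (i ≤? col x)} a
      ... | e₁ , e₂ = inj₂ (true-∧ k (true-∧ (dec-true (col x ≟ i) col≡) (dec-true (row x ≟ suc r) row≡)))
        where
        row≡ : row x ≡ suc r
        row≡ with m≤n⇒m<n∨m≡n (does-true (row x ≤? suc r) e₂)
        ... | inj₂ eq = eq
        ... | inj₁ lt with () ← trans (sym (not-true na)) (true-∧ e₁ (dec-true (row x ≤? r) (≤-pred lt)))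
        col≡ : col x ≡ i
        col≡ with m≤n⇒m<n∨m≡n (does-true (i ≤? col x) e₁)
        ... | inj₂ eq = sym eq
        ... | inj₁ lt with () ← trans (sym (not-true (proj₂ (∈-fil⁻ (not ∘ S₂) xs x∈)))) (true-∧ k (true-∧ (dec-true (i <? col x) lt) (dec-true (row x ≟ suc r) row≡)))
      kept : ∀ S → length (fil (done κ i (suc r)) (fil S xs)) ≤ u
      kept S = ≤-trans (≤-reflexive (cong length (fil-comm (done κ i (suc r)) S xs))) (≤-trans (length-fil-≤ S (fil (done κ i (suc r)) xs)) done≤)
      leaf′ : ∀ S b → b ≡ u + (suc c + suc r + 1) * B → ∀ p → length (fil (cls κ) (fil p (fil S xs))) ≤ b → cnt (fil p (fil S xs)) ≤ X
      leaf′ S b e p len = subst (λ ys → cnt ys ≤ X) (sym (fil-fil p S xs))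
        (leaf (λ x → S x ∧ p x) (subst (λ ys → length (fil (cls κ) ys) ≤ u + (suc c + suc r + 1) * B) (fil-fil p S xs) (≤-trans len (≤-reflexive e))))
      right : cnt xs₁ ≤ 2 ^ (c + suc r) * X
      right = follow κ c (suc r) (suc i) (u + B) xs₁ X (trans (sym (+-suc i c)) i≡) (Ok-fil (not ∘ S₁) xs ok)
        (≤-trans (length-fil-∨ (done κ (suc i) (suc r)) (done κ i (suc r)) _ xs₁ done₁) (+-mono-≤ (kept (not ∘ S₁)) (cell κ i (suc r) xs₁ (Ok-fil (not ∘ S₁) xs ok))))
        (leaf′ (not ∘ S₁) (u + B + (c + suc r + 1) * B) (r₁ u B c r))
      down : cnt xs₂ ≤ 2 ^ (suc c + r) * X
      down = follow κ (suc c) r i (u + B) xs₂ X i≡ (Ok-fil (not ∘ S₂) xs ok)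
        (≤-trans (length-fil-∨ (done κ i r) (done κ i (suc r)) _ xs₂ done₂) (+-mono-≤ (kept (not ∘ S₂)) (cell κ i (suc r) xs₂ (Ok-fil (not ∘ S₂) xs ok))))
        (leaf′ (not ∘ S₂) (u + B + (suc c + r + 1) * B) (r₂ u B c r))

    thin : ℕ
    thin = (last + last + 1) * B

    -- Classes are thinned one after another; restricting the list for a later class can only shrink
    -- the earlier ones.
    all-classes : ∀ ks xs X → Ok xs →
      (∀ p → (∀ κ → κ ∈ ks → length (fil (cls κ) (fil p xs)) ≤ thin) → cnt (fil p xs) ≤ X) →
      cnt xs ≤ 2 ^ (length ks * (last + last)) * X
    all-classes [] xs X ok leaf = ≤-trans (whole {λ ys → cnt ys ≤ X} xs (leaf (λ _ → true) (λ _ ()))) (≤-reflexive (sym (+-identityʳ X)))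
    all-classes (k ∷ ks) xs X ok leaf = ≤-trans
      (follow k last last 0 0 xs (2 ^ (length ks * (last + last)) * X) refl ok
        (≤-reflexive (fil-none (done k 0 last) xs nothing-done)) rest)
      (≤-reflexive (trans (sym (*-assoc (2 ^ (last + last)) (2 ^ (length ks * (last + last))) X))
        (cong (_* X) (sym (^-distribˡ-+-* 2 (last + last) (length ks * (last + last)))))))
      where
      nothing-done : ∀ x → x ∈ xs → done k 0 last x ≡ false
      nothing-done x x∈ rewrite dec-true (row x ≤? last) (row≤ xs x ok x∈) = ∧-false (cls k x)
        where
        ∧-false : ∀ b → b ∧ false ≡ false
        ∧-false true = refl
        ∧-false false = refl
      rest : ∀ p → length (fil (cls k) (fil p xs)) ≤ thin → cnt (fil p xs) ≤ 2 ^ (length ks * (last + last)) * X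
      rest p len = all-classes ks (fil p xs) X (Ok-fil p xs ok) (λ p′ small →
        subst (λ ys → cnt ys ≤ X) (sym (fil-fil p′ p xs)) (leaf (λ x → p x ∧ p′ x) (λ κ κ∈ →
          subst (λ ys → length (fil (cls κ) ys) ≤ thin) (fil-fil p′ p xs) (at κ κ∈ p′ small))))
        where
        at : ∀ κ → κ ∈ k ∷ ks → ∀ p′ → (∀ κ → κ ∈ ks → length (fil (cls κ) (fil p′ (fil p xs))) ≤ thin) → length (fil (cls κ) (fil p′ (fil p xs))) ≤ thin
        at κ (here refl) p′ small = ≤-trans (≤-reflexive (cong length (fil-comm (cls κ) p′ (fil p xs)))) (≤-trans (length-fil-≤ p′ (fil (cls κ) (fil p xs))) len)
        at κ (there κ∈) p′ small = small κ κ∈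

  cnt-planes : ∀ ks xs X → Ok xs → (∀ x → x ∈ xs → Σ Key (λ κ → κ ∈ ks × cls κ x ≡ true)) →
    (∀ p → length (fil p xs) ≤ length ks * ((last + last + 1) * B) → cnt (fil p xs) ≤ X) →
    cnt xs ≤ 2 ^ (length ks * (last + last)) * X
  cnt-planes ks xs X ok covered leaf = all-classes ks xs X ok (λ p small → leaf p (bound p small))
    where
    open ≤-Reasoning
    bound : ∀ p → (∀ κ → κ ∈ ks → length (fil (cls κ) (fil p xs)) ≤ thin) → length (fil p xs) ≤ length ks * thin
    bound p small = begin
      length (fil p xs)                                  ≡⟨ length-∑ (fil p xs) ⟩
      ∑ (fil p xs) (λ _ → 1)                             ≤⟨ ∑-mono-∈ (fil p xs) in-some ⟩
      ∑ (fil p xs) (λ x → ∑ ks (λ κ → ⟦ cls κ x ⟧))      ≡⟨ ∑-swap (fil p xs) ks _ ⟩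
      ∑ ks (λ κ → ∑ (fil p xs) (λ x → ⟦ cls κ x ⟧))      ≤⟨ ∑-mono-∈ ks (λ κ κ∈ → ≤-trans (≤-reflexive (sym (length-fil (cls κ) (fil p xs)))) (small κ κ∈)) ⟩
      ∑ ks (λ _ → thin)                                  ≡⟨ ∑-const ks thin ⟩
      length ks * thin                                   ∎
      where
      in-some : ∀ x → x ∈ fil p xs → 1 ≤ ∑ ks (λ κ → ⟦ cls κ x ⟧)
      in-some x x∈ with covered x (proj₁ (∈-fil⁻ p xs x∈))
      ... | κ , κ∈ , e = ≤-trans (≤-reflexive (cong ⟦_⟧ (sym e))) (term≤∑ (λ κ → ⟦ cls κ x ⟧) κ∈)

-- Planes in the grid

incomp : List ℕ → List ℕ → Bool
incomp x y = not (below x y) ∧ not (below y x)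

incomp-sym : ∀ x y → incomp x y ≡ incomp y x
incomp-sym x y = ∧-comm′ (not (below x y)) (not (below y x))
  where
  ∧-comm′ : ∀ a b → a ∧ b ≡ b ∧ a
  ∧-comm′ true true = refl
  ∧-comm′ true false = refl
  ∧-comm′ false true = refl
  ∧-comm′ false false = refl

≤⇒¬incomp : ∀ {x y} → Pointwise _≤_ x y → incomp x y ≡ false
≤⇒¬incomp {x} {y} p = cong (λ b → not b ∧ not (below y x)) (≤⇒below p)

incomp-irrefl : ∀ x → incomp x x ≡ false
incomp-irrefl x = ≤⇒¬incomp {x} {x} (Pointwise.refl ≤-refl)

rots-injective : ∀ ρ {x y} → rots ρ x ≡ rots ρ y → x ≡ y
rots-injective zero e = e
rots-injective (suc ρ) {x} {y} e = rot-injective x y (rots-injective ρ e)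
  where
  rot-injective : ∀ x y → rot x ≡ rot y → x ≡ y
  rot-injective [] [] e = refl
  rot-injective [] (b ∷ []) ()
  rot-injective [] (b ∷ c ∷ y) ()
  rot-injective (a ∷ []) [] ()
  rot-injective (a ∷ c ∷ x) [] ()
  rot-injective (a ∷ x) (b ∷ y) e with ∷ʳ-injective x y e
  ... | refl , refl = refl

Pointwise-∷ʳ⁻ : ∀ x y {a b} → Pointwise _≤_ (x ++ [ a ]) (y ++ [ b ]) → Pointwise _≤_ x y × a ≤ b
Pointwise-∷ʳ⁻ [] [] (a≤b ∷ []) = [] , a≤b
Pointwise-∷ʳ⁻ [] (c ∷ []) (_ ∷ ())
Pointwise-∷ʳ⁻ [] (c ∷ d ∷ y) (_ ∷ ())
Pointwise-∷ʳ⁻ (c ∷ []) [] (_ ∷ ())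
Pointwise-∷ʳ⁻ (c ∷ d ∷ x) [] (_ ∷ ())
Pointwise-∷ʳ⁻ (c ∷ x) (d ∷ y) (c≤d ∷ p) with Pointwise-∷ʳ⁻ x y p
... | q , a≤b = c≤d ∷ q , a≤b

rots-reflects-≤ : ∀ ρ {x y} → Pointwise _≤_ (rots ρ x) (rots ρ y) → Pointwise _≤_ x y
rots-reflects-≤ zero p = p
rots-reflects-≤ (suc ρ) {x} {y} p = rot-reflects x y (rots-reflects-≤ ρ p)
  where
  rot-reflects : ∀ x y → Pointwise _≤_ (rot x) (rot y) → Pointwise _≤_ x y
  rot-reflects [] [] _ = []
  rot-reflects [] (b ∷ []) ()
  rot-reflects [] (b ∷ c ∷ y) ()
  rot-reflects (a ∷ []) [] ()
  rot-reflects (a ∷ c ∷ x) [] ()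
  rot-reflects (a ∷ x) (b ∷ y) p with Pointwise-∷ʳ⁻ x y p
  ... | q , a≤b = a≤b ∷ q

hd : List ℕ → ℕ
hd [] = 0
hd (a ∷ _) = a

last-two : ∀ m w → length w ≡ 2 + m → w ≡ take m w ++ hd (drop m w) ∷ hd (drop (suc m) w) ∷ []
last-two zero (a ∷ b ∷ []) refl = refl
last-two (suc m) (a ∷ w) e = cong (a ∷_) (last-two m w (cong pred e))

hd-drop< : ∀ {t} → 0 < t → ∀ m {w} → All (_< t) w → hd (drop m w) < t
hd-drop< 0<t zero [] = 0<t
hd-drop< 0<t zero (a<t ∷ _) = a<t
hd-drop< 0<t (suc m) [] = 0<t
hd-drop< 0<t (suc m) (_ ∷ w<t) = hd-drop< 0<t m w<t

module GridPlanes (t m : ℕ) (0<t : 0 < t) where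

  n : ℕ
  n = 2 + m

  open Points t
  open Kernel t n 0<t using (lists-distinct; ∑-lists-pick)
  open Antichains incomp

  Grid : List (List ℕ) → Set
  Grid xs = (∀ x → x ∈ xs → x ∈ lists n) × (∀ x → ∑ xs (λ y → ⟦ does (x ≟L y) ⟧) ≤ 1)

  Grid-fil : ∀ p xs → Grid xs → Grid (fil p xs)
  Grid-fil p xs (inside , distinct) =
    (λ x x∈ → inside x (proj₁ (∈-fil⁻ p xs x∈))) , (λ x → ≤-trans (∑-fil-≤ p xs _) (distinct x))

  Grid-lists : Grid (lists n)
  Grid-lists = (λ _ x∈ → x∈) , lists-distinct n

  valid⇒∈lists : ∀ {k y} → Valid k y → y ∈ lists k
  valid⇒∈lists {k} {y} v with ∑-nonzero (lists k) (λ z → 1 * ⟦ does (z ≟L y) ⟧) (λ e → 1≢0 (trans (sym (∑-lists-pick k v (λ _ → 1))) e))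
    where
    1≢0 : 1 ≢ 0
    1≢0 ()
  ... | z , z∈ , ne with z ≟L y
  ... | yes refl = z∈
  ... | no _ = ⊥-elim (ne refl)

  -- The coordinates that are constant on a plane; free are the two that come last after the
  -- rotation.
  key : ℕ → List ℕ → List ℕ
  key ρ x = take m (rots ρ x)

  key∈ : ∀ ρ {x} → x ∈ lists n → key ρ x ∈ lists m
  key∈ ρ {x} x∈ with ∈lists⇒valid x∈
  ... | l , x<t = valid⇒∈lists (trans (length-take m (rots ρ x)) (m≤n⇒m⊓n≡m (≤-trans (m≤n+m m 2) (≤-reflexive (sym (trans (length-rots ρ x) l))))) , All.take⁺ m (All-rots ρ x<t))

  ∑-at-most-one : ∀ xs (P : List ℕ → Bool) → (∀ x → ∑ xs (λ y → ⟦ does (x ≟L y) ⟧) ≤ 1) →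
    (∀ x y → x ∈ xs → y ∈ xs → P x ≡ true → P y ≡ true → x ≡ y) → ∑ xs (⟦_⟧ ∘ P) ≤ 1
  ∑-at-most-one xs P distinct unique with ∑ xs (⟦_⟧ ∘ P) ≟ 0
  ... | yes e = ≤-trans (≤-reflexive e) z≤n
  ... | no ne with ∑-nonzero xs (⟦_⟧ ∘ P) ne
  ... | x , x∈ , Px≢0 = ≤-trans (∑-mono-∈ xs only) (distinct x)
    where
    Px : P x ≡ true
    Px with P x
    ... | true = refl
    ... | false = ⊥-elim (Px≢0 refl)
    only : ∀ y → y ∈ xs → ⟦ P y ⟧ ≤ ⟦ does (x ≟L y) ⟧
    only y y∈ with P y in Py
    ... | false = z≤n
    ... | true rewrite dec-true (x ≟L y) (unique x y x∈ y∈ Px Py) = ≤-refl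

  module _ (ρ q : ℕ) ⦃ _ : NonZero q ⦄ where

    private
      c₀ r₀ col row : List ℕ → ℕ
      c₀ x = hd (drop m (rots ρ x))
      r₀ x = hd (drop (suc m) (rots ρ x))
      col x = c₀ x / q
      row x = r₀ x / q

      cls : List ℕ → List ℕ → Bool
      cls κ x = does (κ ≟L key ρ x)

      shape : ∀ {x} → x ∈ lists n → rots ρ x ≡ key ρ x ++ c₀ x ∷ r₀ x ∷ []
      shape {x} x∈ = last-two m (rots ρ x) (trans (length-rots ρ x) (proj₁ (∈lists⇒valid x∈)))

      comparable : ∀ κ xs x y → Grid xs → x ∈ xs → y ∈ xs → cls κ x ≡ true → cls κ y ≡ true →
        col x < col y → row x < row y → incomp x y ≡ false × incomp y x ≡ false
      comparable κ xs x y (inside , _) x∈ y∈ kx ky c< r< = ≤⇒¬incomp x≤y , trans (incomp-sym y x) (≤⇒¬incomp x≤y)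
        where
        smaller : ∀ {a b} → a / q < b / q → a ≤ b
        smaller {a} {b} lt with a ≤? b
        ... | yes p = p
        ... | no ¬p = ⊥-elim (<-irrefl refl (<-≤-trans lt (/-monoˡ-≤ q (<⇒≤ (≰⇒> ¬p)))))
        keys : key ρ x ≡ key ρ y
        keys = trans (sym (does-true (κ ≟L key ρ x) kx)) (does-true (κ ≟L key ρ y) ky)
        x≤y : Pointwise _≤_ x y
        x≤y = rots-reflects-≤ ρ (subst₂ (Pointwise _≤_) (sym (shape (inside x x∈))) (sym (trans (shape (inside y y∈)) (cong (_++ c₀ y ∷ r₀ y ∷ []) (sym keys))))
                (Pointwise.++⁺ (Pointwise.refl ≤-refl) (smaller c< ∷ smaller r< ∷ [])))

      cell : ∀ κ i j xs → Grid xs → length (fil (λ x → cls κ x ∧ ((col x ≡ᵇ i) ∧ (row x ≡ᵇ j))) xs) ≤ q * q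
      cell κ i j xs (inside , distinct) = begin
        length (fil (λ x → cls κ x ∧ ((col x ≡ᵇ i) ∧ (row x ≡ᵇ j))) xs)
          ≡⟨ length-fil _ xs ⟩
        ∑ xs (λ x → ⟦ cls κ x ∧ ((col x ≡ᵇ i) ∧ (row x ≡ᵇ j)) ⟧)
          ≤⟨ ∑-mono xs locate ⟩
        ∑ xs (λ x → ∑< q (λ c → ∑< q (λ d → ⟦ at c d x ⟧)))
          ≡⟨ trans (∑-swap xs (downFrom q) _) (∑-cong (downFrom q) (λ c → ∑-swap xs (downFrom q) _)) ⟩
        ∑< q (λ c → ∑< q (λ d → ∑ xs (λ x → ⟦ at c d x ⟧)))
          ≤⟨ ∑-mono (downFrom q) (λ c → ∑-mono (downFrom q) (λ d → ∑-at-most-one xs (at c d) distinct (unique c d))) ⟩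
        ∑< q (λ c → ∑< q (λ d → 1))
          ≡⟨ trans (∑-cong (downFrom q) (λ _ → trans (∑<-const q 1) (*-identityʳ q))) (∑<-const q q) ⟩
        q * q ∎
        where
        open ≤-Reasoning
        -- Within a block of a plane, the residues `c` and `d` of the two free coordinates determine
        -- the point.
        at : ℕ → ℕ → List ℕ → Bool
        at c d x = cls κ x ∧ ((c₀ x ≡ᵇ c + i * q) ∧ (r₀ x ≡ᵇ d + j * q))
        locate : ∀ x → ⟦ cls κ x ∧ ((col x ≡ᵇ i) ∧ (row x ≡ᵇ j)) ⟧ ≤ ∑< q (λ c → ∑< q (λ d → ⟦ at c d x ⟧))
        locate x with cls κ x ∧ ((col x ≡ᵇ i) ∧ (row x ≡ᵇ j)) in e
        ... | false = z≤n
        ... | true with ∧-true {cls κ x} e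
        ... | k , e₁ with ∧-true {col x ≡ᵇ i} e₁
        ... | ci , rj = ≤-trans (≤-reflexive (cong ⟦_⟧ (sym here′)))
              (≤-trans (term≤∑ (λ d → ⟦ at (c₀ x % q) d x ⟧) (∈-downFrom⁺ (m%n<n (r₀ x) q)))
                       (term≤∑ (λ c → ∑< q (λ d → ⟦ at c d x ⟧)) (∈-downFrom⁺ (m%n<n (c₀ x) q))))
          where
          here′ : at (c₀ x % q) (r₀ x % q) x ≡ true
          here′ = true-∧ k (true-∧
            (dec-true (c₀ x ≟ c₀ x % q + i * q) (trans (m≡m%n+[m/n]*n (c₀ x) q) (cong (λ b → c₀ x % q + b * q) (≡ᵇ-true (col x) i ci))))
            (dec-true (r₀ x ≟ r₀ x % q + j * q) (trans (m≡m%n+[m/n]*n (r₀ x) q) (cong (λ b → r₀ x % q + b * q) (≡ᵇ-true (row x) j rj)))))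
        unique : ∀ c d x y → x ∈ xs → y ∈ xs → at c d x ≡ true → at c d y ≡ true → x ≡ y
        unique c d x y x∈ y∈ ex ey with ∧-true {cls κ x} ex | ∧-true {cls κ y} ey
        ... | kx , ex₁ | ky , ey₁ with ∧-true {c₀ x ≡ᵇ c + i * q} ex₁ | ∧-true {c₀ y ≡ᵇ c + i * q} ey₁
        ... | cx , rx | cy , ry = rots-injective ρ (trans (shape (inside x x∈)) (trans
              (cong₂ _++_ (trans (sym (does-true (κ ≟L key ρ x) kx)) (does-true (κ ≟L key ρ y) ky))
                (cong₂ (λ a b → a ∷ b ∷ []) (trans (≡ᵇ-true (c₀ x) _ cx) (sym (≡ᵇ-true (c₀ y) _ cy)))
                                            (trans (≡ᵇ-true (r₀ x) _ rx) (sym (≡ᵇ-true (r₀ y) _ ry)))))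
              (sym (shape (inside y y∈)))))

      bounded : ∀ {xs x} k → Grid xs → x ∈ xs → hd (drop k (rots ρ x)) / q ≤ pred t / q
      bounded {x = x} k (inside , _) x∈ = /-monoˡ-≤ q (pred-mono-≤ (hd-drop< 0<t k (All-rots ρ (proj₂ (∈lists⇒valid (inside x x∈))))))

    cnt-grid : ∀ ks xs X → Grid xs → (∀ x → x ∈ xs → key ρ x ∈ ks) →
      (∀ p → length (fil p xs) ≤ length ks * ((pred t / q + pred t / q + 1) * (q * q)) → cnt (fil p xs) ≤ X) →
      cnt xs ≤ 2 ^ (length ks * (pred t / q + pred t / q)) * X
    cnt-grid ks xs X grid covered leaf = cnt-planes ks xs X grid
        (λ x x∈ → key ρ x , covered x x∈ , dec-true (key ρ x ≟L key ρ x) refl) leaf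
      where
      open Planes incomp cls col row (pred t / q) (q * q) Grid Grid-fil
        (λ xs x g x∈ → bounded {xs} {x} m g x∈) (λ xs x g x∈ → bounded {xs} {x} (suc m) g x∈) comparable cell

  -- With blocks of side 1, fewer than `2 * t` binary choices per plane select a path, and fewer
  -- than `2 * t` points on it remain to be chosen or not.
  cnt-by-planes : ∀ ρ ks xs → Grid xs → (∀ x → x ∈ xs → key ρ x ∈ ks) → cnt xs ≤ 2 ^ (length ks * (4 * t))
  cnt-by-planes ρ ks xs grid covered = begin
    cnt xs                                                        ≤⟨ cnt-grid ρ 1 ks xs (2 ^ (length ks * (e + e + 1))) grid covered
                                                                       (λ p len → ≤-trans (cnt≤2^length (fil p xs)) (^-monoʳ-≤ 2
                                                                         (≤-trans len (≤-reflexive (cong (length ks *_) (*-identityʳ (e + e + 1))))))) ⟩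
    2 ^ (length ks * (e + e)) * 2 ^ (length ks * (e + e + 1))     ≡⟨ sym (^-distribˡ-+-* 2 (length ks * (e + e)) _) ⟩
    2 ^ (length ks * (e + e) + length ks * (e + e + 1))           ≤⟨ ^-monoʳ-≤ 2 (≤-trans (≤-reflexive (sym (*-distribˡ-+ (length ks) (e + e) (e + e + 1))))
                                                                       (*-monoʳ-≤ (length ks) small)) ⟩
    2 ^ (length ks * (4 * t))                                     ∎
    where
    open ≤-Reasoning
    e : ℕ
    e = pred t / 1
    e≤ : suc e ≤ t
    e≤ = subst (λ k → suc k ≤ t) (sym (trans (cong (_/ 1) (sym (*-identityʳ (pred t)))) (m*n/n≡m (pred t) 1)))
           (≤-reflexive (suc-pred t ⦃ >-nonZero 0<t ⦄))
    r : ∀ e → e + e + (e + e + 1) + 3 ≡ 4 * suc e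
    r = solve-∀
    small : e + e + (e + e + 1) ≤ 4 * t
    small = ≤-trans (m≤m+n _ 3) (≤-trans (≤-reflexive (r e)) (*-monoʳ-≤ 4 e≤))

-- Few points have an unbalanced window

^-distrib-* : ∀ k a b → (a * b) ^ k ≡ a ^ k * b ^ k
^-distrib-* zero a b = refl
^-distrib-* (suc k) a b = trans (cong (a * b *_) (^-distrib-* k a b)) (mix a b (a ^ k) (b ^ k))
  where
  mix : ∀ a b x y → a * b * (x * y) ≡ a * x * (b * y)
  mix = solve-∀

module Deviation (t : ℕ) (0<t : 0 < t) where

  open Points t

  -- The base of an exponential moment: a coordinate outside `p` contributes the factor 8, any other
  -- the factor 1.
  weight : (ℕ → Bool) → ℕ → ℕ
  weight p a = ⟦ p a ⟧ + 8 * ⟦ not (p a) ⟧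

  ∏weight : (ℕ → Bool) → List ℕ → ℕ
  ∏weight p [] = 1
  ∏weight p (a ∷ x) = weight p a * ∏weight p x

  ∑-∏weight : ∀ p l o → ∑ (lists (l + o)) (λ x → ∏weight p (take l x)) ≡ ∑< t (weight p) ^ l * t ^ o
  ∑-∏weight p zero o = trans (∑-lists-const o 1) (trans (*-identityʳ _) (sym (+-identityʳ _)))
  ∑-∏weight p (suc l) o = begin
    ∑ (lists (suc (l + o))) (λ x → ∏weight p (take (suc l) x))
      ≡⟨ ∑-lists-suc (l + o) _ ⟩
    ∑< t (λ a → ∑ (lists (l + o)) (λ x → weight p a * ∏weight p (take l x)))
      ≡⟨ ∑-cong (downFrom t) (λ a → trans (∑-*ˡ (lists (l + o)) (weight p a) _) (cong (weight p a *_) (∑-∏weight p l o))) ⟩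
    ∑< t (λ a → weight p a * (∑< t (weight p) ^ l * t ^ o))
      ≡⟨ ∑-*ʳ (downFrom t) _ (weight p) ⟩
    ∑< t (weight p) * (∑< t (weight p) ^ l * t ^ o)
      ≡⟨ sym (*-assoc (∑< t (weight p)) _ _) ⟩
    ∑< t (weight p) ^ suc l * t ^ o ∎
    where open ≡-Reasoning

  8^length : ∀ p x → 8 ^ length x ≡ ∏weight p x * 8 ^ ∑ x (⟦_⟧ ∘ p)
  8^length p [] = refl
  8^length p (a ∷ x) with p a
  ... | true = trans (cong (8 *_) (8^length p x)) (r (∏weight p x) (8 ^ ∑ x (⟦_⟧ ∘ p)))
    where
    r : ∀ w e → 8 * (w * e) ≡ 1 * w * (8 * e)
    r = solve-∀
  ... | false = trans (cong (8 *_) (8^length p x)) (sym (*-assoc 8 (∏weight p x) _))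

  ∑weight≤ : ∀ p → t ≤ 2 * ∑< t (⟦_⟧ ∘ p) → 2 * ∑< t (weight p) ≤ 9 * t
  ∑weight≤ p half = +-cancelʳ-≤ (7 * t) _ _ (begin
    2 * S + 7 * t               ≤⟨ +-monoʳ-≤ (2 * S) (*-monoʳ-≤ 7 half) ⟩
    2 * S + 7 * (2 * U)         ≡⟨ r₁ S U ⟩
    2 * (S + 7 * U)             ≡⟨ cong (2 *_) total ⟩
    2 * (8 * t)                 ≡⟨ r₂ t ⟩
    9 * t + 7 * t               ∎)
    where
    open ≤-Reasoning
    S U : ℕ
    S = ∑< t (weight p)
    U = ∑< t (⟦_⟧ ∘ p)
    r₁ : ∀ s u → 2 * s + 7 * (2 * u) ≡ 2 * (s + 7 * u)
    r₁ = solve-∀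
    r₂ : ∀ t → 2 * (8 * t) ≡ 9 * t + 7 * t
    r₂ = solve-∀
    eight : ∀ b → ⟦ b ⟧ + 8 * ⟦ not b ⟧ + 7 * ⟦ b ⟧ ≡ 8
    eight true = refl
    eight false = refl
    total : S + 7 * U ≡ 8 * t
    total = trans (cong (S +_) (sym (∑-*ˡ (downFrom t) 7 _))) (trans (sym (∑-+ (downFrom t) _ _))
      (trans (∑-cong (downFrom t) (λ a → eight (p a))) (trans (∑<-const t 8) (*-comm t 8))))

  -- Markov's inequality for 8 ^ (number of coordinates outside p); note 9 ^ 8 ≤ 2 ^ 26.
  deviation : ∀ p l′ o → t ≤ 2 * ∑< t (⟦_⟧ ∘ p) →
    length (fil (λ x → does (∑ (take (8 * l′) x) (⟦_⟧ ∘ p) ≤? l′)) (lists (8 * l′ + o))) * 2 ^ (3 * l′) ≤ t ^ (8 * l′ + o)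
  deviation p l′ o half = *-cancelʳ-≤ _ _ (2 ^ (26 * l′)) ⦃ m^n≢0 2 (26 * l′) ⦄ (begin
    c * 2 ^ (3 * l′) * 2 ^ (26 * l′)         ≡⟨ *-assoc c _ _ ⟩
    c * (2 ^ (3 * l′) * 2 ^ (26 * l′))       ≡⟨ cong (c *_) (trans (sym (^-distribˡ-+-* 2 (3 * l′) (26 * l′))) (trans (cong (2 ^_) (r₁ l′)) (^-distribˡ-+-* 2 (3 * (7 * l′)) l))) ⟩
    c * (2 ^ (3 * (7 * l′)) * 2 ^ l)         ≡⟨ cong (λ e → c * (e * 2 ^ l)) (sym (^-*-assoc 2 3 (7 * l′))) ⟩
    c * (8 ^ (7 * l′) * 2 ^ l)               ≡⟨ sym (*-assoc c _ _) ⟩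
    c * 8 ^ (7 * l′) * 2 ^ l                 ≤⟨ *-monoˡ-≤ (2 ^ l) markov ⟩
    S ^ l * t ^ o * 2 ^ l                    ≡⟨ r₂ (S ^ l) (t ^ o) (2 ^ l) ⟩
    2 ^ l * S ^ l * t ^ o                    ≡⟨ cong (_* t ^ o) (sym (^-distrib-* l 2 S)) ⟩
    (2 * S) ^ l * t ^ o                      ≤⟨ *-monoˡ-≤ (t ^ o) (^-monoˡ-≤ l (∑weight≤ p half)) ⟩
    (9 * t) ^ l * t ^ o                      ≡⟨ cong (_* t ^ o) (^-distrib-* l 9 t) ⟩
    9 ^ l * t ^ l * t ^ o                    ≡⟨ *-assoc (9 ^ l) _ _ ⟩
    9 ^ l * (t ^ l * t ^ o)                  ≡⟨ cong₂ _*_ (sym (^-*-assoc 9 8 l′)) (sym (^-distribˡ-+-* t l o)) ⟩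
    (9 ^ 8) ^ l′ * t ^ (l + o)               ≤⟨ *-monoˡ-≤ (t ^ (l + o)) (^-monoˡ-≤ l′ (≤ᵇ⇒≤ (9 ^ 8) (2 ^ 26) tt)) ⟩
    (2 ^ 26) ^ l′ * t ^ (l + o)              ≡⟨ cong (_* t ^ (l + o)) (^-*-assoc 2 26 l′) ⟩
    2 ^ (26 * l′) * t ^ (l + o)              ≡⟨ *-comm (2 ^ (26 * l′)) _ ⟩
    t ^ (l + o) * 2 ^ (26 * l′)              ∎)
    where
    open ≤-Reasoning
    l S c : ℕ
    l = 8 * l′
    S = ∑< t (weight p)
    bad : List ℕ → Bool
    bad x = does (∑ (take l x) (⟦_⟧ ∘ p) ≤? l′)
    c = length (fil bad (lists (l + o)))
    r₁ : ∀ l → 3 * l + 26 * l ≡ 3 * (7 * l) + 8 * l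
    r₁ = solve-∀
    r₂ : ∀ a b c → a * b * c ≡ c * a * b
    r₂ = solve-∀
    heavy : ∀ x → x ∈ lists (l + o) → ⟦ bad x ⟧ * 8 ^ (7 * l′) ≤ ∏weight p (take l x)
    heavy x x∈ with ∑ (take l x) (⟦_⟧ ∘ p) ≤? l′
    ... | no ¬b rewrite dec-false (∑ (take l x) (⟦_⟧ ∘ p) ≤? l′) ¬b = z≤n
    ... | yes b = ≤-trans (*-monoˡ-≤ (8 ^ (7 * l′)) (⟦⟧≤1 (bad x))) (≤-trans (≤-reflexive (+-identityʳ _))
        (*-cancelʳ-≤ _ _ (8 ^ l′) ⦃ m^n≢0 8 l′ ⦄ (begin
          8 ^ (7 * l′) * 8 ^ l′                     ≡⟨ sym (^-distribˡ-+-* 8 (7 * l′) l′) ⟩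
          8 ^ (7 * l′ + l′)                         ≡⟨ cong (8 ^_) (trans (r₃ l′) (sym (trans (length-take l x) (m≤n⇒m⊓n≡m (≤-trans (m≤m+n l o) (≤-reflexive (sym (proj₁ (∈lists⇒valid x∈))))))))) ⟩
          8 ^ length (take l x)                     ≡⟨ 8^length p (take l x) ⟩
          ∏weight p (take l x) * 8 ^ ∑ (take l x) (⟦_⟧ ∘ p) ≤⟨ *-monoʳ-≤ (∏weight p (take l x)) (^-monoʳ-≤ 8 b) ⟩
          ∏weight p (take l x) * 8 ^ l′             ∎)))
      where
      r₃ : ∀ l → 7 * l + l ≡ 8 * l
      r₃ = solve-∀
    markov : c * 8 ^ (7 * l′) ≤ S ^ l * t ^ o
    markov = begin
      c * 8 ^ (7 * l′)                                    ≡⟨ cong (_* 8 ^ (7 * l′)) (length-fil bad (lists (l + o))) ⟩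
      ∑ (lists (l + o)) (⟦_⟧ ∘ bad) * 8 ^ (7 * l′)        ≡⟨ sym (∑-*ʳ (lists (l + o)) (8 ^ (7 * l′)) _) ⟩
      ∑ (lists (l + o)) (λ x → ⟦ bad x ⟧ * 8 ^ (7 * l′))  ≤⟨ ∑-mono-∈ (lists (l + o)) heavy ⟩
      ∑ (lists (l + o)) (λ x → ∏weight p (take l x))      ≡⟨ ∑-∏weight p l o ⟩
      S ^ l * t ^ o                                       ∎

  half-of : ∀ p → (∀ a → a < t → 1 ≤ ⟦ p a ⟧ + ⟦ p (t ∸ suc a) ⟧) → t ≤ 2 * ∑< t (⟦_⟧ ∘ p)
  half-of p one = begin
    t                                                      ≡⟨ sym (trans (∑<-const t 1) (*-identityʳ t)) ⟩
    ∑< t (λ _ → 1)                                         ≤⟨ ∑<-mono t one ⟩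
    ∑< t (λ a → ⟦ p a ⟧ + ⟦ p (t ∸ suc a) ⟧)               ≡⟨ ∑-+ (downFrom t) _ _ ⟩
    ∑< t (⟦_⟧ ∘ p) + ∑< t (λ a → ⟦ p (t ∸ suc a) ⟧)        ≡⟨ cong (∑< t (⟦_⟧ ∘ p) +_) (trans (∑<-reverse t (⟦_⟧ ∘ p)) (sym (+-identityʳ _))) ⟩
    2 * ∑< t (⟦_⟧ ∘ p)                                     ∎
    where open ≤-Reasoning

  mirror : ∀ {a} → a < t → 2 * a + 2 * (t ∸ suc a) ≡ 2 * pred t
  mirror {a} a<t = trans (sym (*-distribˡ-+ 2 a (t ∸ suc a))) (cong (2 *_) (cong pred (m+[n∸m]≡n a<t)))

  upper-half : t ≤ 2 * ∑< t (λ a → ⟦ does (pred t ≤? 2 * a) ⟧)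
  upper-half = half-of _ one
    where
    one : ∀ a → a < t → 1 ≤ ⟦ does (pred t ≤? 2 * a) ⟧ + ⟦ does (pred t ≤? 2 * (t ∸ suc a)) ⟧
    one a a<t with pred t ≤? 2 * a
    ... | yes p rewrite dec-true (pred t ≤? 2 * a) p = s≤s z≤n
    ... | no ¬p rewrite dec-true (pred t ≤? 2 * (t ∸ suc a)) (+-cancelˡ-≤ (pred t) _ _ (≤-trans (≤-reflexive (trans (cong (pred t +_) (sym (+-identityʳ (pred t)))) (sym (mirror a<t)))) (+-monoˡ-≤ (2 * (t ∸ suc a)) (<⇒≤ (≰⇒> ¬p))))) =
      m≤n+m 1 ⟦ does (pred t ≤? 2 * a) ⟧

  lower-half : t ≤ 2 * ∑< t (λ a → ⟦ does (2 * a ≤? pred t) ⟧)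
  lower-half = half-of _ one
    where
    one : ∀ a → a < t → 1 ≤ ⟦ does (2 * a ≤? pred t) ⟧ + ⟦ does (2 * (t ∸ suc a) ≤? pred t) ⟧
    one a a<t with 2 * a ≤? pred t
    ... | yes p rewrite dec-true (2 * a ≤? pred t) p = s≤s z≤n
    ... | no ¬p rewrite dec-true (2 * (t ∸ suc a) ≤? pred t) (+-cancelˡ-≤ (pred t) _ _ (≤-trans (+-monoˡ-≤ (2 * (t ∸ suc a)) (<⇒≤ (≰⇒> ¬p))) (≤-reflexive (trans (mirror a<t) (cong (pred t +_) (+-identityʳ (pred t))))))) =
      m≤n+m 1 ⟦ does (2 * a ≤? pred t) ⟧

-- Branching on vertices of large degree

bernoulli : ∀ p k → p ^ k * (p + k) ≤ p * suc p ^ k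
bernoulli p zero = ≤-reflexive (r p)
  where
  r : ∀ p → 1 * (p + 0) ≡ p * 1
  r = solve-∀
bernoulli p (suc k) = begin
  p * p ^ k * (p + suc k)                 ≤⟨ m≤m+n _ (p ^ k * k) ⟩
  p * p ^ k * (p + suc k) + p ^ k * k     ≡⟨ r₁ p (p ^ k) k ⟩
  suc p * (p ^ k * (p + k))               ≤⟨ *-monoʳ-≤ (suc p) (bernoulli p k) ⟩
  suc p * (p * suc p ^ k)                 ≡⟨ r₂ (suc p) p (suc p ^ k) ⟩
  p * (suc p * suc p ^ k)                 ∎
  where
  open ≤-Reasoning
  r₁ : ∀ p e k → p * e * (p + suc k) + e * k ≡ suc p * (e * (p + k))
  r₁ = solve-∀
  r₂ : ∀ a b c → a * (b * c) ≡ b * (a * c)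
  r₂ = solve-∀

-- Bernoulli's inequality for `1 - 1 / (p + 1)`, with `j` for `p + 1 - k`.
bernoulli⁻ : ∀ p k j → j + k ≡ suc p → suc p ^ k * j ≤ p ^ k * suc p
bernoulli⁻ p zero j e = ≤-reflexive (cong (1 *_) (trans (sym (+-identityʳ j)) e))
bernoulli⁻ p (suc k) j e = begin
  suc p * suc p ^ k * j              ≡⟨ r₁ (suc p) (suc p ^ k) j ⟩
  suc p ^ k * (suc p * j)            ≤⟨ *-monoʳ-≤ (suc p ^ k) (≤-trans (+-monoˡ-≤ (p * j) j≤p) (≤-reflexive (sym (*-suc p j)))) ⟩
  suc p ^ k * (p * suc j)            ≡⟨ r₂ (suc p ^ k) p (suc j) ⟩
  p * (suc p ^ k * suc j)            ≤⟨ *-monoʳ-≤ p (bernoulli⁻ p k (suc j) (trans (sym (+-suc j k)) e)) ⟩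
  p * (p ^ k * suc p)                ≡⟨ sym (*-assoc p (p ^ k) (suc p)) ⟩
  p * p ^ k * suc p                  ∎
  where
  open ≤-Reasoning
  j≤p : j ≤ p
  j≤p = ≤-pred (≤-trans (m≤m+n (suc j) k) (≤-reflexive (trans (sym (+-suc j k)) e)))
  r₁ : ∀ a b c → a * b * c ≡ b * (a * c)
  r₁ = solve-∀
  r₂ : ∀ a b c → a * (b * c) ≡ b * (a * c)
  r₂ = solve-∀

suc^≤2 : ∀ p k → k + k ≤ suc p → suc p ^ k ≤ 2 * p ^ k
suc^≤2 p k 2k≤ with m≤n⇒∃[o]m+o≡n (≤-trans (m≤m+n k k) 2k≤)
... | j , k+j≡ = *-cancelʳ-≤ _ _ (suc p) (begin
  suc p ^ k * suc p            ≡⟨ cong (suc p ^ k *_) (sym k+j≡) ⟩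
  suc p ^ k * (k + j)          ≤⟨ *-monoʳ-≤ (suc p ^ k) (+-monoˡ-≤ j (+-cancelˡ-≤ k k j (≤-trans 2k≤ (≤-reflexive (sym k+j≡))))) ⟩
  suc p ^ k * (j + j)          ≡⟨ r (suc p ^ k) j ⟩
  2 * (suc p ^ k * j)          ≤⟨ *-monoʳ-≤ 2 (bernoulli⁻ p k j (trans (+-comm j k) k+j≡)) ⟩
  2 * (p ^ k * suc p)          ≡⟨ sym (*-assoc 2 (p ^ k) (suc p)) ⟩
  2 * p ^ k * suc p            ∎)
  where
  open ≤-Reasoning
  r : ∀ a j → a * (j + j) ≡ 2 * (a * j)
  r = solve-∀

-- Both halves of the exponent are short enough for `suc^≤2`.
suc^≤4 : ∀ p → suc p ^ p ≤ 4 * p ^ p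
suc^≤4 p = begin
  suc p ^ p                                           ≡⟨ cong (suc p ^_) (sym split) ⟩
  suc p ^ (⌊ p /2⌋ + ⌈ p /2⌉)                         ≡⟨ ^-distribˡ-+-* (suc p) ⌊ p /2⌋ ⌈ p /2⌉ ⟩
  suc p ^ ⌊ p /2⌋ * suc p ^ ⌈ p /2⌉                   ≤⟨ *-mono-≤ (suc^≤2 p ⌊ p /2⌋ (≤-trans (+-monoʳ-≤ ⌊ p /2⌋ (⌊n/2⌋≤⌈n/2⌉ p)) (≤-trans (≤-reflexive split) (n≤1+n p))))
                                                                   (suc^≤2 p ⌈ p /2⌉ (≤-trans (+-monoʳ-≤ ⌈ p /2⌉ (⌊n/2⌋≤⌈n/2⌉ (suc p))) (≤-reflexive (⌊n/2⌋+⌈n/2⌉≡n (suc p))))) ⟩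
  2 * p ^ ⌊ p /2⌋ * (2 * p ^ ⌈ p /2⌉)                 ≡⟨ r (p ^ ⌊ p /2⌋) (p ^ ⌈ p /2⌉) ⟩
  4 * (p ^ ⌊ p /2⌋ * p ^ ⌈ p /2⌉)                     ≡⟨ cong (4 *_) (trans (sym (^-distribˡ-+-* p ⌊ p /2⌋ ⌈ p /2⌉)) (cong (p ^_) split)) ⟩
  4 * p ^ p                                           ∎
  where
  open ≤-Reasoning
  split : ⌊ p /2⌋ + ⌈ p /2⌉ ≡ p
  split = ⌊n/2⌋+⌈n/2⌉≡n p
  r : ∀ a b → 2 * a * (2 * b) ≡ 4 * (a * b)
  r = solve-∀

2*p^p≤ : ∀ p → 0 < p → 2 * p ^ p ≤ suc p ^ p
2*p^p≤ p 0<p = *-cancelˡ-≤ p ⦃ >-nonZero 0<p ⦄ (≤-trans (≤-reflexive (r p (p ^ p))) (bernoulli p p))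
  where
  r : ∀ p e → p * (2 * e) ≡ e * (p + p)
  r = solve-∀

module Degrees {V : Set} (inc : V → V → Bool) (_≟′_ : (x y : V) → Dec (x ≡ y))
  (inc-sym : ∀ x y → inc x y ≡ inc y x) (inc-irrefl : ∀ x → inc x x ≡ false)
  (Ok : List V → Set) (Ok-fil : ∀ p xs → Ok xs → Ok (fil p xs))
  (Ok-distinct : ∀ xs → Ok xs → ∀ x → ∑ xs (λ y → ⟦ does (x ≟′ y) ⟧) ≤ 1)
  where

  open Antichains inc
  open Branching _≟′_ inc-sym inc-irrefl

  -- x has at least d neighbours in W in the comparability graph.
  HighDegree : ℕ → List V → Set
  HighDegree d W = Σ V (λ x → x ∈ W × length (fil (inc x) W) + suc d ≤ length W)

  length-∖ : ∀ x W → x ∈ W → suc (length (W ∖ x)) ≤ length W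
  length-∖ x W x∈ = begin
    suc (length (W ∖ x))                                         ≡⟨ cong suc (length-fil _ W) ⟩
    1 + ∑ W (λ y → ⟦ not (does (x ≟′ y)) ⟧)                      ≤⟨ +-monoˡ-≤ _ (≤-trans (≤-reflexive (sym (δ-refl x))) (term≤∑ (δ x) x∈)) ⟩
    ∑ W (δ x) + ∑ W (λ y → ⟦ not (does (x ≟′ y)) ⟧)              ≡⟨ sym (∑-+ W _ _) ⟩
    ∑ W (λ y → δ x y + ⟦ not (does (x ≟′ y)) ⟧)                  ≡⟨ ∑-cong W (λ y → one (does (x ≟′ y))) ⟩
    ∑ W (λ _ → 1)                                                ≡⟨ sym (length-∑ W) ⟩
    length W                                                     ∎
    where
    open ≤-Reasoning
    one : ∀ b → ⟦ b ⟧ + ⟦ not b ⟧ ≡ 1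
    one true = refl
    one false = refl

  -- Branching on a vertex of degree d removes 1 or d + 1 points, so removing R points costs a factor
  -- λ ^ R for any λ with λ ^ -1 + λ ^ -(d + 1) ≤ 1; here λ = 1 + 1 / p.
  phase : ∀ M d p X → p ^ suc d ≤ suc p ^ d → (∀ W → Ok W → M < length W → HighDegree d W) →
    (∀ W → Ok W → length W ≤ M → cnt W ≤ X) →
    ∀ R W → Ok W → length W ≤ M + R → cnt W * p ^ (R + d) ≤ suc p ^ (R + d) * X
  phase M d p X p-ok high low R = go R R ≤-refl
    where
    open ≤-Reasoning
    go : ∀ fuel R → R ≤ fuel → ∀ W → Ok W → length W ≤ M + R → cnt W * p ^ (R + d) ≤ suc p ^ (R + d) * X
    go fuel R R≤ W ok len with length W ≤? M
    ... | yes small = ≤-trans (*-mono-≤ (low W ok small) (^-monoˡ-≤ (R + d) (n≤1+n p))) (≤-reflexive (*-comm X _))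
    go fuel zero R≤ W ok len | no big = ⊥-elim (big (≤-trans len (≤-reflexive (+-identityʳ M))))
    go (suc fuel) (suc R) (s≤s R≤) W ok len | no big with high W ok (≰⇒> big)
    ... | x , x∈ , deg = begin
      cnt W * (p * p ^ (R + d))
        ≤⟨ *-monoˡ-≤ (p * p ^ (R + d)) (cnt-branch x W (Ok-distinct W ok)) ⟩
      (cnt (W ∖ x) + cnt (fil (inc x) W)) * (p * p ^ (R + d))
        ≡⟨ r₁ (cnt (W ∖ x)) (cnt (fil (inc x) W)) p (p ^ (R + d)) ⟩
      p * (cnt (W ∖ x) * p ^ (R + d)) + cnt (fil (inc x) W) * p ^ (suc R + d)
        ≤⟨ +-mono-≤ (*-monoʳ-≤ p (go fuel R R≤ (W ∖ x) (Ok-fil _ W ok) (≤-pred (≤-trans (length-∖ x W x∈) (≤-trans len (≤-reflexive (+-suc M R))))))) taken ⟩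
      p * (suc p ^ (R + d) * X) + suc p ^ (R + d) * X
        ≡⟨ r₂ p (suc p ^ (R + d)) X ⟩
      suc p * suc p ^ (R + d) * X ∎
      where
      r₁ : ∀ a b p e → (a + b) * (p * e) ≡ p * (a * e) + b * (p * e)
      r₁ = solve-∀
      r₂ : ∀ p e X → p * (e * X) + e * X ≡ suc p * e * X
      r₂ = solve-∀
      F : List V
      F = fil (inc x) W
      room : length F + d ≤ M + R
      room = ≤-pred (≤-trans (≤-reflexive (sym (+-suc (length F) d))) (≤-trans deg (≤-trans len (≤-reflexive (+-suc M R)))))
      -- If fewer than `d` points are left to remove, choosing `x` already brings the list below
      -- `M`. The surplus `d` in the exponent `R + d` is there for this last overshoot.
      taken : cnt F * p ^ (suc R + d) ≤ suc p ^ (R + d) * X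
      taken with d ≤? R
      ... | yes d≤R with m≤n⇒∃[o]m+o≡n d≤R
      ... | o , refl = begin
        cnt F * p ^ (suc (d + o) + d)              ≡⟨ cong (λ e → cnt F * p ^ e) (e₁ d o) ⟩
        cnt F * p ^ (o + d + suc d)                ≡⟨ cong (cnt F *_) (^-distribˡ-+-* p (o + d) (suc d)) ⟩
        cnt F * (p ^ (o + d) * p ^ suc d)          ≡⟨ sym (*-assoc (cnt F) _ _) ⟩
        cnt F * p ^ (o + d) * p ^ suc d            ≤⟨ *-mono-≤ (go fuel o (≤-trans (m≤n+m o d) R≤) F (Ok-fil (inc x) W ok)
                                                        (+-cancelʳ-≤ d _ _ (≤-trans room (≤-reflexive (e₂ M d o))))) p-ok ⟩
        suc p ^ (o + d) * X * suc p ^ d            ≡⟨ e₃ (suc p ^ (o + d)) X (suc p ^ d) ⟩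
        suc p ^ (o + d) * suc p ^ d * X            ≡⟨ cong (_* X) (trans (sym (^-distribˡ-+-* (suc p) (o + d) d)) (cong (suc p ^_) (cong (_+ d) (+-comm o d)))) ⟩
        suc p ^ (d + o + d) * X                    ∎
        where
        e₁ : ∀ d o → suc (d + o) + d ≡ o + d + suc d
        e₁ = solve-∀
        e₂ : ∀ M d o → M + (d + o) ≡ M + o + d
        e₂ = solve-∀
        e₃ : ∀ a b c → a * b * c ≡ a * c * b
        e₃ = solve-∀
      taken | no d≰R = begin
        cnt F * p ^ (suc R + d)                    ≤⟨ *-monoˡ-≤ (p ^ (suc R + d)) (low F (Ok-fil (inc x) W ok) (+-cancelʳ-≤ d _ _ (≤-trans room (+-monoʳ-≤ M (<⇒≤ (≰⇒> d≰R)))))) ⟩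
        X * p ^ (suc R + d)                        ≡⟨ cong (λ e → X * p ^ e) (sym (+-suc R d)) ⟩
        X * p ^ (R + suc d)                        ≡⟨ cong (X *_) (^-distribˡ-+-* p R (suc d)) ⟩
        X * (p ^ R * p ^ suc d)                    ≤⟨ *-monoʳ-≤ X (*-mono-≤ (^-monoˡ-≤ R (n≤1+n p)) p-ok) ⟩
        X * (suc p ^ R * suc p ^ d)                ≡⟨ cong (X *_) (sym (^-distribˡ-+-* (suc p) R d)) ⟩
        X * suc p ^ (R + d)                        ≡⟨ *-comm X _ ⟩
        suc p ^ (R + d) * X                        ∎

  -- The degree `p * L` suffices because (1 + 1 / p) ^ (p L) is at least `2 ^ L`, hence at least
  -- `p`. As (1 + 1 / p) ^ p is at most 4, removing `p * e` points costs `2 * (e + L)` bits,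
  -- whatever `p` is.
  phase′ : ∀ M p L e X → 0 < p → p ≤ 2 ^ L → (∀ W → Ok W → M < length W → HighDegree (p * L) W) →
    (∀ W → Ok W → length W ≤ M → cnt W ≤ X) → ∀ W → Ok W → length W ≤ M + p * e → cnt W ≤ 4 ^ (e + L) * X
  phase′ M p L e X 0<p p≤ high low W ok len = *-cancelʳ-≤ _ _ (p ^ T) ⦃ m^n≢0 p T ⦃ >-nonZero 0<p ⦄ ⦄ (begin
    cnt W * p ^ T                       ≤⟨ phase M (p * L) p X p-ok high low (p * e) W ok len ⟩
    suc p ^ T * X                       ≡⟨ cong (_* X) (power (suc p)) ⟩
    (suc p ^ p) ^ (e + L) * X           ≤⟨ *-monoˡ-≤ X (^-monoˡ-≤ (e + L) (suc^≤4 p)) ⟩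
    (4 * p ^ p) ^ (e + L) * X           ≡⟨ cong (_* X) (^-distrib-* (e + L) 4 (p ^ p)) ⟩
    4 ^ (e + L) * (p ^ p) ^ (e + L) * X ≡⟨ cong (λ k → 4 ^ (e + L) * k * X) (sym (power p)) ⟩
    4 ^ (e + L) * p ^ T * X             ≡⟨ r (4 ^ (e + L)) (p ^ T) X ⟩
    4 ^ (e + L) * X * p ^ T             ∎)
    where
    open ≤-Reasoning
    T : ℕ
    T = p * e + p * L
    r : ∀ a b c → a * b * c ≡ a * c * b
    r = solve-∀
    power : ∀ a → a ^ T ≡ (a ^ p) ^ (e + L)
    power a = trans (cong (a ^_) (sym (*-distribˡ-+ p e L))) (sym (^-*-assoc a p (e + L)))
    p-ok : p ^ suc (p * L) ≤ suc p ^ (p * L)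
    p-ok = begin
      p * p ^ (p * L)              ≤⟨ *-monoˡ-≤ (p ^ (p * L)) p≤ ⟩
      2 ^ L * p ^ (p * L)          ≡⟨ cong (2 ^ L *_) (sym (^-*-assoc p p L)) ⟩
      2 ^ L * (p ^ p) ^ L          ≡⟨ sym (^-distrib-* L 2 (p ^ p)) ⟩
      (2 * p ^ p) ^ L              ≤⟨ ^-monoˡ-≤ L (2*p^p≤ p 0<p) ⟩
      (suc p ^ p) ^ L              ≡⟨ ^-*-assoc (suc p) p L ⟩
      suc p ^ (p * L)              ∎

  -- Each phase halves the excess over `α` and takes `p` to be the power of two that matches the
  -- excess, so all phases cost the same. Once the excess is down to `e`, all subsets are counted.
  phases : ∀ α e I → (∀ i W → i < I → Ok W → α + 2 ^ i * e < length W → HighDegree (2 ^ i * I) W) →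
    ∀ i → i ≤ I → ∀ W → Ok W → length W ≤ α + 2 ^ i * e → cnt W ≤ (4 ^ (e + I)) ^ i * 2 ^ (α + e)
  phases α e I high zero _ W ok len = ≤-trans (cnt≤2^length W) (≤-trans (^-monoʳ-≤ 2 (≤-trans len (≤-reflexive (cong (α +_) (+-identityʳ e))))) (≤-reflexive (sym (+-identityʳ _))))
  phases α e I high (suc i) i<I W ok len = ≤-trans
    (phase′ (α + 2 ^ i * e) (2 ^ i) I e ((4 ^ (e + I)) ^ i * 2 ^ (α + e)) (m^n>0 2 i) (^-monoʳ-≤ 2 (<⇒≤ i<I))
      (λ W ok big → high i W i<I ok big) (phases α e I high i (<⇒≤ i<I)) W ok (≤-trans len (≤-reflexive (r α (2 ^ i) e))))
    (≤-reflexive (sym (*-assoc (4 ^ (e + I)) _ _)))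
    where
    r : ∀ a p e → a + 2 * p * e ≡ a + p * e + p * e
    r = solve-∀

-- With s = ⌊L / α⌋, a set of L > α + e points all of whose degrees are at most d violates supersaturation.
dense⇒⊥ : ∀ n α K d e L → 0 < n → 0 < α → 8 * (d * K * α) ≤ n * e → α + e < L →
  (∀ s → s * n * L ≤ tri (suc s) * n * α + d * K * L) → ⊥
dense⇒⊥ n α K d e L 0<n 0<α small big sat with _/_ L α ⦃ >-nonZero 0<α ⦄ in eq
... | zero = <-irrefl refl (≤-trans (s≤s (≤-trans (m≤m+n α e) (<⇒≤ big))) (≤-trans above (≤-reflexive (trans (cong (λ k → α * suc k) eq) (*-identityʳ α)))))
  where
  above : L < α * suc (_/_ L α ⦃ >-nonZero 0<α ⦄)
  above = m<n*suc[m/n] L α ⦃ >-nonZero 0<α ⦄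
-- Here `L < 2 * α`, and `sat 1` bounds the excess: `n * (L - α)` is at most `d * K * L`, which
-- `small` makes less than `n * e`.
... | suc zero = <-irrefl refl (begin-strict
    4 * (n * L)                             ≡⟨ r₁ n L ⟩
    4 * (1 * n * L)                         ≤⟨ *-monoʳ-≤ 4 (sat 1) ⟩
    4 * (tri 2 * n * α + d * K * L)         ≡⟨ r₂ n α (d * K) L ⟩
    4 * (n * α) + 4 * (d * K * L)           ≤⟨ +-monoʳ-≤ (4 * (n * α)) (*-monoʳ-≤ 4 (*-monoʳ-≤ (d * K) L≤2α)) ⟩
    4 * (n * α) + 4 * (d * K * (2 * α))     ≡⟨ r₃ (4 * (n * α)) (d * K) α ⟩
    4 * (n * α) + 8 * (d * K * α)           ≤⟨ +-monoʳ-≤ (4 * (n * α)) small ⟩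
    4 * (n * α) + n * e                     ≤⟨ m≤m+n _ (3 * (n * e)) ⟩
    4 * (n * α) + n * e + 3 * (n * e)       ≡⟨ r₄ n α e ⟩
    4 * (n * (α + e))                       <⟨ *-monoʳ-< 4 (*-monoʳ-< n ⦃ >-nonZero 0<n ⦄ big) ⟩
    4 * (n * L)                             ∎)
  where
  open ≤-Reasoning
  r₁ : ∀ n L → 4 * (n * L) ≡ 4 * (1 * n * L)
  r₁ = solve-∀
  r₂ : ∀ n α k L → 4 * (1 * n * α + k * L) ≡ 4 * (n * α) + 4 * (k * L)
  r₂ = solve-∀
  r₃ : ∀ x k α → x + 4 * (k * (2 * α)) ≡ x + 8 * (k * α)
  r₃ = solve-∀
  r₄ : ∀ n α e → 4 * (n * α) + n * e + 3 * (n * e) ≡ 4 * (n * (α + e))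
  r₄ = solve-∀
  L≤2α : L ≤ 2 * α
  L≤2α = <⇒≤ (≤-trans (m<n*suc[m/n] L α ⦃ >-nonZero 0<α ⦄) (≤-reflexive (trans (cong (λ k → α * suc k) eq) (*-comm α 2))))
-- For a quotient `s` of at least 2, `sat s` gives `(s - 1) * n ≤ 2 * (d * K)`. Then `small` forces
-- `L` to be at least `4 * (s - 1) * α`, but `L` is less than `(s + 1) * α`.
... | suc (suc s′) = <-irrefl refl (begin-strict
    4 * (suc s′ * (n * α))                  ≤⟨ ≤-trans (≤-reflexive (cong (4 *_) (r₁ (suc s′) n α))) (*-monoʳ-≤ 4 (*-monoˡ-≤ α few)) ⟩
    4 * (2 * (d * K) * α)                   ≡⟨ r₂ (d * K) α ⟩
    8 * (d * K * α)                         ≤⟨ small ⟩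
    n * e                                   ≤⟨ *-monoʳ-≤ n (≤-trans (m≤n+m e α) (<⇒≤ big)) ⟩
    n * L                                   <⟨ *-monoʳ-< n ⦃ >-nonZero 0<n ⦄ L< ⟩
    n * (suc s * α)                         ≤⟨ m≤m+n _ (3 * (s′ * (n * α)) + n * α) ⟩
    n * (suc s * α) + (3 * (s′ * (n * α)) + n * α) ≡⟨ r₃ n s′ α ⟩
    4 * (suc s′ * (n * α)) + 0              ≡⟨ +-identityʳ _ ⟩
    4 * (suc s′ * (n * α))                  ∎)
  where
  open ≤-Reasoning
  s : ℕ
  s = suc (suc s′)
  r₁ : ∀ s n α → s * (n * α) ≡ s * n * α
  r₁ = solve-∀
  r₂ : ∀ k α → 4 * (2 * k * α) ≡ 8 * (k * α)
  r₂ = solve-∀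
  r₃ : ∀ n s α → n * (suc (suc (suc s)) * α) + (3 * (s * (n * α)) + n * α) ≡ 4 * (suc s * (n * α)) + 0
  r₃ = solve-∀
  L< : L < suc s * α
  L< = ≤-trans (m<n*suc[m/n] L α ⦃ >-nonZero 0<α ⦄) (≤-reflexive (trans (cong (λ k → α * suc k) eq) (*-comm α (suc s))))
  sα≤L : s * α ≤ L
  sα≤L = subst (λ k → k * α ≤ L) eq (m/n*n≤m L α ⦃ >-nonZero 0<α ⦄)
  few : suc s′ * n ≤ 2 * (d * K)
  few = *-cancelʳ-≤ _ _ L ⦃ >-nonZero (≤-trans (s≤s z≤n) big) ⦄ (+-cancelʳ-≤ (suc s * n * L) _ _ (begin
    suc s′ * n * L + suc s * n * L             ≡⟨ q₁ s′ n L ⟩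
    2 * (s * n * L)                            ≤⟨ *-monoʳ-≤ 2 (sat s) ⟩
    2 * (tri (suc s) * n * α + d * K * L)      ≡⟨ q₂ (tri (suc s)) n α (d * K) L ⟩
    2 * tri (suc s) * (n * α) + 2 * (d * K) * L ≡⟨ cong (λ k → k * (n * α) + 2 * (d * K) * L) (2*tri s) ⟩
    s * suc s * (n * α) + 2 * (d * K) * L      ≡⟨ q₃ s (suc s) n α (2 * (d * K) * L) ⟩
    suc s * n * (s * α) + 2 * (d * K) * L      ≤⟨ +-monoˡ-≤ _ (*-monoʳ-≤ (suc s * n) sα≤L) ⟩
    suc s * n * L + 2 * (d * K) * L            ≡⟨ +-comm (suc s * n * L) _ ⟩
    2 * (d * K) * L + suc s * n * L            ∎))
    where
    q₁ : ∀ s n L → suc s * n * L + suc (suc (suc s)) * n * L ≡ 2 * (suc (suc s) * n * L)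
    q₁ = solve-∀
    q₂ : ∀ t n α k L → 2 * (t * n * α + k * L) ≡ 2 * t * (n * α) + 2 * k * L
    q₂ = solve-∀
    q₃ : ∀ s u n α y → s * u * (n * α) + y ≡ u * n * (s * α) + y
    q₃ = solve-∀

-- The width and the number of antichains

Pointwise-el : ∀ {t n} {x y : Point t n} → x ≼ y → Pointwise _≤_ (el x) (el y)
Pointwise-el VecPointwise.[] = []
Pointwise-el (a≤b VecPointwise.∷ x≼y) = a≤b ∷ Pointwise-el x≼y

Pointwise-el⁻ : ∀ {t n} (x y : Point t n) → Pointwise _≤_ (el x) (el y) → x ≼ y
Pointwise-el⁻ [] [] _ = VecPointwise.[]
Pointwise-el⁻ (a ∷ x) (b ∷ y) (a≤b ∷ p) = a≤b VecPointwise.∷ Pointwise-el⁻ x y p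

below-el : ∀ {t n} (x y : Point t n) → below (el x) (el y) ≡ does (x ≼? y)
below-el x y with x ≼? y
... | yes p = ≤⇒below (Pointwise-el p)
... | no ¬p = dec-false (Pointwise.decidable _≤?_ (el x) (el y)) (¬p ∘ Pointwise-el⁻ x y)

A≡cnt : ∀ t n → A t n ≡ count incomp (Points.lists t n)
A≡cnt t n = trans (length-filter-subsets (allPairs? incomparable?) (points t n))
  (trans (countSublists-cong (points t n) pairwise)
         (sym (count-map el incomp (λ x y → does (incomparable? x y))
           (λ x y → cong₂ (λ a b → not a ∧ not b) (below-el x y) (below-el y x)) (points t n))))
  where
  allᵇ-does : ∀ (x : Point t n) S → does (All.all? (incomparable? x) S) ≡ allᵇ (λ y → does (incomparable? x y)) S
  allᵇ-does x [] = refl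
  allᵇ-does x (y ∷ S) = cong (does (incomparable? x y) ∧_) (allᵇ-does x S)
  pairwise : ∀ S → does (allPairs? incomparable? S) ≡ pairwiseᵇ (λ (x y : Point t n) → does (incomparable? x y)) S
  pairwise [] = refl
  pairwise (x ∷ S) = cong₂ _∧_ (allᵇ-does x S) (pairwise S)

≼-sum : ∀ {t n} {x y : Point t n} → x ≼ y → sum (el x) ≤ sum (el y)
≼-sum VecPointwise.[] = z≤n
≼-sum (a≤b VecPointwise.∷ p) = +-mono-≤ a≤b (≼-sum p)

≼-same-rank : ∀ {t n} {x y : Point t n} → x ≼ y → sum (el y) ≤ sum (el x) → x ≡ y
≼-same-rank VecPointwise.[] _ = refl
≼-same-rank {x = a ∷ x} {y = b ∷ y} (a≤b VecPointwise.∷ p) le = cong₂ _∷_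
  (Fin.toℕ-injective (≤-antisym a≤b (+-cancelʳ-≤ (sum (el y)) _ _ (≤-trans le (+-monoʳ-≤ (toℕ a) (≼-sum p))))))
  (≼-same-rank p (+-cancelˡ-≤ (toℕ a) _ _ (≤-trans (+-monoˡ-≤ (sum (el y)) a≤b) le)))

filter∈subsets : ∀ {V : Set} {P : V → Set} (P? : ∀ x → Dec (P x)) xs → filter P? xs ∈ subsets xs
filter∈subsets P? [] = here refl
filter∈subsets P? (x ∷ xs) with does (P? x)
... | true = ∈-++⁺ʳ (subsets xs) (∈-map⁺ (x ∷_) (filter∈subsets P? xs))
... | false = ∈-++⁺ˡ (filter∈subsets P? xs)

≤foldr-⊔ : ∀ {x xs} → x ∈ xs → x ≤ foldr _⊔_ 0 xs
≤foldr-⊔ {xs = y ∷ xs} (here refl) = m≤m⊔n y _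
≤foldr-⊔ {xs = y ∷ xs} (there x∈) = ≤-trans (≤foldr-⊔ x∈) (m≤n⊔m y _)

module Width (t n : ℕ) (0<t : 0 < t) where

  open Layers t
  open Points t
  open Kernel t n 0<t using (lists-distinct)

  points-unique : Unique (points t n)
  points-unique = Unique.map⁻ (unique (lists n) (lists-distinct n))
    where
    unique : ∀ xs → (∀ x → ∑ xs (λ y → ⟦ does (x ≟L y) ⟧) ≤ 1) → Unique xs
    unique [] _ = []
    unique (x ∷ xs) d = All.tabulate fresh ∷ unique xs (λ z → ≤-trans (m≤n+m _ _) (d z))
      where
      fresh : ∀ {y} → y ∈ xs → x ≢ y
      fresh y∈ refl with s≤s () ← ≤-trans (+-mono-≤ (≤-reflexive (cong ⟦_⟧ (sym (dec-true (x ≟L x) refl))))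
        (≤-trans (≤-reflexive (cong ⟦_⟧ (sym (dec-true (x ≟L x) refl)))) (term≤∑ (λ y → ⟦ does (x ≟L y) ⟧) y∈))) (d x)

  -- Comparable points of equal rank coincide, so each layer is among the antichains over which `α`
  -- takes the maximum.
  N≤α : ∀ k → N n k ≤ α t n
  N≤α k = begin
    N n k                                              ≡⟨ sym (∑-rank n k) ⟩
    ∑ (lists n) (λ x → ⟦ sum x ≡ᵇ k ⟧)                 ≡⟨ ∑-map el (points t n) _ ⟩
    ∑ (points t n) (λ p → ⟦ sum (el p) ≡ᵇ k ⟧)         ≡⟨ sym (length-filter (points t n)) ⟩
    length layer                                       ≤⟨ ≤foldr-⊔ (∈-map⁺ length (∈-filter⁺ (allPairs? incomparable?) (filter∈subsets at-k (points t n)) antichain)) ⟩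
    α t n                                              ∎
    where
    open ≤-Reasoning
    at-k : (p : Point t n) → Dec (sum (el p) ≡ k)
    at-k p = sum (el p) ≟ k
    layer : List (Point t n)
    layer = filter at-k (points t n)
    length-filter : ∀ ps → length (filter at-k ps) ≡ ∑ ps (λ p → ⟦ sum (el p) ≡ᵇ k ⟧)
    length-filter [] = refl
    length-filter (p ∷ ps) with sum (el p) ≡ᵇ k
    ... | true = cong suc (length-filter ps)
    ... | false = length-filter ps
    differ : ∀ {x y : Point t n} → sum (el x) ≡ k → sum (el y) ≡ k → x ≢ y → Incomparable x y
    differ sx sy x≢y = (λ p → x≢y (≼-same-rank p (≤-reflexive (trans sy (sym sx))))) ,
                       (λ p → x≢y (sym (≼-same-rank p (≤-reflexive (trans sx (sym sy))))))
    pairs : ∀ ps → All (λ p → sum (el p) ≡ k) ps → Unique ps → AllPairs Incomparable ps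
    pairs [] [] [] = []
    pairs (p ∷ ps) (sp ∷ sps) (fresh ∷ u) = All.zipWith (λ (s , ne) → differ sp s ne) (sps , fresh) ∷ pairs ps sps u
    antichain : AllPairs Incomparable layer
    antichain = pairs layer (All.all-filter at-k (points t n)) (Unique.filter⁺ at-k points-unique)

  0<α : 0 < α t n
  0<α = ≤-trans (≤-reflexive (sym (N-zero 0<t n))) (N≤α 0)

  -- At most `n * t` ranks occur. The polynomial factor lost here is absorbed later by the block
  -- side `n * n` and by the window length.
  t^n≤ : 0 < n → t ^ n ≤ n * t * α t n
  t^n≤ 0<n = begin
    t ^ n                                                            ≡⟨ sym (trans (∑-lists-const n 1) (*-identityʳ _)) ⟩
    ∑ (lists n) (λ _ → 1)                                            ≤⟨ ∑-mono-∈ (lists n) ranked ⟩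
    ∑ (lists n) (λ x → ∑< (n * t) (λ k → ⟦ sum x ≡ᵇ k ⟧))            ≡⟨ ∑-swap (lists n) (downFrom (n * t)) _ ⟩
    ∑< (n * t) (λ k → ∑ (lists n) (λ x → ⟦ sum x ≡ᵇ k ⟧))            ≤⟨ ∑-mono (downFrom (n * t)) (λ k → ≤-trans (≤-reflexive (∑-rank n k)) (N≤α k)) ⟩
    ∑< (n * t) (λ _ → α t n)                                         ≡⟨ ∑<-const (n * t) (α t n) ⟩
    n * t * α t n                                                    ∎
    where
    open ≤-Reasoning
    sum< : ∀ {x} → 0 < length x → All (_< t) x → sum x < length x * t
    sum< {a ∷ []} _ (a<t ∷ []) = +-mono-≤ a<t z≤n
    sum< {a ∷ b ∷ x} _ (a<t ∷ x<t) = +-mono-≤ a<t (<⇒≤ (sum< (s≤s z≤n) x<t))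
    ranked : ∀ x → x ∈ lists n → 1 ≤ ∑< (n * t) (λ k → ⟦ sum x ≡ᵇ k ⟧)
    ranked x x∈ with ∈lists⇒valid x∈
    ... | l , x<t = ≤-trans (≤-reflexive (cong ⟦_⟧ (sym (≡ᵇ-refl (sum x)))))
      (term≤∑ (λ k → ⟦ sum x ≡ᵇ k ⟧) (∈-downFrom⁺ (subst (λ k → sum x < k * t) l (sum< (subst (0 <_) (sym l) 0<n) x<t))))

-- Assembling the bound

n≤2^⌈log₂n⌉ : ∀ n → n ≤ 2 ^ ⌈log₂ n ⌉
n≤2^⌈log₂n⌉ = <-rec (λ n → n ≤ 2 ^ ⌈log₂ n ⌉) step
  where
  step : ∀ n → (∀ {k} → k < n → k ≤ 2 ^ ⌈log₂ k ⌉) → n ≤ 2 ^ ⌈log₂ n ⌉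
  step zero _ = z≤n
  step (suc zero) _ = ≤-refl
  step n@(suc (suc k)) rec = begin
    n                                          ≡⟨ sym (⌊n/2⌋+⌈n/2⌉≡n n) ⟩
    ⌊ n /2⌋ + ⌈ n /2⌉                          ≤⟨ +-monoˡ-≤ ⌈ n /2⌉ (⌊n/2⌋≤⌈n/2⌉ n) ⟩
    ⌈ n /2⌉ + ⌈ n /2⌉                          ≡⟨ cong (⌈ n /2⌉ +_) (sym (+-identityʳ ⌈ n /2⌉)) ⟩
    2 * ⌈ n /2⌉                                ≤⟨ *-monoʳ-≤ 2 (rec (⌈n/2⌉<n k)) ⟩
    2 * 2 ^ ⌈log₂ ⌈ n /2⌉ ⌉                    ≡⟨ cong (λ e → 2 * 2 ^ e) (⌈log₂⌈n/2⌉⌉≡⌈log₂n⌉∸1 n) ⟩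
    2 ^ suc (⌈log₂ n ⌉ ∸ 1)                    ≡⟨ cong (2 ^_) (m+[n∸m]≡n (⌈log₂⌉-mono-≤ {2} {n} (s≤s (s≤s z≤n)))) ⟩
    2 ^ ⌈log₂ n ⌉                              ∎
    where open ≤-Reasoning

2^k<n : ∀ n k → k < ⌈log₂ n ⌉ → 2 ^ k < n
2^k<n n k k< with n ≤? 2 ^ k
... | no ¬p = ≰⇒> ¬p
... | yes p = ⊥-elim (<-irrefl refl (≤-trans k< (≤-trans (⌈log₂⌉-mono-≤ p) (≤-reflexive (⌈log₂2^n⌉≡n k)))))

-- For each test, the points on which it succeeds are split off by `cnt-product` at the price of one
-- factor `Y`.
cnt-strip : ∀ {V : Set} (inc : V → V → Bool) (Ok : List V → Set) (Ok-fil : ∀ p xs → Ok xs → Ok (fil p xs)) Y tests →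
  (∀ b → b ∈ tests → ∀ xs → Ok xs → count inc (fil b xs) ≤ Y) →
  ∀ xs → Ok xs → count inc xs ≤ Y ^ length tests * count inc (fil (λ x → allᵇ (λ b → not (b x)) tests) xs)
cnt-strip inc Ok Ok-fil Y [] small xs ok =
  ≤-reflexive (trans (cong (count inc) (sym (fil-id (λ _ → true) xs (λ _ _ → refl)))) (sym (+-identityʳ _)))
cnt-strip inc Ok Ok-fil Y (b ∷ bs) small xs ok = begin
  count inc xs
    ≤⟨ cnt-product b xs ⟩
  count inc (fil b xs) * count inc (fil (not ∘ b) xs)
    ≤⟨ *-mono-≤ (small b (here refl) xs ok) (cnt-strip inc Ok Ok-fil Y bs (λ b b∈ → small b (there b∈)) (fil (not ∘ b) xs) (Ok-fil (not ∘ b) xs ok)) ⟩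
  Y * (Y ^ length bs * count inc (fil (λ x → allᵇ (λ b → not (b x)) bs) (fil (not ∘ b) xs)))
    ≡⟨ sym (*-assoc Y _ _) ⟩
  Y ^ suc (length bs) * count inc (fil (λ x → allᵇ (λ b → not (b x)) bs) (fil (not ∘ b) xs))
    ≡⟨ cong (λ ys → Y ^ suc (length bs) * count inc ys) (fil-fil (λ x → allᵇ (λ b → not (b x)) bs) (not ∘ b) xs) ⟩
  Y ^ suc (length bs) * count inc (fil (λ x → not (b x) ∧ allᵇ (λ b → not (b x)) bs) xs) ∎
  where
  open ≤-Reasoning
  open Antichains inc using (cnt-product)

allᵇ-∈ : ∀ {V : Set} (p : V → Bool) {xs x} → allᵇ p xs ≡ true → x ∈ xs → p x ≡ true
allᵇ-∈ p {y ∷ xs} e (here refl) = proj₁ (∧-true {p y} e)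
allᵇ-∈ p {y ∷ xs} e (there x∈) = allᵇ-∈ p (proj₂ (∧-true {p y} e)) x∈

-- n / α times the logarithm of the number of antichains exceeds n by at most this, if C bounds the spread of the random step.
coefficient : ℕ → ℕ → ℕ
coefficient L C = (2 * I + 1) * (1 + 8 * (I * K)) + 2 * (I * I) + 3
  where
  I K : ℕ
  -- For `n ≤ 2 ^ L` this gives `4 * n ^ 6 ≤ 2 ^ I`: enough halvings for the containers.
  I = 6 * L + 2
  K = 8 * (L + 48) + suc L * C

module Assembly (t m L o g : ℕ) (1<t : 1 < t) (512≤g : 512 ≤ g) (n≤2^L : 2 + m ≤ 2 ^ L)
  (m≡ : m ≡ 8 * (L + 48) + o) (n≤α : 2 + m ≤ α t (2 + m)) where

  open Spread t (2 + m) 1<t (s≤s z≤n)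
  open Layers t
  open Points t
  open Kernel t (2 + m) 0<t
  open RandomChain t (2 + m) 0<t (s≤s z≤n)
  open GridPlanes t m 0<t
  open Deviation t 0<t
  open Width t (2 + m) 0<t
  open Antichains incomp

  private
    a l′ : ℕ
    a = α t n
    l′ = L + 48

    l≤m : 8 * l′ ≤ m
    l≤m = ≤-trans (m≤m+n (8 * l′) o) (≤-reflexive (sym m≡))

    t^≤na : t * t ^ m ≤ n * a
    t^≤na = *-cancelˡ-≤ t ⦃ >-nonZero 0<t ⦄ (≤-trans (t^n≤ (s≤s z≤n)) (≤-reflexive (r n t a)))
      where
      r : ∀ n t a → n * t * a ≡ t * (n * a)
      r = solve-∀

    bad : (ℕ → Bool) → ℕ → List ℕ → Bool
    bad p ρ x = does (many p (take (8 * l′) (rots ρ x)) ≤? l′)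

    -- The window lies within the first `m` rotated coordinates, so whether a point is bad depends
    -- only on its plane. These are the keys of the bad planes.
    few : (ℕ → Bool) → List (List ℕ)
    few p = fil (λ w → does (many p (take (8 * l′) w) ≤? l′)) (lists m)

    few≤ : ∀ p → t ≤ 2 * ∑< t (⟦_⟧ ∘ p) → length (few p) * 2 ^ (3 * l′) ≤ t ^ m
    few≤ p half = subst (λ k → length (fil (λ w → does (many p (take (8 * l′) w) ≤? l′)) (lists k)) * 2 ^ (3 * l′) ≤ t ^ k)
      (sym m≡) (deviation p l′ o half)

    cnt-bad : ∀ p ρ xs → Grid xs → cnt (fil (bad p ρ) xs) ≤ 2 ^ (length (few p) * (4 * t))
    cnt-bad p ρ xs grid = cnt-by-planes ρ (few p) (fil (bad p ρ) xs) (Grid-fil (bad p ρ) xs grid) in-few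
      where
      in-few : ∀ x → x ∈ fil (bad p ρ) xs → key ρ x ∈ few p
      in-few x x∈ with ∈-fil⁻ (bad p ρ) xs x∈
      ... | x∈xs , b = ∈-fil⁺ _ (key∈ ρ x∈l) (trans (cong (λ w → does (many p w ≤? l′)) window) b)
        where
        x∈l : x ∈ lists n
        x∈l = proj₁ grid x x∈xs
        window : take (8 * l′) (key ρ x) ≡ take (8 * l′) (rots ρ x)
        window = sym (trans (cong (take (8 * l′)) (sym (take++drop≡id m (rots ρ x)))) (take-++-≤ (8 * l′) (key ρ x) (drop m (rots ρ x))
          (≤-trans l≤m (≤-reflexive (sym (proj₁ (∈lists⇒valid (key∈ ρ x∈l))))))))

    tests : List (List ℕ → Bool)
    tests = map (bad upper) (downFrom (2 * n)) ++ map (bad lower) (downFrom (2 * n))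

    length-tests : length tests ≡ 4 * n
    length-tests = trans (length-++ (map (bad upper) (downFrom (2 * n)))) (trans
      (cong₂ _+_ (trans (length-map (bad upper) (downFrom (2 * n))) (length-downFrom (2 * n))) (trans (length-map (bad lower) (downFrom (2 * n))) (length-downFrom (2 * n)))) (r n))
      where
      r : ∀ n → 2 * n + 2 * n ≡ 4 * n
      r = solve-∀

    b : ℕ
    b = length (few upper) * (4 * t) + length (few lower) * (4 * t)

    tests-small : ∀ f → f ∈ tests → ∀ xs → Grid xs → cnt (fil f xs) ≤ 2 ^ b
    tests-small f f∈ xs grid with ∈-++⁻ (map (bad upper) (downFrom (2 * n))) f∈
    ... | inj₁ f∈u with ∈-map⁻ (bad upper) {xs = downFrom (2 * n)} f∈u
    ... | ρ , _ , refl = ≤-trans (cnt-bad upper ρ xs grid) (^-monoʳ-≤ 2 (m≤m+n (length (few upper) * (4 * t)) _))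
    tests-small f f∈ xs grid | inj₂ f∈l with ∈-map⁻ (bad lower) {xs = downFrom (2 * n)} f∈l
    ... | ρ , _ , refl = ≤-trans (cnt-bad lower ρ xs grid) (^-monoʳ-≤ 2 (m≤n+m (length (few lower) * (4 * t)) (length (few upper) * (4 * t))))

    good : List ℕ → Bool
    good x = allᵇ (λ f → not (f x)) tests

    good⇒balanced : ∀ x → good x ≡ true → Balanced (8 * l′) l′ x
    good⇒balanced x e ρ ρ< =
      enough upper (∈-++⁺ˡ (∈-map⁺ (bad upper) (∈-downFrom⁺ ρ<))) ,
      enough lower (∈-++⁺ʳ (map (bad upper) (downFrom (2 * n))) (∈-map⁺ (bad lower) (∈-downFrom⁺ ρ<)))
      where
      enough : ∀ p → bad p ρ ∈ tests → l′ ≤ many p (take (8 * l′) (rots ρ x))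
      enough p p∈ with many p (take (8 * l′) (rots ρ x)) ≤? l′
      ... | no ¬q = <⇒≤ (≰⇒> ¬q)
      ... | yes q with () ← trans (sym (dec-true (many p (take (8 * l′) (rots ρ x)) ≤? l′) q)) (not-true (allᵇ-∈ (λ f → not (f x)) e p∈))

    Ok : List (List ℕ) → Set
    Ok W = Grid W × (∀ x → x ∈ W → good x ≡ true)

    Ok-fil : ∀ p xs → Ok xs → Ok (fil p xs)
    Ok-fil p xs (grid , gs) = Grid-fil p xs grid , (λ x x∈ → gs x (proj₁ (∈-fil⁻ p xs x∈)))

    open Degrees incomp _≟L_ incomp-sym incomp-irrefl Ok Ok-fil (λ xs ok → proj₂ (proj₁ ok))

    -- `K` is the bound of `spread`, and `e₀` is the excess that `dense⇒⊥` demands for degree `I`,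
    -- rounded up. In phase `i` both degree and excess are multiplied by `2 ^ i`, which keeps that
    -- condition true.
    K I e₀ : ℕ
    K = 8 * l′ + suc L * (8 * (2 ^ g) ^ 3)
    I = 6 * L + 2
    e₀ = suc (8 * (I * K * a) / n)

    8IKa≤ : 8 * (I * K * a) ≤ n * e₀
    8IKa≤ = <⇒≤ (m<n*suc[m/n] (8 * (I * K * a)) n)

    ne₀≤ : n * e₀ ≤ a + 8 * (I * K * a)
    ne₀≤ = begin
      n * e₀                                    ≡⟨ *-suc n _ ⟩
      n + n * (8 * (I * K * a) / n)             ≤⟨ +-mono-≤ n≤α (≤-trans (≤-reflexive (*-comm n (8 * (I * K * a) / n))) (m/n*n≤m (8 * (I * K * a)) n)) ⟩
      a + 8 * (I * K * a)                       ∎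
      where open ≤-Reasoning

    search : ∀ (h : List ℕ → ℕ) d W → (Σ (List ℕ) (λ x → x ∈ W × d < h x)) ⊎ (∀ x → x ∈ W → h x ≤ d)
    search h d [] = inj₂ (λ _ ())
    search h d (x ∷ W) with h x ≤? d | search h d W
    ... | no ¬p | _ = inj₁ (x , here refl , ≰⇒> ¬p)
    ... | yes p | inj₁ (y , y∈ , q) = inj₁ (y , there y∈ , q)
    ... | yes p | inj₂ rest = inj₂ (λ { _ (here refl) → p ; y (there y∈) → rest y y∈ })

    high : ∀ i W → i < I → Ok W → a + 2 ^ i * e₀ < length W → HighDegree (2 ^ i * I) W
    high i W _ ok big with search (λ x → ∑ W (λ y → ⟦ lt x y ⟧)) (2 ^ i * I) W
    ... | inj₂ low = ⊥-elim (dense⇒⊥ n a K (2 ^ i * I) (2 ^ i * e₀) (length W) (s≤s z≤n) 0<α scaled big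
          (supersaturated a K (2 ^ i * I) W N≤α (proj₁ (proj₁ ok)) (proj₂ (proj₁ ok))
            (λ x y x∈ y∈ → spread g 512≤g l′ L (≤-trans (m≤m+n 32 16) (m≤n+m 48 L)) n≤2^L x y x∈
               (∈lists⇒valid (proj₁ (proj₁ ok) y y∈)) (good⇒balanced y (proj₂ ok y y∈))) low))
      where
      r₁ : ∀ p I K a → 8 * (p * I * K * a) ≡ p * (8 * (I * K * a))
      r₁ = solve-∀
      r₂ : ∀ p n e → p * (n * e) ≡ n * (p * e)
      r₂ = solve-∀
      scaled : 8 * (2 ^ i * I * K * a) ≤ n * (2 ^ i * e₀)
      scaled = ≤-trans (≤-reflexive (r₁ (2 ^ i) I K a)) (≤-trans (*-monoʳ-≤ (2 ^ i) 8IKa≤) (≤-reflexive (r₂ (2 ^ i) n e₀)))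
    ... | inj₁ (x , x∈ , deg) = x , x∈ , (begin
      length (fil (incomp x) W) + suc (2 ^ i * I)               ≤⟨ +-mono-≤ (≤-reflexive (length-fil (incomp x) W)) deg ⟩
      ∑ W (λ y → ⟦ incomp x y ⟧) + ∑ W (λ y → ⟦ lt x y ⟧)       ≡⟨ sym (∑-+ W _ _) ⟩
      ∑ W (λ y → ⟦ incomp x y ⟧ + ⟦ lt x y ⟧)                   ≤⟨ ∑-mono W exclusive ⟩
      ∑ W (λ _ → 1)                                             ≡⟨ sym (length-∑ W) ⟩
      length W                                                  ∎)
      where
      open ≤-Reasoning
      exclusive : ∀ y → ⟦ incomp x y ⟧ + ⟦ lt x y ⟧ ≤ 1
      exclusive y with lt x y in e
      ... | false = ≤-trans (≤-reflexive (+-identityʳ _)) (⟦⟧≤1 (incomp x y))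
      ... | true rewrite ≤⇒¬incomp {x} {y} (proj₁ (lt⇒≤ x y e)) = ≤-refl

    -- There are `t ^ m ≤ n * a / t` planes, and a path in one of them takes
    -- `2 * e ≤ 2 * t / (n * n)` choices. The side `n * n` thus makes all paths together cost at
    -- most `2 * a / n` bits.
    q e : ℕ
    q = n * n
    e = pred t / q

    eq≤t : e * q ≤ t
    eq≤t = ≤-trans (m/n*n≤m (pred t) q) pred[n]≤n

    t^me≤ : n * (t ^ m * (e + e)) ≤ 2 * a
    t^me≤ = *-cancelˡ-≤ n (begin
      n * (n * (t ^ m * (e + e)))      ≡⟨ r₁ n (t ^ m) e ⟩
      2 * (e * (n * n) * t ^ m)        ≤⟨ *-monoʳ-≤ 2 (≤-trans (*-monoˡ-≤ (t ^ m) eq≤t) t^≤na) ⟩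
      2 * (n * a)                      ≡⟨ r₂ n a ⟩
      n * (2 * a)                      ∎)
      where
      open ≤-Reasoning
      r₁ : ∀ n x e → n * (n * (x * (e + e))) ≡ 2 * (e * (n * n) * x)
      r₁ = solve-∀
      r₂ : ∀ n a → 2 * (n * a) ≡ n * (2 * a)
      r₂ = solve-∀

    2^I : n ^ 6 * 4 ≤ 2 ^ I
    2^I = begin
      n ^ 6 * 4               ≤⟨ *-monoˡ-≤ 4 (^-monoˡ-≤ 6 n≤2^L) ⟩
      (2 ^ L) ^ 6 * 4         ≡⟨ cong (_* 4) (trans (^-*-assoc 2 L 6) (cong (2 ^_) (*-comm L 6))) ⟩
      2 ^ (6 * L) * 2 ^ 2     ≡⟨ sym (^-distribˡ-+-* 2 (6 * L) 2) ⟩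
      2 ^ I                   ∎
      where open ≤-Reasoning

    -- The containers have at most `3 * n ^ 5 * a` points, and `a ≤ n * e₀`; this determines the
    -- number `I` of phases.
    container-size : t ^ m * ((e + e + 1) * (q * q)) ≤ a + 2 ^ I * e₀
    container-size = ≤-trans (*-cancelˡ-≤ n (begin
      n * (t ^ m * ((e + e + 1) * (q * q)))               ≡⟨ r₁ n (t ^ m) e q ⟩
      n * t ^ m * (e * q * (2 * q) + q * q)               ≤⟨ *-monoʳ-≤ (n * t ^ m) (+-mono-≤ (≤-trans (*-monoˡ-≤ (2 * q) eq≤t) (*-monoʳ-≤ t (*-monoʳ-≤ 2 q≤qq)))
                                                                (≤-trans (≤-reflexive (sym (+-identityʳ (q * q)))) (*-monoˡ-≤ (q * q) 0<t))) ⟩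
      n * t ^ m * (t * (2 * (q * q)) + t * (q * q))       ≡⟨ r₂ n (t ^ m) t q ⟩
      3 * (n * (q * q)) * (t * t ^ m)                     ≤⟨ *-monoʳ-≤ (3 * (n * (q * q))) t^≤na ⟩
      3 * (n * (q * q)) * (n * a)                         ≡⟨ r₃ n a ⟩
      n ^ 6 * 3 * a                                       ≤⟨ *-monoˡ-≤ a (*-monoʳ-≤ (n ^ 6) (n≤1+n 3)) ⟩
      n ^ 6 * 4 * a                                       ≤⟨ *-mono-≤ 2^I a≤ ⟩
      2 ^ I * (n * e₀)                                    ≡⟨ r₄ (2 ^ I) n e₀ ⟩
      n * (2 ^ I * e₀)                                    ∎)) (m≤n+m _ a)
      where
      open ≤-Reasoning
      r₁ : ∀ n x e q → n * (x * ((e + e + 1) * (q * q))) ≡ n * x * (e * q * (2 * q) + q * q)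
      r₁ = solve-∀
      r₂ : ∀ n x t q → n * x * (t * (2 * (q * q)) + t * (q * q)) ≡ 3 * (n * (q * q)) * (t * x)
      r₂ = solve-∀
      r₃ : ∀ n a → 3 * (n * ((n * n) * (n * n))) * (n * a) ≡ (n * (n * (n * (n * (n * (n * 1)))))) * 3 * a
      r₃ = solve-∀
      r₄ : ∀ p n e → p * (n * e) ≡ n * (p * e)
      r₄ = solve-∀
      q≤qq : q ≤ q * q
      q≤qq = ≤-trans (≤-reflexive (sym (*-identityʳ q))) (*-monoʳ-≤ q {1} {q} (s≤s z≤n))
      a≤ : a ≤ n * e₀
      a≤ = ≤-trans (≤-trans (≤-trans (≤-reflexive (sym (+-identityʳ a))) (*-monoˡ-≤ a 1≤IK)) (m≤m+n (I * K * a) _)) 8IKa≤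
        where
        1≤IK : 1 ≤ I * K
        1≤IK = *-mono-≤ (≤-trans (m≤m+n 1 1) (m≤n+m 2 (6 * L))) (≤-trans (≤-trans (≤-trans (m≤m+n 1 47) (m≤n+m 48 L)) (m≤m+n l′ _)) (m≤m+n (8 * l′) _))

    X : ℕ
    X = (4 ^ (e₀ + I)) ^ I * 2 ^ (a + e₀)

    cnt-good : cnt (fil good (lists n)) ≤ 2 ^ (t ^ m * (e + e)) * X
    cnt-good = subst (λ k → cnt W ≤ 2 ^ (k * (e + e)) * X) (length-lists m)
      (cnt-grid 0 q (lists m) W X (proj₁ ok) (λ x x∈ → key∈ 0 (proj₁ (proj₁ ok) x x∈))
        (λ p len → phases a e₀ I high I ≤-refl (fil p W) (Ok-fil p W ok)
          (≤-trans len (≤-trans (≤-reflexive (cong (_* ((e + e + 1) * (q * q))) (length-lists m))) container-size))))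
      where
      W : List (List ℕ)
      W = fil good (lists n)
      ok : Ok W
      ok = Grid-fil good (lists n) Grid-lists , (λ x x∈ → proj₂ (∈-fil⁻ good (lists n) x∈))

    -- At most a fraction `2 ^ (3 * l′)` to the power -1 of the planes is bad for a given test. With
    -- `l′ = L + 48`, the power `2 ^ (3 * l′)` exceeds `32 * n ^ 3`, which covers the `4 * n` tests,
    -- the factor `n` in front and the factor `n` lost in `t^≤na`.
    tests-cost : n * (b * (4 * n)) ≤ a
    tests-cost = *-cancelˡ-≤ P₃ ⦃ m^n≢0 2 (3 * l′) ⦄ (begin
      P₃ * (n * (b * (4 * n)))                                ≡⟨ r₁ P₃ n (length (few upper)) (length (few lower)) t ⟩
      16 * (n * n) * (t * (length (few upper) * P₃ + length (few lower) * P₃)) ≤⟨ *-monoʳ-≤ (16 * (n * n)) (*-monoʳ-≤ t (+-mono-≤ (few≤ upper upper-half) (few≤ lower lower-half))) ⟩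
      16 * (n * n) * (t * (t ^ m + t ^ m))                    ≡⟨ r₂ n t (t ^ m) ⟩
      32 * (n * n) * (t * t ^ m)                              ≤⟨ *-monoʳ-≤ (32 * (n * n)) t^≤na ⟩
      32 * (n * n) * (n * a)                                  ≡⟨ r₃ n a ⟩
      n ^ 3 * 32 * a                                          ≤⟨ *-monoˡ-≤ a (*-mono-≤ (^-monoˡ-≤ 3 n≤2^L) (^-monoʳ-≤ 2 (m≤m+n 5 139))) ⟩
      (2 ^ L) ^ 3 * 2 ^ 144 * a                               ≡⟨ cong (_* a) (trans (cong (_* 2 ^ 144) (trans (^-*-assoc 2 L 3) (cong (2 ^_) (*-comm L 3))))
                                                                   (trans (sym (^-distribˡ-+-* 2 (3 * L) (3 * 48))) (cong (2 ^_) (sym (*-distribˡ-+ 3 L 48))))) ⟩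
      P₃ * a                                                  ∎)
      where
      open ≤-Reasoning
      P₃ : ℕ
      P₃ = 2 ^ (3 * l′)
      r₁ : ∀ P n u v t → P * (n * ((u * (4 * t) + v * (4 * t)) * (4 * n))) ≡ 16 * (n * n) * (t * (u * P + v * P))
      r₁ = solve-∀
      r₂ : ∀ n t x → 16 * (n * n) * (t * (x + x)) ≡ 32 * (n * n) * (t * x)
      r₂ = solve-∀
      r₃ : ∀ n a → 32 * (n * n) * (n * a) ≡ (n * (n * (n * 1))) * 32 * a
      r₃ = solve-∀

    T : ℕ
    T = b * (4 * n) + (t ^ m * (e + e) + (2 * ((e₀ + I) * I) + (a + e₀)))

    cnt-all : cnt (lists n) ≤ 2 ^ T
    cnt-all = begin
      cnt (lists n)
        ≤⟨ cnt-strip incomp Grid Grid-fil (2 ^ b) tests tests-small (lists n) Grid-lists ⟩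
      (2 ^ b) ^ length tests * cnt (fil good (lists n))
        ≡⟨ cong (_* cnt (fil good (lists n))) (trans (^-*-assoc 2 b (length tests)) (cong (λ k → 2 ^ (b * k)) length-tests)) ⟩
      2 ^ (b * (4 * n)) * cnt (fil good (lists n))
        ≤⟨ *-monoʳ-≤ (2 ^ (b * (4 * n))) cnt-good ⟩
      2 ^ (b * (4 * n)) * (2 ^ (t ^ m * (e + e)) * X)
        ≡⟨ cong (λ k → 2 ^ (b * (4 * n)) * (2 ^ (t ^ m * (e + e)) * k)) X≡ ⟩
      2 ^ (b * (4 * n)) * (2 ^ (t ^ m * (e + e)) * 2 ^ (2 * ((e₀ + I) * I) + (a + e₀)))
        ≡⟨ cong (2 ^ (b * (4 * n)) *_) (sym (^-distribˡ-+-* 2 (t ^ m * (e + e)) _)) ⟩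
      2 ^ (b * (4 * n)) * 2 ^ (t ^ m * (e + e) + (2 * ((e₀ + I) * I) + (a + e₀)))
        ≡⟨ sym (^-distribˡ-+-* 2 (b * (4 * n)) _) ⟩
      2 ^ T ∎
      where
      open ≤-Reasoning
      X≡ : X ≡ 2 ^ (2 * ((e₀ + I) * I) + (a + e₀))
      X≡ = trans (cong (_* 2 ^ (a + e₀)) (trans (^-*-assoc 4 (e₀ + I) I) (^-*-assoc 2 2 ((e₀ + I) * I)))) (sym (^-distribˡ-+-* 2 (2 * ((e₀ + I) * I)) (a + e₀)))

    -- `n≤α` turns the terms that lack a factor `a` into multiples of `a`: the rounding of `e₀` and
    -- the fixed cost `2 * (I * I)` of the phases.
    exponent : T * n ≤ n * a + coefficient L (8 * (2 ^ g) ^ 3) * a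
    exponent = begin
      T * n
        ≡⟨ r₁ (b * (4 * n)) (t ^ m * (e + e)) e₀ I a n ⟩
      n * a + (2 * I + 1) * (n * e₀) + 2 * (I * I) * n + n * (b * (4 * n)) + n * (t ^ m * (e + e))
        ≤⟨ +-mono-≤ (+-mono-≤ (+-mono-≤ (+-monoʳ-≤ (n * a) (*-monoʳ-≤ (2 * I + 1) ne₀≤)) (*-monoʳ-≤ (2 * (I * I)) n≤α)) tests-cost) t^me≤ ⟩
      n * a + (2 * I + 1) * (a + 8 * (I * K * a)) + 2 * (I * I) * a + a + 2 * a
        ≡⟨ r₂ (n * a) I K a ⟩
      n * a + coefficient L (8 * (2 ^ g) ^ 3) * a ∎
      where
      open ≤-Reasoning
      r₁ : ∀ x y e I a n → (x + (y + (2 * ((e + I) * I) + (a + e)))) * n ≡ n * a + (2 * I + 1) * (n * e) + 2 * (I * I) * n + n * x + n * y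
      r₁ = solve-∀
      r₂ : ∀ z I K a → z + (2 * I + 1) * (a + 8 * (I * K * a)) + 2 * (I * I) * a + a + 2 * a ≡ z + ((2 * I + 1) * (1 + 8 * (I * K)) + 2 * (I * I) + 3) * a
      r₂ = solve-∀

  A-bound : A t n ^ n ≤ 2 ^ (n * α t n + coefficient L (8 * (2 ^ g) ^ 3) * α t n)
  A-bound = begin
    A t n ^ n                ≡⟨ cong (_^ n) (A≡cnt t n) ⟩
    cnt (lists n) ^ n        ≤⟨ ^-monoˡ-≤ n cnt-all ⟩
    (2 ^ T) ^ n              ≡⟨ ^-*-assoc 2 T n ⟩
    2 ^ (T * n)              ≤⟨ ^-monoʳ-≤ 2 exponent ⟩
    2 ^ (n * a + coefficient L (8 * (2 ^ g) ^ 3) * a) ∎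
    where open ≤-Reasoning

-- The absolute constant and the ranges of small and large dimension

leading : ℕ → ℕ
leading C = 17 * (1 + 64 * (392 + 2 * C)) + 131

-- `I` and `K` are linear in `L`, and the dominant term is a multiple of `I * I * K`.
coefficient≤ : ∀ L C → 1 ≤ L → coefficient L C ≤ leading C * L ^ 3
coefficient≤ L C 1≤L = begin
  (2 * I + 1) * (1 + 8 * (I * K)) + 2 * (I * I) + 3
    ≤⟨ +-mono-≤ (+-mono-≤ (*-mono-≤ 2I+1≤ 8IK≤) (*-monoʳ-≤ 2 (*-mono-≤ I≤ I≤))) (*-monoʳ-≤ 3 1≤L³) ⟩
  17 * L * ((1 + 64 * K₀) * (L * L)) + 2 * (8 * L * (8 * L)) + 3 * L ^ 3
    ≡⟨ r₁ L K₀ ⟩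
  17 * (1 + 64 * K₀) * L ^ 3 + 128 * (1 * (L * L)) + 3 * L ^ 3
    ≤⟨ +-monoˡ-≤ (3 * L ^ 3) (+-monoʳ-≤ (17 * (1 + 64 * K₀) * L ^ 3) (*-monoʳ-≤ 128 (*-monoˡ-≤ (L * L) 1≤L))) ⟩
  17 * (1 + 64 * K₀) * L ^ 3 + 128 * (L * (L * L)) + 3 * L ^ 3
    ≡⟨ r₂ (17 * (1 + 64 * K₀)) L ⟩
  (17 * (1 + 64 * K₀) + 131) * L ^ 3 ∎
  where
  open ≤-Reasoning
  I K K₀ : ℕ
  I = 6 * L + 2
  K = 8 * (L + 48) + suc L * C
  K₀ = 392 + 2 * C
  c≤ : ∀ c → c ≤ c * L
  c≤ c = ≤-trans (≤-reflexive (sym (*-identityʳ c))) (*-monoʳ-≤ c 1≤L)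
  1≤LL : 1 ≤ L * L
  1≤LL = *-mono-≤ 1≤L 1≤L
  1≤L³ : 1 ≤ L ^ 3
  1≤L³ = *-mono-≤ 1≤L (*-mono-≤ 1≤L (*-mono-≤ 1≤L ≤-refl))
  I≤ : I ≤ 8 * L
  I≤ = ≤-trans (+-monoʳ-≤ (6 * L) (c≤ 2)) (≤-reflexive (sym (*-distribʳ-+ L 6 2)))
  2I+1≤ : 2 * I + 1 ≤ 17 * L
  2I+1≤ = ≤-trans (+-mono-≤ (*-monoʳ-≤ 2 I≤) 1≤L) (≤-reflexive (s L))
    where
    s : ∀ L → 2 * (8 * L) + L ≡ 17 * L
    s = solve-∀
  K≤ : K ≤ K₀ * L
  K≤ = ≤-trans (+-mono-≤ (*-monoʳ-≤ 8 (+-monoʳ-≤ L (c≤ 48))) (*-monoˡ-≤ C (≤-trans (+-monoˡ-≤ L 1≤L) (≤-reflexive (cong (L +_) (sym (+-identityʳ L))))))) (≤-reflexive (s L C))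
    where
    s : ∀ L C → 8 * (L + 48 * L) + 2 * L * C ≡ (392 + 2 * C) * L
    s = solve-∀
  8IK≤ : 1 + 8 * (I * K) ≤ (1 + 64 * K₀) * (L * L)
  8IK≤ = ≤-trans (+-mono-≤ 1≤LL (*-monoʳ-≤ 8 (*-mono-≤ I≤ K≤))) (≤-reflexive (s L K₀))
    where
    s : ∀ L k → L * L + 8 * (8 * L * (k * L)) ≡ (1 + 64 * k) * (L * L)
    s = solve-∀
  r₁ : ∀ L k → 17 * L * ((1 + 64 * k) * (L * L)) + 2 * (8 * L * (8 * L)) + 3 * (L * (L * (L * 1))) ≡
               17 * (1 + 64 * k) * (L * (L * (L * 1))) + 128 * (1 * (L * L)) + 3 * (L * (L * (L * 1)))
  r₁ = solve-∀
  r₂ : ∀ x L → x * (L * (L * (L * 1))) + 128 * (L * (L * L)) + 3 * (L * (L * (L * 1))) ≡ (x + 131) * (L * (L * (L * 1)))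
  r₂ = solve-∀

-- From dimension 7 on, `n * n` is at most `2 ^ (n - 1)`, so the pigeonhole bound `t^n≤` is already
-- strong enough.
n≤α : ∀ t k → 1 < t → k + 7 ≤ α t (k + 7)
n≤α t k 1<t = *-cancelˡ-≤ (n * t) ⦃ m*n≢0 n t ⦃ >-nonZero 0<n ⦄ ⦃ >-nonZero 0<t ⦄ ⦄ (begin
  n * t * n           ≡⟨ r n t ⟩
  t * (n * n)         ≤⟨ *-monoʳ-≤ t (≤-trans (square k) (≤-trans (≤-reflexive (sym (^-distribˡ-+-* 2 k 6))) (^-monoˡ-≤ (k + 6) 1<t))) ⟩
  t ^ suc (k + 6)     ≡⟨ cong (t ^_) (sym (+-suc k 6)) ⟩
  t ^ n               ≤⟨ Width.t^n≤ t n 0<t 0<n ⟩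
  n * t * α t n       ∎)
  where
  open ≤-Reasoning
  n : ℕ
  n = k + 7
  0<n : 0 < n
  0<n = ≤-trans (s≤s z≤n) (m≤n+m 7 k)
  0<t : 0 < t
  0<t = <⇒≤ 1<t
  r : ∀ n t → n * t * n ≡ t * (n * n)
  r = solve-∀
  square : ∀ k → (k + 7) * (k + 7) ≤ 2 ^ k * 64
  square zero = m≤m+n 49 15
  square (suc k) = ≤-trans (m≤m+n (suc (k + 7) * suc (k + 7)) (k * k + 12 * k + 34))
    (≤-trans (≤-reflexive (s k)) (≤-trans (*-monoʳ-≤ 2 (square k)) (≤-reflexive (sym (*-assoc 2 (2 ^ k) 64)))))
    where
    s : ∀ k → (1 + (k + 7)) * (1 + (k + 7)) + (k * k + 12 * k + 34) ≡ 2 * ((k + 7) * (k + 7))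
    s = solve-∀

-- The logarithm is `k + 10`. At `k = 0` the claim reduces to `466 ≤ 512`, and with logarithm 9 it
-- would fail; this fixes where the large range begins.
room : ∀ m k → 2 ^ (k + 9) ≤ 2 + m → 8 * (k + 10 + 48) ≤ m
room m k le = +-cancelˡ-≤ 2 _ _ (≤-trans (≤-reflexive (s k)) (≤-trans (grow k) (≤-trans (≤-reflexive (sym (^-distribˡ-+-* 2 k 9))) le)))
  where
  s : ∀ k → 2 + 8 * (k + 10 + 48) ≡ 8 * k + 466
  s = solve-∀
  grow : ∀ k → 8 * k + 466 ≤ 2 ^ k * 512
  grow zero = m≤m+n 466 46
  grow (suc k) = ≤-trans (m≤m+n (8 * suc k + 466) (8 * k + 458))
    (≤-trans (≤-reflexive (s′ k)) (≤-trans (*-monoʳ-≤ 2 (grow k)) (≤-reflexive (sym (*-assoc 2 (2 ^ k) 512)))))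
    where
    s′ : ∀ k → 8 * (1 + k) + 466 + (8 * k + 458) ≡ 2 * (8 * k + 466)
    s′ = solve-∀

large-bound : ∀ g c t m L → 512 ≤ g → 1 < t → 8 * (L + 48) ≤ m → 2 + m ≤ 2 ^ L →
  coefficient L (8 * (2 ^ g) ^ 3) ≤ c * L ^ 3 →
  A t (2 + m) ^ (2 + m) ≤ 2 ^ ((2 + m) * α t (2 + m) + c * α t (2 + m) * L ^ 3)
large-bound g c t m L 512≤g 1<t room n≤ coefficient≤c =
  ≤-trans (Assembly.A-bound t m L (proj₁ rest) g 1<t 512≤g n≤ (sym (proj₂ rest)) (enough (m≤n⇒∃[o]m+o≡n 5≤m)))
  (^-monoʳ-≤ 2 (+-monoʳ-≤ ((2 + m) * a) (≤-trans (*-monoˡ-≤ a coefficient≤c) (≤-reflexive (r c (L ^ 3) a)))))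
  where
  a : ℕ
  a = α t (2 + m)
  r : ∀ c l a → c * l * a ≡ c * a * l
  r = solve-∀
  rest : ∃ (λ o → 8 * (L + 48) + o ≡ m)
  rest = m≤n⇒∃[o]m+o≡n room
  5≤m : 5 ≤ m
  5≤m = ≤-trans (≤-trans (m≤m+n 5 43) (m≤n+m 48 L)) (≤-trans (m≤m+n (L + 48) _) room)
  enough : ∃ (λ j → 5 + j ≡ m) → 2 + m ≤ α t (2 + m)
  enough (j , refl) = subst (λ n → n ≤ α t n) (+-comm j 7) (n≤α t j 1<t)

-- In dimension at most `2 ^ 9`, counting plane by plane costs `4 * n * n * a` in the exponent, and
-- `4 * n * n` is at most `2 ^ 20`.
small-bound : ∀ c t m L → 2 ^ 20 ≤ c → 1 < t → 1 ≤ L → L < 10 → 2 + m ≤ 2 ^ L →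
  A t (2 + m) ^ (2 + m) ≤ 2 ^ ((2 + m) * α t (2 + m) + c * α t (2 + m) * L ^ 3)
small-bound c t m L 2^20≤c 1<t 1≤L L<10 n≤ = begin
  A t n ^ n                              ≡⟨ cong (_^ n) (A≡cnt t n) ⟩
  count incomp (lists n) ^ n             ≤⟨ ^-monoˡ-≤ n (cnt-by-planes 0 (lists m) (lists n) Grid-lists (λ x x∈ → key∈ 0 x∈)) ⟩
  (2 ^ (length (lists m) * (4 * t))) ^ n ≡⟨ ^-*-assoc 2 (length (lists m) * (4 * t)) n ⟩
  2 ^ (length (lists m) * (4 * t) * n)   ≤⟨ ^-monoʳ-≤ 2 (≤-trans few (m≤n+m _ (n * a))) ⟩
  2 ^ (n * a + c * a * L ^ 3) ∎
  where
  open ≤-Reasoning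
  0<t : 0 < t
  0<t = <⇒≤ 1<t
  open Points t
  open GridPlanes t m 0<t
  a : ℕ
  a = α t n
  n≤2^9 : n ≤ 2 ^ 9
  n≤2^9 = ≤-trans n≤ (^-monoʳ-≤ 2 (≤-pred L<10))
  1≤L³ : 1 ≤ L ^ 3
  1≤L³ = *-mono-≤ 1≤L (*-mono-≤ 1≤L (*-mono-≤ 1≤L ≤-refl))
  r₁ : ∀ x t n → x * (4 * t) * n ≡ 4 * n * (t * x)
  r₁ = solve-∀
  r₂ : ∀ n a → 4 * n * (n * a) ≡ 4 * (n * n) * a
  r₂ = solve-∀
  r₃ : ∀ n t a → n * t * a ≡ t * (n * a)
  r₃ = solve-∀
  few : length (lists m) * (4 * t) * n ≤ c * a * L ^ 3
  few = begin
    length (lists m) * (4 * t) * n       ≡⟨ cong (λ k → k * (4 * t) * n) (length-lists m) ⟩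
    t ^ m * (4 * t) * n                  ≡⟨ r₁ (t ^ m) t n ⟩
    4 * n * (t * t ^ m)                  ≤⟨ *-monoʳ-≤ (4 * n) (*-cancelˡ-≤ t ⦃ >-nonZero 0<t ⦄ (≤-trans (Width.t^n≤ t n 0<t (s≤s z≤n)) (≤-reflexive (r₃ n t a)))) ⟩
    4 * n * (n * a)                      ≡⟨ r₂ n a ⟩
    4 * (n * n) * a                      ≤⟨ *-monoˡ-≤ a (≤-trans (*-monoʳ-≤ 4 (*-mono-≤ n≤2^9 n≤2^9)) 2^20≤c) ⟩
    c * a                     ≡⟨ sym (*-identityʳ _) ⟩
    c * a * 1                 ≤⟨ *-monoʳ-≤ (c * a) 1≤L³ ⟩
    c * a * L ^ 3             ∎

-- `g` and `c` stay variables here, so the huge constant is instantiated only at the very end.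
bound : ∀ g c → 512 ≤ g → 2 ^ 20 ≤ c → (∀ L → 1 ≤ L → coefficient L (8 * (2 ^ g) ^ 3) ≤ c * L ^ 3) →
  (n t : ℕ) → 2 ≤ n → 2 ≤ t → A t n ^ n ≤ 2 ^ (n * α t n + c * α t n * ⌈log₂ n ⌉ ^ 3)
bound g c 512≤g 2^20≤c coefficient≤c (suc zero) t (s≤s ()) _
bound g c 512≤g 2^20≤c coefficient≤c (suc (suc m)) t _ 1<t = cases ⌈log₂ 2 + m ⌉ (10 ≤? ⌈log₂ 2 + m ⌉)
  (⌈log₂⌉-mono-≤ {2} {2 + m} (s≤s (s≤s z≤n))) (n≤2^⌈log₂n⌉ (2 + m)) (2^k<n (2 + m))
  where
  cases : ∀ L → Dec (10 ≤ L) → 1 ≤ L → 2 + m ≤ 2 ^ L → (∀ k → k < L → 2 ^ k < 2 + m) →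
    A t (2 + m) ^ (2 + m) ≤ 2 ^ ((2 + m) * α t (2 + m) + c * α t (2 + m) * L ^ 3)
  cases L (no 10≰L) 1≤L n≤ _ = small-bound c t m L 2^20≤c 1<t 1≤L (≰⇒> 10≰L) n≤
  cases L (yes 10≤L) 1≤L n≤ <n = large-bound g c t m L 512≤g 1<t (enough (m≤n⇒∃[o]m+o≡n 10≤L)) n≤ (coefficient≤c L 1≤L)
    where
    enough : ∃ (λ k → 10 + k ≡ L) → 8 * (L + 48) ≤ m
    enough (k , e) = subst (λ l → 8 * (l + 48) ≤ m) (trans (+-comm k 10) e)
      (room m k (<⇒≤ (<n (k + 9) (≤-reflexive (trans (sym (+-suc k 9)) (trans (+-comm k 10) e))))))

constant : ℕ → ℕ
constant g = leading (8 * (2 ^ g) ^ 3) + 2 ^ 20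

2^20≤constant : ∀ g → 2 ^ 20 ≤ constant g
2^20≤constant g = m≤n+m (2 ^ 20) (leading (8 * (2 ^ g) ^ 3))

coefficient≤constant : ∀ g L → 1 ≤ L → coefficient L (8 * (2 ^ g) ^ 3) ≤ constant g * L ^ 3
coefficient≤constant g L 1≤L = ≤-trans (coefficient≤ L (8 * (2 ^ g) ^ 3) 1≤L) (*-monoˡ-≤ (L ^ 3) (m≤m+n (leading (8 * (2 ^ g) ^ 3)) (2 ^ 20)))

-- The inequality multiplied by `n` and exponentiated, so that only naturals occur. For `n ≥ 2` the
-- rounded logarithm is at most twice the true one, which changes only the constant.
theorem1p1 : Σ ℕ (λ c → 1 ≤ c × ((n t : ℕ) → 2 ≤ n → 2 ≤ t →
    A t n ^ n ≤ 2 ^ (n * α t n + c * α t n * ⌈log₂ n ⌉ ^ 3)))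
-- 512 is the least value of `g` that `spread` admits.
theorem1p1 = constant 512 , ≤-trans (m^n>0 2 20) (2^20≤constant 512) ,
  bound 512 (constant 512) ≤-refl (2^20≤constant 512) (coefficient≤constant 512)
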